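{- Let $\Gamma$ be a finite abelian group and let $S\subseteq\Gamma$ be skew-symmetric with $0\notin S$. Then the oriented Cayley graph $\mathrm{Cay}(\Gamma,S)$ is HS-integral if and only if $S\in\mathbb{E}(\Gamma)$.
   Context: $\Gamma$ is written additively; $x^k$ denotes $kx$ and $-x$ is the inverse of $x$. A set $S$ is skew-symmetric if $-a\notin S$ for all $a\in S$. $\mathrm{Cay}(\Gamma,S)$ has vertex set $\Gamma$ and arcs $(a,b)$ with $b-a\in S$. Its Hermitian adjacency matrix of second kind $\mathcal{H}=(h_{uv})$ has $h_{uv}=1$ if both $(u,v)$ and $(v,u)$ are arcs, $h_{uv}=\frac{1+i\sqrt3}{2}$ if only $(u,v)$ is an arc, $h_{uv}=\frac{1-i\sqrt3}{2}$ if only $(v,u)$ is an arc, and $h_{uv}=0$ otherwise. The graph is HS-integral if all eigenvalues of $\mathcal{H}$ are integers. $\Gamma(3)$ is the set of elements of $\Gamma$ whose order is divisible by $3$. For $x\in\Gamma(3)$ with $\mathrm{ord}(x)=m$, put $\langle\!\langle x\rangle\!\rangle=\{x^k:1\le k\le m-1,\ \gcd(k,m)=1,\ k\equiv 1\pmod 3\}$. If $\Gamma(3)\ne\emptyset$, $\mathbb{E}(\Gamma)$ is the set of skew-symmetric subsets of $\Gamma$ of the form $\langle\!\langle x_1\rangle\!\rangle\cup\cdots\cup\langle\!\langle x_k\rangle\!\rangle$ with $x_i\in\Gamma(3)$. If $\Gamma(3)=\emptyset$, then $\mathbb{E}(\Gamma)=\{\emptyset\}$. -}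

module Defs where

open import Data.Nat as ℕ using (ℕ; zero; suc; _<_; _≤_)
open import Data.Nat.Divisibility using (_∣_)
open import Data.Nat.GCD using (gcd)
open import Data.Nat.DivMod using (_%_)
open import Data.Integer as ℤ using (ℤ)
open import Data.Fin using (Fin; zero; suc; punchIn)
open import Data.Fin.Subset using (Subset; _∈_; _∉_)
open import Data.Bool using (Bool; true; false; if_then_else_)
open import Data.List using (List)
open import Data.List.Relation.Unary.All using (All)
open import Data.List.Relation.Unary.Any using (Any)
open import Data.Product using (Σ; ∃; _×_; _,_)
open import Relation.Binary.PropositionalEquality using (_≡_; _≢_)
open import Relation.Nullary using (¬_; Dec; does)
open import Algebra.Structures using (IsAbelianGroup)
open import Function.Bundles using (_⇔_)

-- Eisenstein integers ℤ[ω], ω = (-1 + i√3)/2, ω² = -1 - ω.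
-- An element  re + om·ω .

record ℤω : Set where
  constructor _+_ω
  field
    re : ℤ
    om : ℤ
open ℤω public

infixl 6 _+ω_ _-ω_
infixl 7 _*ω_

_+ω_ : ℤω → ℤω → ℤω
(a + b ω) +ω (c + d ω) = (a ℤ.+ c) + (b ℤ.+ d) ω

-ω_ : ℤω → ℤω
-ω (a + b ω) = (ℤ.- a) + (ℤ.- b) ω

_-ω_ : ℤω → ℤω → ℤω
x -ω y = x +ω (-ω y)

-- (a + bω)(c + dω) = ac + (ad + bc)ω + bd ω² = (ac - bd) + (ad + bc - bd)ω
_*ω_ : ℤω → ℤω → ℤω
(a + b ω) *ω (c + d ω) =
  (a ℤ.* c ℤ.- b ℤ.* d) + (a ℤ.* d ℤ.+ b ℤ.* c ℤ.- b ℤ.* d) ω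

0ω 1ω : ℤω
0ω = ℤ.0ℤ + ℤ.0ℤ ω
1ω = ℤ.1ℤ + ℤ.0ℤ ω

ι : ℤ → ℤω
ι a = a + ℤ.0ℤ ω

-- (1 + i√3)/2 = 1 + ω   and   (1 - i√3)/2 = -ω
ω₆ ω₆̄ : ℤω
ω₆  = ℤ.1ℤ + ℤ.1ℤ ω
ω₆̄ = ℤ.0ℤ + ℤ.-1ℤ ω

sumω : ∀ {m} → (Fin m → ℤω) → ℤω
sumω {zero}  f = 0ω
sumω {suc m} f = f zero +ω sumω (λ i → f (suc i))

prodω : ∀ {m} → (Fin m → ℤω) → ℤω
prodω {zero}  f = 1ω
prodω {suc m} f = f zero *ω prodω (λ i → f (suc i))

altSign : ℕ → ℤω → ℤω
altSign zero          x = x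
altSign (suc zero)    x = -ω x
altSign (suc (suc j)) x = altSign j x

det : ∀ {m} → (Fin m → Fin m → ℤω) → ℤω
det {zero}  M = 1ω
det {suc m} M =
  sumω (λ j → altSign (Data.Fin.toℕ j)
                 (M zero j *ω det (λ i k → M (suc i) (punchIn j k))))

-- Finite abelian groups, presented (up to relabelling) on carrier Fin n,
-- written additively.

record FinAbGroup : Set where
  field
    n   : ℕ
    _⊕_ : Fin n → Fin n → Fin n
    𝟘   : Fin n
    ⊝_  : Fin n → Fin n
    isAbelianGroup : IsAbelianGroup _≡_ _⊕_ 𝟘 ⊝_

module _ (Γ : FinAbGroup) where
  open FinAbGroup Γ

  _⊖_ : Fin n → Fin n → Fin n
  a ⊖ b = a ⊕ (⊝ b)

  pow : ℕ → Fin n → Fin n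
  pow zero    x = 𝟘
  pow (suc k) x = x ⊕ pow k x

  IsOrder : Fin n → ℕ → Set
  IsOrder x m = 0 < m × pow m x ≡ 𝟘 × (∀ k → 0 < k → k < m → pow k x ≢ 𝟘)

  InΓ3 : Fin n → Set
  InΓ3 x = Σ ℕ λ m → IsOrder x m × 3 ∣ m

  In⟪_⟫ : Fin n → Fin n → Set
  In⟪ x ⟫ y = Σ ℕ λ m → IsOrder x m ×
              (Σ ℕ λ k → 1 ≤ k × suc k ≤ m × gcd k m ≡ 1 × k % 3 ≡ 1
                         × y ≡ pow k x)

  SkewSymmetric : Subset n → Set
  SkewSymmetric S = ∀ a → a ∈ S → (⊝ a) ∉ S

  -- S ∈ 𝔼(Γ): S skew-symmetric and S = ⟨⟨x₁⟩⟩ ∪ ⋯ ∪ ⟨⟨x_k⟩⟩ with x_i ∈ Γ(3)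
  -- (k = 0 allowed, giving ∅; this also covers the case Γ(3) = ∅).
  In𝔼 : Subset n → Set
  In𝔼 S = SkewSymmetric S ×
          (Σ (List (Fin n)) λ xs → All InΓ3 xs ×
             (∀ y → (y ∈ S) ⇔ Any (λ x → In⟪ x ⟫ y) xs))

  mem : Subset n → Fin n → Bool
  mem S a = Data.Vec.lookup S a
    where import Data.Vec

  -- Hermitian adjacency matrix of the second kind of Cay(Γ,S);
  -- arc (u,v) iff v - u ∈ S.
  HS : Subset n → Fin n → Fin n → ℤω
  HS S u v with mem S (v ⊖ u) | mem S (u ⊖ v)
  ... | true  | true  = 1ω
  ... | true  | false = ω₆
  ... | false | true  = ω₆̄
  ... | false | false = 0ω

  δ : Fin n → Fin n → ℤω
  δ u v = if does (u Data.Fin.≟ v) then 1ω else 0ω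
    where import Data.Fin

  charPolyAt : (Fin n → Fin n → ℤω) → ℤ → ℤω
  charPolyAt H t = det (λ u v → (ι t *ω δ u v) -ω H u v)

  -- HS-integral: all eigenvalues (roots, with multiplicity, of det(xI - H))
  -- are integers, i.e. det(xI - H) = ∏_u (x - λ_u) with λ_u ∈ ℤ.
  -- Polynomial identity of degree n over the domain ℤ[ω] is stated as
  -- equality at every integer point.
  HSIntegral : Subset n → Set
  HSIntegral S = Σ (Fin n → ℤ) λ λs →
    ∀ (t : ℤ) → charPolyAt (HS S) t ≡ prodω (λ u → ι (t ℤ.- λs u))

{-# OPTIONS --safe #-}
module Submission where

-- In R = ℤ[ω][Γ] put h = Σ_{s∈S} (ω₆ [s] + ω̄₆ [-s]); the Hermitian adjacency matrix is
-- multiplication by h.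
--
-- If S ∈ 𝔼(Γ), then h is a ℤ-combination of the elements W(g) = Σ_{j<m} ψ(j) [j g] with
-- m = ord g divisible by 3 and ψ(j) = 0, ω₆, ω̄₆ according to j mod 3.  Each W = W(g)
-- satisfies W (W - m/3) (W + 2m/3) = 0, so h is annihilated by a product of linear factors
-- x - l with l ∈ ℤ.  Multiplicativity of the determinant makes the characteristic
-- polynomial divide a power of that product, hence it splits over ℤ.
--
-- Conversely, Cayley–Hamilton gives ∏ (h - λ_u) = 0.  For a prime p the Frobenius map gives
-- hᵖ ≡ h⁽ᵖ⁾ := Σ h(g)ᵖ [p g] modulo p, and hᵖ - h ≡ (h - l)((h - l)ᵖ⁻¹ - 1) for every integer
-- l, so h⁽ᵖ⁾ - h is nilpotent modulo p.  Only finitely many elements h⁽ᵖ⁾ - h occur, so for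
-- large p it is nilpotent, hence 0, being self-adjoint.  Every residue class prime to the
-- order of an element has a representative with only large prime factors, so S is closed
-- under multiplication by all k ≡ 1 modulo 3 prime to the order.

open import Defs
open import Level using (0ℓ)
open import Algebra.Bundles using (AbelianGroup; CommutativeRing; RawRing)
open import Algebra.Structures using (IsCommutativeRing)
open import Algebra.Solver.Ring.AlmostCommutativeRing using (AlmostCommutativeRing; fromCommutativeRing; _-Raw-AlmostCommutative⟶_)
import Algebra.Properties.AbelianGroup
import Algebra.Properties.CommutativeSemiring.Binomial
import Algebra.Properties.CommutativeSemiring.Exp
import Algebra.Properties.Group
import Algebra.Properties.Ring
import Algebra.Properties.Semiring.Mult
import Algebra.Properties.Semiring.Mult.TCOptimised
import Algebra.Properties.Semiring.Sum
import Algebra.Solver.Ring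
open import Data.Bool using (Bool; true; false; if_then_else_)
open import Data.Empty using (⊥; ⊥-elim)
open import Data.Fin as Fin using (Fin; zero; suc; toℕ; punchIn)
open import Data.Fin.Permutation using (Permutation; permutation)
import Data.Fin.Properties as Finₚ
open import Data.Fin.Subset using (Subset; _∉_) renaming (_∈_ to _∈ₛ_)
open import Data.Fin.Subset.Properties using () renaming (_∈?_ to _∈ₛ?_)
open import Data.Integer as ℤ using (ℤ; -[1+_]) renaming (+_ to pos)
import Data.Integer.Properties as ℤₚ
open import Data.Integer.Solver using (module +-*-Solver)
open import Data.List as List using (List; []; _∷_; _++_; length)
open import Data.List.Membership.Propositional using (_∈_; lose; find)
open import Data.List.Membership.Propositional.Properties using (∈-∃++; ∈-allFin; ∈-filter⁺; ∈-filter⁻)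
import Data.List.Properties as Listₚ
open import Data.List.Relation.Unary.All as All using (All; []; _∷_)
open import Data.List.Relation.Unary.Any using (Any; here; there)
open import Data.Maybe using (Maybe; just; nothing)
open import Data.Nat as ℕ using (ℕ; zero; suc; z≤n; s≤s)
open import Data.Nat.Combinatorics using (_C_; nCn≡1; nCk+nC[k+1]≡[n+1]C[k+1]; nC1≡n)
open import Data.Nat.Coprimality as Coprimality using (Coprime; coprime?; coprime-Bézout; coprime-divisor; coprime⇒gcd≡1; gcd≡1⇒coprime; prime⇒coprime)
open import Data.Nat.Divisibility using (_∣_; _∤_; divides; _∣?_; ∣-trans; ∣⇒≤; ∣m⇒∣m*n; ∣n⇒∣m*n; m%n≡0⇒n∣m; n∣m⇒m%n≡0; ∣m+n∣m⇒∣n; ∣m∣n⇒∣m+n; n∣m*n; m∣m*n; ∣1⇒≡1; *-cancelʳ-∣)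
open import Data.Nat.DivMod using (_%_; _/_; m≡m%n+[m/n]*n; m%n<n; [m+kn]%n≡m%n; %-distribˡ-*; %-distribˡ-+; m∣n⇒o%n%m≡o%m)
open import Data.Nat.GCD using (module Bézout)
open import Data.Nat.ListAction using (product)
open import Data.Nat.ListAction.Properties using (∈⇒∣product)
open import Data.Nat.Primality using (Prime; prime?; euclidsLemma; prime⇒irreducible; prime⇒nonZero; ¬prime[1])
open import Data.Nat.Primality.Factorisation using (factorise; PrimeFactorisation)
import Data.Nat.Properties as ℕₚ
open import Data.Nat.Tactic.RingSolver using (solve-∀)
open import Data.Product using (Σ; ∃; _×_; _,_; proj₁; proj₂)
open import Data.Sum as Sum using (_⊎_; inj₁; inj₂)
open import Data.Vec as Vec using (Vec; []; _∷_)
import Data.Vec.Properties as Vecₚ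
open import Function using (_∘_; id)
open import Function.Bundles using (_⇔_; mk⇔; Equivalence)
open import Relation.Binary using (tri<; tri≈; tri>)
open import Relation.Binary.PropositionalEquality using (_≡_; _≢_; refl; sym; trans; cong; cong₂; subst; isEquivalence; module ≡-Reasoning)
open import Relation.Nullary using (¬_; Dec; yes; no; does)
open import Relation.Nullary.Decidable using (dec-true; dec-false; from-yes)

-- Eigenvalues and characters are avoided: both directions meet in the statement that h is
-- annihilated by a product of factors x - l with integers l, which makes sense inside ℤ[ω][Γ]. The
-- three factors for W still come from characters: at the cube roots of unity 1, ω, ω² the
-- expression ω₆ y + ω̄₆ y² takes the values 1, -2, 1, and the remaining geometric sum contributes 0
-- or m/3. The group algebra has zero divisors, so determinants are developed over arbitrary
-- commutative rings, and Cayley-Hamilton comes from a kernel vector. Characteristic polynomials are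
-- given only by their values at integers; coefficients are recovered because an element of ℤ[ω]
-- divisible by all large integers is 0. The values of h are 0 or sixth roots of unity, so h⁽ᵖ⁾
-- depends only on p modulo a fixed number; this is the source of the finiteness. Self-adjoint
-- nilpotents vanish by positivity: the coefficient of a² at the neutral element is the sum of the
-- norms of all coefficients of a. Multipliers are replaced by numbers with only large prime
-- factors, which can be built by hand, where large primes would call for Dirichlet's theorem.

-- Commutative rings with propositional equality, and the integers inside them

record CRing : Set₁ where
  field
    Carrier : Set
    _+_ _*_ : Carrier → Carrier → Carrier
    -_      : Carrier → Carrier
    0# 1#   : Carrier
    isCommutativeRing : IsCommutativeRing _≡_ _+_ _*_ -_ 0# 1#

  commutativeRing : CommutativeRing 0ℓ 0ℓ
  commutativeRing = record { isCommutativeRing = isCommutativeRing }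

module RingKit (R : CRing) where
  open CommutativeRing (CRing.commutativeRing R) public
    using (Carrier; _+_; _*_; -_; _-_; 0#; 1#; semiring; ring; commutativeSemiring;
           +-identityˡ; +-identityʳ; +-assoc; +-comm; *-identityˡ; *-identityʳ; *-assoc; *-comm;
           distribˡ; distribʳ; zeroˡ; zeroʳ; -‿inverseˡ; -‿inverseʳ)
  open Algebra.Properties.Ring ring public
    using (-‿distribˡ-*; -‿distribʳ-*; -0#≈0#; -‿involutive; -‿+-comm)
  open Algebra.Properties.Semiring.Sum semiring public
    using (sum; sum-cong-≗; ∑-distrib-+; ∑-comm; sum-permute; sum-init-last; *-distribˡ-sum; *-distribʳ-sum; sum-replicate-zero)
  open Algebra.Properties.CommutativeSemiring.Exp commutativeSemiring public
    using (_^_; ^-homo-*; ^-assocʳ)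
  private
    module M = Algebra.Properties.Semiring.Mult.TCOptimised semiring

  1^ : ∀ k → 1# ^ k ≡ 1#
  1^ zero    = refl
  1^ (suc k) = trans (*-identityˡ _) (1^ k)

  -- The optimised multiple makes `fromℕ 0` and `fromℕ 1` reduce to `0#` and `1#`, so the
  -- coefficient map of the solver preserves both by `refl`.
  fromℕ : ℕ → Carrier
  fromℕ n = n M.× 1#

  fromℤ : ℤ → Carrier
  fromℤ (pos n)      = fromℕ n
  fromℤ (-[1+ n ]) = - fromℕ (suc n)

  fromℕ-+ : ∀ m n → fromℕ (m ℕ.+ n) ≡ fromℕ m + fromℕ n
  fromℕ-+ = M.×-homo-+ 1#

  fromℕ-* : ∀ m n → fromℕ (m ℕ.* n) ≡ fromℕ m * fromℕ n
  fromℕ-* = M.×1-homo-*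

  fromℤ-neg : ∀ i → fromℤ (ℤ.- i) ≡ - fromℤ i
  fromℤ-neg (pos zero)   = sym -0#≈0#
  fromℤ-neg (pos (suc n))  = refl
  fromℤ-neg (-[1+ n ]) = sym (-‿involutive _)

  fromℤ-⊖ : ∀ m n → fromℤ (m ℤ.⊖ n) ≡ fromℕ m + - fromℕ n
  fromℤ-⊖ m       zero    = sym (trans (cong (fromℕ m +_) -0#≈0#) (+-identityʳ _))
  fromℤ-⊖ zero    (suc n) = sym (+-identityˡ _)
  fromℤ-⊖ (suc m) (suc n) = begin
    fromℤ (suc m ℤ.⊖ suc n)                   ≡⟨ cong fromℤ (ℤₚ.[1+m]⊖[1+n]≡m⊖n m n) ⟩
    fromℤ (m ℤ.⊖ n)                           ≡⟨ fromℤ-⊖ m n ⟩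
    fromℕ m + - fromℕ n                       ≡⟨ cong (_+ - fromℕ n) (+-identityʳ _) ⟨
    fromℕ m + 0# + - fromℕ n                  ≡⟨ cong (λ z → fromℕ m + z + - fromℕ n) (-‿inverseʳ 1#) ⟨
    fromℕ m + (1# + - 1#) + - fromℕ n         ≡⟨ cong (_+ - fromℕ n) (+-assoc _ _ _) ⟨
    fromℕ m + 1# + - 1# + - fromℕ n           ≡⟨ +-assoc _ _ _ ⟩
    fromℕ m + 1# + (- 1# + - fromℕ n)         ≡⟨ cong₂ _+_ (+-comm _ _) (-‿+-comm _ _) ⟩
    1# + fromℕ m + - (1# + fromℕ n)           ≡⟨ cong₂ (λ a b → a + - b) (M.1+× m 1#) (M.1+× n 1#) ⟨
    fromℕ (suc m) + - fromℕ (suc n)           ∎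
    where open ≡-Reasoning

  fromℤ-+ : ∀ i j → fromℤ (i ℤ.+ j) ≡ fromℤ i + fromℤ j
  fromℤ-+ (pos m)      (pos n)      = fromℕ-+ m n
  fromℤ-+ (pos m)      (-[1+ n ]) = fromℤ-⊖ m (suc n)
  fromℤ-+ (-[1+ m ]) (pos n)      = trans (fromℤ-⊖ n (suc m)) (+-comm _ _)
  fromℤ-+ (-[1+ m ]) (-[1+ n ]) =
    trans (cong (λ k → - fromℕ (suc k)) (sym (ℕₚ.+-suc m n)))
      (trans (cong -_ (fromℕ-+ (suc m) (suc n))) (sym (-‿+-comm _ _)))

  fromℤ-*⁺ : ∀ m j → fromℤ (pos m ℤ.* j) ≡ fromℕ m * fromℤ j
  fromℤ-*⁺ m (pos n)      = trans (cong fromℤ (sym (ℤₚ.pos-* m n))) (fromℕ-* m n)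
  fromℤ-*⁺ m (-[1+ n ]) = begin
    fromℤ (pos m ℤ.* (ℤ.- (pos (suc n))))   ≡⟨ cong fromℤ (ℤₚ.neg-distribʳ-* (pos m) (pos (suc n))) ⟨
    fromℤ (ℤ.- (pos m ℤ.* pos (suc n)))     ≡⟨ fromℤ-neg (pos m ℤ.* pos (suc n)) ⟩
    - fromℤ (pos m ℤ.* pos (suc n))         ≡⟨ cong -_ (fromℤ-*⁺ m (pos (suc n))) ⟩
    - (fromℕ m * fromℕ (suc n))       ≡⟨ -‿distribʳ-* _ _ ⟩
    fromℕ m * - fromℕ (suc n)         ∎
    where open ≡-Reasoning

  fromℤ-* : ∀ i j → fromℤ (i ℤ.* j) ≡ fromℤ i * fromℤ j
  fromℤ-* (pos m)      j = fromℤ-*⁺ m j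
  fromℤ-* (-[1+ m ]) j = begin
    fromℤ ((ℤ.- (pos (suc m))) ℤ.* j)     ≡⟨ cong fromℤ (ℤₚ.neg-distribˡ-* (pos (suc m)) j) ⟨
    fromℤ (ℤ.- (pos (suc m) ℤ.* j))       ≡⟨ fromℤ-neg (pos (suc m) ℤ.* j) ⟩
    - fromℤ (pos (suc m) ℤ.* j)           ≡⟨ cong -_ (fromℤ-*⁺ (suc m) j) ⟩
    - (fromℕ (suc m) * fromℤ j)       ≡⟨ -‿distribˡ-* _ _ ⟩
    - fromℕ (suc m) * fromℤ j         ∎
    where open ≡-Reasoning

  private
    ACR : AlmostCommutativeRing 0ℓ 0ℓ
    ACR = fromCommutativeRing (CRing.commutativeRing R)

    ℤ-raw : RawRing 0ℓ 0ℓ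
    ℤ-raw = CommutativeRing.rawRing ℤₚ.+-*-commutativeRing

    ℤ⟶R : ℤ-raw -Raw-AlmostCommutative⟶ ACR
    ℤ⟶R = record
      { ⟦_⟧    = fromℤ
      ; +-homo = fromℤ-+
      ; *-homo = fromℤ-*
      ; -‿homo = fromℤ-neg
      ; 0-homo = refl
      ; 1-homo = refl
      }

    -- Coefficients are compared as integers, since equality in an abstract ring need not be
    -- decidable.
    ≟-weak : ∀ i j → Maybe (fromℤ i ≡ fromℤ j)
    ≟-weak i j with i ℤₚ.≟ j
    ... | yes i≡j = just (cong fromℤ i≡j)
    ... | no _    = nothing

  open Algebra.Solver.Ring ℤ-raw ACR ℤ⟶R ≟-weak public
    using (solve; _:=_; _:+_; _:*_; _:-_; :-_; con; _:^_) renaming (Polynomial to Expression)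

  :0 :1 : ∀ {n} → Expression n
  :0 = con ℤ.0ℤ
  :1 = con ℤ.1ℤ

-- Determinants

-- Raw operations suffice for the expansion; it is also run on coefficient lists, where trailing
-- zeros break the ring laws up to `≡`.
module RawDeterminant {A : Set} (_+_ _*_ : A → A → A) (-_ : A → A) (0# 1# : A) where

  -- Laplace expansion of a function G of lists along the form φ:
  -- Σⱼ (-1)ʲ φ(vⱼ) G(v without vⱼ).
  laplace : ∀ {V : Set} → (V → A) → (List V → A) → List V → A
  laplace φ G []       = 0#
  laplace φ G (x ∷ vs) = (φ x * G vs) + (- laplace φ (G ∘ (x ∷_)) vs)

  -- Expansion of a list of columns along the first row. The value `0#` on surplus columns of height
  -- zero keeps even `det′ zero` alternating.
  det′ : ∀ n → List (Vec A n) → A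
  det′ zero    []      = 1#
  det′ zero    (_ ∷ _) = 0#
  det′ (suc n) cs      = laplace Vec.head (det′ n ∘ List.map Vec.tail) cs

  laplace-map : ∀ {V W : Set} (f : W → V) (φ : V → A) (G : List V → A) ws →
                laplace φ G (List.map f ws) ≡ laplace (φ ∘ f) (G ∘ List.map f) ws
  laplace-map f φ G []       = refl
  laplace-map f φ G (w ∷ ws) = cong (λ z → (φ (f w) * G (List.map f ws)) + (- z)) (laplace-map f φ (G ∘ (f w ∷_)) ws)

  laplace-cong : ∀ {V : Set} (φ : V → A) (G G′ : List V → A) vs →
                 (∀ ws → suc (length ws) ≡ length vs → G ws ≡ G′ ws) →
                 laplace φ G vs ≡ laplace φ G′ vs
  laplace-cong φ G G′ []       eq = refl
  laplace-cong φ G G′ (x ∷ vs) eq = cong₂ (λ p q → p + (- q)) (cong (φ x *_) (eq vs refl))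
    (laplace-cong φ _ _ vs λ ws l → eq (x ∷ ws) (cong suc l))

  det′-map : ∀ {T : Set} (f : T → A) n (cs : List (Vec T (suc n))) →
             det′ (suc n) (List.map (Vec.map f) cs)
               ≡ laplace (f ∘ Vec.head) (λ ds → det′ n (List.map (Vec.map f) (List.map Vec.tail ds))) cs
  det′-map f n cs = trans (laplace-map (Vec.map f) Vec.head _ cs)
    (trans (laplace-cong _ _ _ cs λ ds _ → cong (det′ n)
              (trans (sym (Listₚ.map-∘ ds)) (trans (Listₚ.map-cong (λ { (_ ∷ _) → refl }) ds) (Listₚ.map-∘ ds))))
           (head-map cs _))
    where
    head-map : ∀ cs (G : List (Vec _ (suc n)) → A) →
               laplace (Vec.head ∘ Vec.map f) G cs ≡ laplace (f ∘ Vec.head) G cs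
    head-map []             G = refl
    head-map ((x ∷ c) ∷ cs) G = cong (λ z → (f x * G cs) + (- z)) (head-map cs _)

-- The degree k lets the relation also speak about leading coefficients.
module DeterminantRelation
  {A B : Set} (_+₁_ _*₁_ : A → A → A) (-₁_ : A → A) (0₁ 1₁ : A)
  (_+₂_ _*₂_ : B → B → B) (-₂_ : B → B) (0₂ 1₂ : B)
  {T : Set} (α : T → A) (β : T → B) (_~[_]_ : A → ℕ → B → Set)
  (~-zero : ∀ k → 0₁ ~[ k ] 0₂) (~-one : 1₁ ~[ 0 ] 1₂)
  (~-step : ∀ t k {x y z w} → x ~[ k ] y → z ~[ suc k ] w →
            ((α t *₁ x) +₁ (-₁ z)) ~[ suc k ] ((β t *₂ y) +₂ (-₂ w)))
  where
  private
    module D₁ = RawDeterminant _+₁_ _*₁_ -₁_ 0₁ 1₁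
    module D₂ = RawDeterminant _+₂_ _*₂_ -₂_ 0₂ 1₂

  laplace-rel : ∀ {V : Set} (f : V → T) k (G : List V → A) (G′ : List V → B) →
                (∀ ws → G ws ~[ k ] G′ ws) →
                ∀ vs → D₁.laplace (α ∘ f) G vs ~[ suc k ] D₂.laplace (β ∘ f) G′ vs
  laplace-rel f k G G′ r []       = ~-zero (suc k)
  laplace-rel f k G G′ r (x ∷ vs) = ~-step (f x) k (r vs) (laplace-rel f k _ _ (r ∘ (x ∷_)) vs)

  det′-rel : ∀ n (cs : List (Vec T n)) →
             D₁.det′ n (List.map (Vec.map α) cs) ~[ n ] D₂.det′ n (List.map (Vec.map β) cs)
  det′-rel zero    []      = ~-one
  det′-rel zero    (_ ∷ _) = ~-zero 0
  det′-rel (suc n) cs rewrite D₁.det′-map α n cs | D₂.det′-map β n cs =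
    laplace-rel Vec.head n _ _ (λ ds → det′-rel n (List.map Vec.tail ds)) cs

module Determinant (R : CRing) where
  open RingKit R
  open RawDeterminant _+_ _*_ -_ 0# 1# public

  laplace-0 : ∀ {V : Set} (φ : V → Carrier) (vs : List V) → laplace φ (λ _ → 0#) vs ≡ 0#
  laplace-0 φ []       = refl
  laplace-0 φ (x ∷ vs) = trans (cong (λ z → φ x * 0# - z) (laplace-0 φ vs))
    (solve 1 (λ a → a :* :0 :- :0 := :0) refl (φ x))

  laplace-linear : ∀ {V : Set} (φ : V → Carrier) (a : Carrier) (G G′ : List V → Carrier) vs →
                   laplace φ (λ ws → a * G ws + G′ ws) vs ≡ a * laplace φ G vs + laplace φ G′ vs
  laplace-linear φ a G G′ []       = solve 1 (λ a → :0 := a :* :0 :+ :0) refl a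
  laplace-linear φ a G G′ (x ∷ vs) =
    trans (cong (λ z → φ x * (a * G vs + G′ vs) - z) (laplace-linear φ a (G ∘ (x ∷_)) (G′ ∘ (x ∷_)) vs))
      (solve 6 (λ p a g g′ l l′ → p :* (a :* g :+ g′) :- (a :* l :+ l′)
                                  := a :* (p :* g :- l) :+ (p :* g′ :- l′))
        refl (φ x) a (G vs) (G′ vs) _ _)

  laplace-scale : ∀ {V : Set} (φ : V → Carrier) (a : Carrier) (G : List V → Carrier) vs →
                  laplace φ (λ ws → a * G ws) vs ≡ a * laplace φ G vs
  laplace-scale φ a G []       = sym (zeroʳ a)
  laplace-scale φ a G (x ∷ vs) =
    trans (cong (λ z → φ x * (a * G vs) - z) (laplace-scale φ a (G ∘ (x ∷_)) vs))
      (solve 4 (λ p a g l → p :* (a :* g) :- a :* l := a :* (p :* g :- l)) refl (φ x) a (G vs) _)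

  module Alternating {V : Set} (0ᵥ : V) (_+ᵥ_ : V → V → V) (_·_ : Carrier → V → V) where

    -- The operations on V carry no laws, so vanishing at `0ᵥ` is a field of its own. Only adjacent
    -- repetitions are required; `swap` brings distant ones together.
    record Alt (G : List V → Carrier) : Set where
      field
        linear : ∀ pre a x y vs →
                 G (pre ++ ((a · x) +ᵥ y) ∷ vs) ≡ a * G (pre ++ x ∷ vs) + G (pre ++ y ∷ vs)
        zeroes : ∀ pre vs → G (pre ++ 0ᵥ ∷ vs) ≡ 0#
        repeat : ∀ pre x vs → G (pre ++ x ∷ x ∷ vs) ≡ 0#
    open Alt

    record Linear (φ : V → Carrier) : Set where
      field
        linear : ∀ a x y → φ ((a · x) +ᵥ y) ≡ a * φ x + φ y
        zeroes : φ 0ᵥ ≡ 0#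

    Alt-∷ : ∀ {G} x → Alt G → Alt (G ∘ (x ∷_))
    Alt-∷ x A .linear pre = A .linear (x ∷ pre)
    Alt-∷ x A .zeroes pre = A .zeroes (x ∷ pre)
    Alt-∷ x A .repeat pre = A .repeat (x ∷ pre)

    module _ {φ : V → Carrier} (Φ : Linear φ) where
      private module Φ = Linear Φ

      laplace-lin : ∀ {G} → Alt G → ∀ pre a x y vs →
        laplace φ G (pre ++ ((a · x) +ᵥ y) ∷ vs)
          ≡ a * laplace φ G (pre ++ x ∷ vs) + laplace φ G (pre ++ y ∷ vs)
      laplace-lin {G} A []        a x y vs = begin
        φ ((a · x) +ᵥ y) * G vs - laplace φ (λ ws → G (((a · x) +ᵥ y) ∷ ws)) vs
          ≡⟨ cong₂ (λ p l → p * G vs - l) (Φ.linear a x y)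
               (trans (laplace-cong φ _ _ vs λ ws _ → A .linear [] a x y ws) (laplace-linear φ a _ _ vs)) ⟩
        (a * φ x + φ y) * G vs - (a * laplace φ (G ∘ (x ∷_)) vs + laplace φ (G ∘ (y ∷_)) vs)
          ≡⟨ solve 6 (λ a p q g l m → (a :* p :+ q) :* g :- (a :* l :+ m)
                                      := a :* (p :* g :- l) :+ (q :* g :- m)) refl a (φ x) (φ y) (G vs) _ _ ⟩
        _ ∎
        where open ≡-Reasoning
      laplace-lin {G} A (w ∷ pre) a x y vs =
        trans (cong₂ (λ g l → φ w * g - l) (A .linear pre a x y vs)
                (laplace-lin (Alt-∷ w A) pre a x y vs))
          (solve 6 (λ p a g h l m → p :* (a :* g :+ h) :- (a :* l :+ m)
                                    := a :* (p :* g :- l) :+ (p :* h :- m)) refl (φ w) a _ _ _ _)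

      laplace-zeroes : ∀ {G} → Alt G → ∀ pre vs → laplace φ G (pre ++ 0ᵥ ∷ vs) ≡ 0#
      laplace-zeroes {G} A []        vs =
        trans (cong₂ (λ p l → p * G vs - l) Φ.zeroes
                (trans (laplace-cong φ _ _ vs λ ws _ → A .zeroes [] ws) (laplace-0 φ vs)))
          (solve 1 (λ g → :0 :* g :- :0 := :0) refl (G vs))
      laplace-zeroes {G} A (w ∷ pre) vs =
        trans (cong₂ (λ g l → φ w * g - l) (A .zeroes pre vs) (laplace-zeroes (Alt-∷ w A) pre vs))
          (solve 1 (λ p → p :* :0 :- :0 := :0) refl (φ w))

      -- Removing either of the two equal columns leaves the same list, and these two terms have
      -- opposite signs; every other term keeps both columns and vanishes.
      laplace-repeat : ∀ {G} → Alt G → ∀ pre x vs → laplace φ G (pre ++ x ∷ x ∷ vs) ≡ 0#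
      laplace-repeat {G} A []        x vs =
        trans (cong (λ l → φ x * G (x ∷ vs) - (φ x * G (x ∷ vs) - l))
                (trans (laplace-cong φ _ _ vs λ ws _ → A .repeat [] x ws) (laplace-0 φ vs)))
          (solve 1 (λ p → p :- (p :- :0) := :0) refl (φ x * G (x ∷ vs)))
      laplace-repeat {G} A (w ∷ pre) x vs =
        trans (cong₂ (λ g l → φ w * g - l) (A .repeat pre x vs) (laplace-repeat (Alt-∷ w A) pre x vs))
          (solve 1 (λ p → p :* :0 :- :0 := :0) refl (φ w))

      laplace-Alt : ∀ {G} → Alt G → Alt (laplace φ G)
      laplace-Alt A .linear = laplace-lin A
      laplace-Alt A .zeroes = laplace-zeroes A
      laplace-Alt A .repeat = laplace-repeat A

    -- Polarisation: G vanishes on the repeated argument x + y, and expanding leaves only the two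
    -- mixed terms because the pure ones repeat x or y.
    swap : ∀ {G} → Alt G → ∀ x y vs → G (x ∷ y ∷ vs) ≡ - G (y ∷ x ∷ vs)
    swap {G} A x y vs = begin
      G (x ∷ y ∷ vs)
        ≡⟨ solve 2 (λ p q → p := (:1 :* (:1 :* :0 :+ p) :+ (:1 :* q :+ :0)) :- q)
             refl (G (x ∷ y ∷ vs)) (G (y ∷ x ∷ vs)) ⟩
      (1# * (1# * 0# + G (x ∷ y ∷ vs)) + (1# * G (y ∷ x ∷ vs) + 0#)) - G (y ∷ x ∷ vs)
        ≡⟨ cong (_- G (y ∷ x ∷ vs)) (begin
             1# * (1# * 0# + G (x ∷ y ∷ vs)) + (1# * G (y ∷ x ∷ vs) + 0#)
               ≡⟨ cong₂ (λ p q → 1# * (1# * p + G (x ∷ y ∷ vs)) + (1# * G (y ∷ x ∷ vs) + q))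
                    (A .repeat [] x vs) (A .repeat [] y vs) ⟨
             1# * (1# * G (x ∷ x ∷ vs) + G (x ∷ y ∷ vs)) + (1# * G (y ∷ x ∷ vs) + G (y ∷ y ∷ vs))
               ≡⟨ cong₂ (λ p q → 1# * p + q) (A .linear (x ∷ []) 1# x y vs) (A .linear (y ∷ []) 1# x y vs) ⟨
             1# * G (x ∷ z ∷ vs) + G (y ∷ z ∷ vs)
               ≡⟨ A .linear [] 1# x y (z ∷ vs) ⟨
             G (z ∷ z ∷ vs)
               ≡⟨ A .repeat [] z vs ⟩
             0# ∎) ⟩
      0# - G (y ∷ x ∷ vs)
        ≡⟨ +-identityˡ _ ⟩
      - G (y ∷ x ∷ vs) ∎
      where
      open ≡-Reasoning
      z = (1# · x) +ᵥ y

    repeat-apart : ∀ {G} → Alt G → ∀ pre x vs → G (x ∷ pre ++ x ∷ vs) ≡ 0#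
    repeat-apart A []        x vs = A .repeat [] x vs
    repeat-apart A (w ∷ pre) x vs =
      trans (swap A x w _) (trans (cong -_ (repeat-apart (Alt-∷ w A) pre x vs)) -0#≈0#)

    -- When a multiple of the same e is added to every argument, a term using e twice vanishes, so
    -- the expansion stops at first order. Moving e to the front past one argument costs a sign,
    -- which produces the signs of `laplace`.
    expand : ∀ {G} → Alt G → ∀ e (ps : List (Carrier × V)) →
      G (List.map (λ p → (proj₁ p · e) +ᵥ proj₂ p) ps)
        ≡ G (List.map proj₂ ps) + laplace proj₁ (λ qs → G (e ∷ List.map proj₂ qs)) ps
    expand         A e []             = sym (+-identityʳ _)
    expand {G} A e ((a , x) ∷ ps) = begin
      G (((a · e) +ᵥ x) ∷ ys)
        ≡⟨ A .linear [] a e x ys ⟩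
      a * G (e ∷ ys) + G (x ∷ ys)
        ≡⟨ cong₂ (λ p q → a * p + q)
             (trans (expand (Alt-∷ e A) e ps)
               (cong (G (e ∷ xs) +_)
                 (trans (laplace-cong proj₁ _ _ ps λ qs _ → A .repeat [] e _) (laplace-0 proj₁ ps))))
             (trans (expand (Alt-∷ x A) e ps)
               (cong (G (x ∷ xs) +_)
                 (trans (laplace-cong proj₁ _ _ ps λ qs _ → trans (swap A x e _) (neg _)) (laplace-scale proj₁ (- 1#) _ ps)))) ⟩
      a * (G (e ∷ xs) + 0#) + (G (x ∷ xs) + (- 1#) * l)
        ≡⟨ solve 4 (λ a g h l → a :* (g :+ :0) :+ (h :+ (:- :1) :* l)
                                := h :+ (a :* g :- l)) refl a (G (e ∷ xs)) (G (x ∷ xs)) l ⟩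
      G (x ∷ xs) + (a * G (e ∷ xs) - l) ∎
      where
      open ≡-Reasoning
      ys = List.map (λ p → (proj₁ p · e) +ᵥ proj₂ p) ps
      xs = List.map proj₂ ps
      l = laplace proj₁ (λ qs → G (e ∷ x ∷ List.map proj₂ qs)) ps
      neg : ∀ u → - u ≡ (- 1#) * u
      neg = solve 1 (λ u → :- u := (:- :1) :* u) refl

    comb : ∀ {m} → Vec V m → Vec Carrier m → V
    comb []       []       = 0ᵥ
    comb (e ∷ es) (a ∷ as) = (a · e) +ᵥ comb es as

    expand-comb : ∀ {G} → Alt G → ∀ {m} e (es : Vec V m) (cs : List (Vec Carrier (suc m))) →
      G (List.map (comb (e ∷ es)) cs)
        ≡ G (List.map (comb es) (List.map Vec.tail cs))
          + laplace Vec.head (λ ds → G (e ∷ List.map (comb es) (List.map Vec.tail ds))) cs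
    expand-comb {G} A {m} e es cs = begin
      G (List.map (comb (e ∷ es)) cs)
        ≡⟨ cong G (trans (Listₚ.map-cong (λ { (a ∷ as) → refl }) cs) (Listₚ.map-∘ cs)) ⟩
      G (List.map (λ p → (proj₁ p · e) +ᵥ proj₂ p) (List.map pair cs))
        ≡⟨ expand A e (List.map pair cs) ⟩
      G (List.map proj₂ (List.map pair cs)) + laplace proj₁ (λ qs → G (e ∷ List.map proj₂ qs)) (List.map pair cs)
        ≡⟨ cong₂ _+_ (cong G (proj₂-pair cs))
             (trans (laplace-map pair proj₁ _ cs)
               (laplace-cong Vec.head _ _ cs λ ds _ → cong (λ z → G (e ∷ z)) (proj₂-pair ds))) ⟩
      _ ∎
      where
      open ≡-Reasoning
      pair : Vec Carrier (suc m) → Carrier × V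
      pair c = Vec.head c , comb es (Vec.tail c)
      proj₂-pair : ∀ ds → List.map proj₂ (List.map pair ds) ≡ List.map (comb es) (List.map Vec.tail ds)
      proj₂-pair ds = trans (sym (Listₚ.map-∘ ds)) (Listₚ.map-∘ ds)

    -- Peeling off e leaves either a term without e or terms in which one argument is spent on e; in
    -- both the arguments still outnumber the remaining vectors. In the end some argument is the
    -- empty combination `0ᵥ`.
    Alt-dependent : ∀ {G} → Alt G → ∀ {m} (es : Vec V m) (cs : List (Vec Carrier m)) → m ℕ.< length cs →
                    G (List.map (comb es) cs) ≡ 0#
    Alt-dependent A {zero}  []       ([] ∷ cs) lt = A .zeroes [] _
    Alt-dependent {G} A {suc m} (e ∷ es) cs lt = begin
      G (List.map (comb (e ∷ es)) cs)
        ≡⟨ expand-comb A e es cs ⟩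
      _ ≡⟨ cong₂ _+_ (Alt-dependent A es (List.map Vec.tail cs)
                        (subst (m ℕ.<_) (sym (Listₚ.length-map Vec.tail cs)) (ℕₚ.<-trans (ℕₚ.n<1+n m) lt)))
             (trans (laplace-cong Vec.head _ _ cs λ ds l →
                       Alt-dependent (Alt-∷ e A) es (List.map Vec.tail ds)
                         (subst (m ℕ.<_) (sym (Listₚ.length-map Vec.tail ds))
                           (ℕₚ.≤-pred (subst (suc m ℕ.<_) (sym l) lt))))
               (laplace-0 Vec.head cs)) ⟩
      0# + 0# ≡⟨ +-identityˡ 0# ⟩
      0# ∎
      where open ≡-Reasoning

    -- Uniqueness of the determinant among alternating forms. The term without e has too many
    -- arguments for the remaining vectors and drops out; what is left is the Laplace expansion of
    -- `det′`. Taking `det′` itself for G gives multiplicativity.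
    Alt-det : ∀ {G} → Alt G → ∀ {m} (es : Vec V m) (cs : List (Vec Carrier m)) → length cs ≡ m →
              G (List.map (comb es) cs) ≡ det′ m cs * G (Vec.toList es)
    Alt-det     A {zero}  []       []       l = sym (*-identityˡ _)
    Alt-det {G} A {suc m} (e ∷ es) cs       l = begin
      G (List.map (comb (e ∷ es)) cs)
        ≡⟨ expand-comb A e es cs ⟩
      _ ≡⟨ cong₂ _+_ (Alt-dependent A es (List.map Vec.tail cs)
                        (subst (m ℕ.<_) (sym (trans (Listₚ.length-map Vec.tail cs) l)) (ℕₚ.n<1+n m)))
             (trans (laplace-cong Vec.head _ _ cs λ ds l′ →
                       trans (Alt-det (Alt-∷ e A) es (List.map Vec.tail ds)
                               (trans (Listₚ.length-map Vec.tail ds) (ℕₚ.suc-injective (trans l′ l))))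
                         (*-comm _ _))
               (laplace-scale Vec.head (G (e ∷ Vec.toList es)) _ cs)) ⟩
      0# + G (e ∷ Vec.toList es) * det′ (suc m) cs
        ≡⟨ trans (+-identityˡ _) (*-comm _ _) ⟩
      det′ (suc m) cs * G (e ∷ Vec.toList es) ∎
      where open ≡-Reasoning

    Alt-comb : ∀ {G} → Alt G → ∀ cs {m} (es : Vec V m) bs → All (λ e → e ∈ cs) (Vec.toList es) →
               G (comb es bs ∷ cs) ≡ 0#
    Alt-comb A cs [] [] [] = A .zeroes [] cs
    Alt-comb {G} A cs (e ∷ es) (b ∷ bs) (e∈ ∷ es∈) with ∈-∃++ e∈
    ... | pre , vs , refl = begin
      G (((b · e) +ᵥ comb es bs) ∷ cs)         ≡⟨ A .linear [] b e _ cs ⟩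
      b * G (e ∷ cs) + G (comb es bs ∷ cs)     ≡⟨ cong₂ (λ p q → b * p + q) (repeat-apart A pre e vs) (Alt-comb A cs es bs es∈) ⟩
      b * 0# + 0#                              ≡⟨ trans (+-identityʳ _) (zeroʳ b) ⟩
      0# ∎
      where open ≡-Reasoning

    -- Scaling the first column by b multiplies G by b, and adding combinations of the other columns
    -- changes nothing; the resulting column is zero. This is the part of the adjugate identity
    -- behind Cayley-Hamilton, and it tolerates zero divisors.
    Alt-kernel : ∀ {G} → Alt G → ∀ {m} (es : Vec V (suc m)) bs → comb es bs ≡ 0ᵥ →
                 Vec.head bs * G (Vec.toList es) ≡ 0#
    Alt-kernel {G} A (e ∷ es) (b ∷ bs) eq = begin
      b * G (e ∷ cs)                          ≡⟨ +-identityʳ _ ⟨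
      b * G (e ∷ cs) + 0#                     ≡⟨ cong (b * G (e ∷ cs) +_) (Alt-comb A cs es bs (All.tabulate id)) ⟨
      b * G (e ∷ cs) + G (comb es bs ∷ cs)    ≡⟨ A .linear [] b e _ cs ⟨
      G (comb (e ∷ es) (b ∷ bs) ∷ cs)         ≡⟨ cong (λ z → G (z ∷ cs)) eq ⟩
      G (0ᵥ ∷ cs)                             ≡⟨ A .zeroes [] cs ⟩
      0# ∎
      where
      open ≡-Reasoning
      cs = Vec.toList es

    Alt-scale : ∀ {G} → Alt G → ∀ a vs → G (List.map (λ v → (a · v) +ᵥ 0ᵥ) vs) ≡ a ^ length vs * G vs
    Alt-scale         A a []       = sym (*-identityˡ _)
    Alt-scale {G} A a (v ∷ vs) = begin
      G (((a · v) +ᵥ 0ᵥ) ∷ ws)                ≡⟨ A .linear [] a v 0ᵥ ws ⟩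
      a * G (v ∷ ws) + G (0ᵥ ∷ ws)            ≡⟨ cong₂ (λ p q → a * p + q) (Alt-scale (Alt-∷ v A) a vs) (A .zeroes [] ws) ⟩
      a * (a ^ length vs * G (v ∷ vs)) + 0#   ≡⟨ trans (+-identityʳ _) (sym (*-assoc _ _ _)) ⟩
      a * a ^ length vs * G (v ∷ vs)          ∎
      where
      open ≡-Reasoning
      ws = List.map (λ v → (a · v) +ᵥ 0ᵥ) vs

  _+ᵥ_ : ∀ {n} → Vec Carrier n → Vec Carrier n → Vec Carrier n
  _+ᵥ_ = Vec.zipWith _+_

  _·_ : ∀ {n} → Carrier → Vec Carrier n → Vec Carrier n
  a · v = Vec.map (a *_) v

  0ᵥ : ∀ {n} → Vec Carrier n
  0ᵥ = Vec.replicate _ 0#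

  module Columns {n : ℕ} = Alternating {Vec Carrier n} 0ᵥ _+ᵥ_ _·_
  open Columns public using (comb)

  det′-Alt : ∀ n → Columns.Alt {n} (det′ n)
  det′-Alt zero = record
    { linear = λ { []      a x y vs → sym (trans (+-identityʳ _) (zeroʳ a))
                 ; (_ ∷ _) a x y vs → sym (trans (+-identityʳ _) (zeroʳ a)) }
    ; zeroes = λ { [] _ → refl ; (_ ∷ _) _ → refl }
    ; repeat = λ { [] _ _ → refl ; (_ ∷ _) _ _ → refl }
    }
  det′-Alt (suc n) = Columns.laplace-Alt head-linear tail-Alt
    where
    head-linear : Columns.Linear {suc n} Vec.head
    head-linear = record { linear = λ { a (x ∷ _) (y ∷ _) → refl } ; zeroes = refl }
    G = det′ n
    module A = Columns.Alt (det′-Alt n)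
    split : ∀ pre (x : Vec Carrier (suc n)) vs →
            G (List.map Vec.tail (pre ++ x ∷ vs)) ≡ G (List.map Vec.tail pre ++ Vec.tail x ∷ List.map Vec.tail vs)
    split pre x vs = cong G (Listₚ.map-++ Vec.tail pre (x ∷ vs))
    tail-Alt : Columns.Alt {suc n} (det′ n ∘ List.map Vec.tail)
    tail-Alt = record
      { linear = λ { pre a (x ∷ xs) (y ∷ ys) vs →
          trans (split pre _ vs) (trans (A.linear _ a xs ys _)
            (sym (cong₂ (λ p q → a * p + q) (split pre (x ∷ xs) vs) (split pre (y ∷ ys) vs)))) }
      ; zeroes = λ pre vs → trans (split pre 0ᵥ vs) (A.zeroes _ _)
      ; repeat = λ pre x vs → trans (cong G (Listₚ.map-++ Vec.tail pre (x ∷ x ∷ vs))) (A.repeat _ _ _)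
      }

  det′-* : ∀ {n} (es : Vec (Vec Carrier n) n) cs → length cs ≡ n →
           det′ n (List.map (comb es) cs) ≡ det′ n cs * det′ n (Vec.toList es)
  det′-* = Columns.Alt-det (det′-Alt _)

  det′-kernel : ∀ {n} (es : Vec (Vec Carrier (suc n)) (suc n)) bs → comb es bs ≡ 0ᵥ →
                Vec.head bs * det′ (suc n) (Vec.toList es) ≡ 0#
  det′-kernel = Columns.Alt-kernel (det′-Alt _)

  basis : ∀ n → Vec (Vec Carrier n) n
  basis zero    = []
  basis (suc n) = (1# ∷ 0ᵥ) ∷ Vec.map (0# ∷_) (basis n)

  laplace-0ˡ : ∀ {V : Set} (G : List V → Carrier) vs → laplace (λ _ → 0#) G vs ≡ 0#
  laplace-0ˡ G []       = refl
  laplace-0ˡ G (x ∷ vs) = trans (cong (λ z → 0# * G vs - z) (laplace-0ˡ (G ∘ (x ∷_)) vs))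
    (solve 1 (λ g → :0 :* g :- :0 := :0) refl (G vs))

  det′-basis : ∀ n → det′ n (Vec.toList (basis n)) ≡ 1#
  det′-basis zero    = refl
  det′-basis (suc n) = begin
    1# * det′ n (List.map Vec.tail cs) - laplace Vec.head G cs
      ≡⟨ cong₂ (λ p q → 1# * p - q)
           (trans (cong (det′ n) (trans (cong (List.map Vec.tail) cs≡) (trans (sym (Listₚ.map-∘ bs)) (Listₚ.map-id bs))))
                  (det′-basis n))
           (trans (cong (laplace Vec.head G) cs≡) (trans (laplace-map (0# ∷_) Vec.head G bs) (laplace-0ˡ _ bs))) ⟩
    1# * 1# - 0#
      ≡⟨ solve 0 (:1 :* :1 :- :0 := :1) refl ⟩
    1# ∎
    where
    open ≡-Reasoning
    bs = Vec.toList (basis n)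
    cs = Vec.toList (Vec.map (0# ∷_) (basis n))
    G = λ ds → det′ n (List.map Vec.tail ((1# ∷ 0ᵥ) ∷ ds))
    cs≡ : cs ≡ List.map (0# ∷_) bs
    cs≡ = Vecₚ.toList-map (0# ∷_) (basis n)

  det′-scalar : ∀ n a → det′ n (List.map (λ v → (a · v) +ᵥ 0ᵥ) (Vec.toList (basis n))) ≡ a ^ n
  det′-scalar n a = begin
    _                                             ≡⟨ Columns.Alt-scale (det′-Alt n) a bs ⟩
    a ^ length bs * det′ n bs                     ≡⟨ cong₂ (λ k d → a ^ k * d) (Vecₚ.length-toList (basis n)) (det′-basis n) ⟩
    a ^ n * 1#                                    ≡⟨ *-identityʳ _ ⟩
    a ^ n                                         ∎
    where
    open ≡-Reasoning
    bs = Vec.toList (basis n)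

-- Eisenstein integers

ω-ext : ∀ {a b c d} → a ≡ c → b ≡ d → (a + b ω) ≡ (c + d ω)
ω-ext refl refl = refl

module _ where
  open +-*-Solver

  ℤω-isCommutativeRing : IsCommutativeRing _≡_ _+ω_ _*ω_ (λ x → -ω x) 0ω 1ω
  ℤω-isCommutativeRing = record
    { isRing = record
      { +-isAbelianGroup = record
        { isGroup = record
          { isMonoid = record
            { isSemigroup = record
              { isMagma = record
                { isEquivalence = isEquivalence
                ; ∙-cong = cong₂ _+ω_ }
              ; assoc = λ { (a + b ω) (c + d ω) (e + f ω) → ω-ext (ℤₚ.+-assoc a c e) (ℤₚ.+-assoc b d f) } }
            ; identity = (λ { (a + b ω) → ω-ext (ℤₚ.+-identityˡ a) (ℤₚ.+-identityˡ b) })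
                       , (λ { (a + b ω) → ω-ext (ℤₚ.+-identityʳ a) (ℤₚ.+-identityʳ b) }) }
          ; inverse = (λ { (a + b ω) → ω-ext (ℤₚ.+-inverseˡ a) (ℤₚ.+-inverseˡ b) })
                    , (λ { (a + b ω) → ω-ext (ℤₚ.+-inverseʳ a) (ℤₚ.+-inverseʳ b) })
          ; ⁻¹-cong = cong (λ x → -ω x) }
        ; comm = λ { (a + b ω) (c + d ω) → ω-ext (ℤₚ.+-comm a c) (ℤₚ.+-comm b d) } }
      ; *-cong = cong₂ _*ω_
      ; *-assoc = λ { (a + b ω) (c + d ω) (e + f ω) → ω-ext
          (solve 6 (λ a b c d e f →
             (a :* c :- b :* d) :* e :- (a :* d :+ b :* c :- b :* d) :* f
             := a :* (c :* e :- d :* f) :- b :* (c :* f :+ d :* e :- d :* f)) refl a b c d e f)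
          (solve 6 (λ a b c d e f →
             (a :* c :- b :* d) :* f :+ (a :* d :+ b :* c :- b :* d) :* e :- (a :* d :+ b :* c :- b :* d) :* f
             := a :* (c :* f :+ d :* e :- d :* f) :+ b :* (c :* e :- d :* f) :- b :* (c :* f :+ d :* e :- d :* f))
            refl a b c d e f) }
      ; *-identity = (λ { (a + b ω) → ω-ext
            (solve 2 (λ a b → con ℤ.1ℤ :* a :- con ℤ.0ℤ :* b := a) refl a b)
            (solve 2 (λ a b → con ℤ.1ℤ :* b :+ con ℤ.0ℤ :* a :- con ℤ.0ℤ :* b := b) refl a b) })
        , (λ { (a + b ω) → ω-ext
            (solve 2 (λ a b → a :* con ℤ.1ℤ :- b :* con ℤ.0ℤ := a) refl a b)
            (solve 2 (λ a b → a :* con ℤ.0ℤ :+ b :* con ℤ.1ℤ :- b :* con ℤ.0ℤ := b) refl a b) })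
      ; distrib = (λ { (a + b ω) (c + d ω) (e + f ω) → ω-ext
            (solve 6 (λ a b c d e f → a :* (c :+ e) :- b :* (d :+ f)
               := (a :* c :- b :* d) :+ (a :* e :- b :* f)) refl a b c d e f)
            (solve 6 (λ a b c d e f → a :* (d :+ f) :+ b :* (c :+ e) :- b :* (d :+ f)
               := (a :* d :+ b :* c :- b :* d) :+ (a :* f :+ b :* e :- b :* f)) refl a b c d e f) })
        , (λ { (a + b ω) (c + d ω) (e + f ω) → ω-ext
            (solve 6 (λ a b c d e f → (c :+ e) :* a :- (d :+ f) :* b
               := (c :* a :- d :* b) :+ (e :* a :- f :* b)) refl a b c d e f)
            (solve 6 (λ a b c d e f → (c :+ e) :* b :+ (d :+ f) :* a :- (d :+ f) :* b
               := (c :* b :+ d :* a :- d :* b) :+ (e :* b :+ f :* a :- f :* b)) refl a b c d e f) }) }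
    ; *-comm = λ { (a + b ω) (c + d ω) → ω-ext
        (solve 4 (λ a b c d → a :* c :- b :* d := c :* a :- d :* b) refl a b c d)
        (solve 4 (λ a b c d → a :* d :+ b :* c :- b :* d := c :* b :+ d :* a :- d :* b) refl a b c d) }
    }

ℤω-ring : CRing
ℤω-ring = record { isCommutativeRing = ℤω-isCommutativeRing }

module E = RingKit ℤω-ring

-- Complex conjugation, from ω̄ = -1 - ω.
conjω : ℤω → ℤω
conjω (a + b ω) = (a ℤ.- b) + (ℤ.- b) ω

norm : ℤω → ℤ
norm (a + b ω) = a ℤ.* a ℤ.- a ℤ.* b ℤ.+ b ℤ.* b

module _ where
  open +-*-Solver

  conjω-+ : ∀ x y → conjω (x +ω y) ≡ conjω x +ω conjω y
  conjω-+ (a + b ω) (c + d ω) = ω-ext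
    (solve 4 (λ a b c d → a :+ c :- (b :+ d) := (a :- b) :+ (c :- d)) refl a b c d)
    (ℤₚ.neg-distrib-+ b d)

  conjω-neg : ∀ x → conjω (-ω x) ≡ -ω conjω x
  conjω-neg (a + b ω) = ω-ext (solve 2 (λ a b → :- a :- :- b := :- (a :- b)) refl a b) refl

  conjω-involutive : ∀ x → conjω (conjω x) ≡ x
  conjω-involutive (a + b ω) = ω-ext
    (solve 2 (λ a b → a :- b :- :- b := a) refl a b) (ℤₚ.neg-involutive b)

  conjω-* : ∀ x y → conjω (x *ω y) ≡ conjω x *ω conjω y
  conjω-* (a + b ω) (c + d ω) = ω-ext
    (solve 4 (λ a b c d → (a :* c :- b :* d) :- (a :* d :+ b :* c :- b :* d)
       := (a :- b) :* (c :- d) :- (:- b) :* (:- d)) refl a b c d)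
    (solve 4 (λ a b c d → :- (a :* d :+ b :* c :- b :* d)
       := (a :- b) :* (:- d) :+ (:- b) :* (c :- d) :- (:- b) :* (:- d)) refl a b c d)

  *-conjω : ∀ x → x *ω conjω x ≡ ι (norm x)
  *-conjω (a + b ω) = ω-ext
    (solve 2 (λ a b → a :* (a :- b) :- b :* (:- b) := a :* a :- a :* b :+ b :* b) refl a b)
    (solve 2 (λ a b → a :* (:- b) :+ b :* (a :- b) :- b :* (:- b) := con ℤ.0ℤ) refl a b)

  norm-* : ∀ x y → norm (x *ω y) ≡ norm x ℤ.* norm y
  norm-* (a + b ω) (c + d ω) = solve 4 (λ a b c d →
    let e = a :* c :- b :* d ; f = a :* d :+ b :* c :- b :* d in
    e :* e :- e :* f :+ f :* f := (a :* a :- a :* b :+ b :* b) :* (c :* c :- c :* d :+ d :* d)) refl a b c d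

  -- Completing the square, (2a - b)² + 3b², shows that the norm is positive definite without
  -- leaving the integers.
  4norm : ∀ a b → let s = a ℤ.+ a ℤ.- b in
    (norm (a + b ω) ℤ.+ norm (a + b ω)) ℤ.+ (norm (a + b ω) ℤ.+ norm (a + b ω))
      ≡ s ℤ.* s ℤ.+ (b ℤ.* b ℤ.+ (b ℤ.* b ℤ.+ b ℤ.* b))
  4norm = solve 2 (λ a b →
    let n = a :* a :- a :* b :+ b :* b ; s = a :+ a :- b in
    (n :+ n) :+ (n :+ n) := s :* s :+ (b :* b :+ (b :* b :+ b :* b))) refl

square-pos : ∀ i → i ℤ.* i ≡ pos (ℤ.∣ i ∣ ℕ.* ℤ.∣ i ∣)
square-pos (pos n)    = sym (ℤₚ.pos-* n n)
square-pos (-[1+ n ]) = refl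

square-zero : ∀ i → ℤ.∣ i ∣ ℕ.* ℤ.∣ i ∣ ≡ 0 → i ≡ ℤ.0ℤ
square-zero i eq with ℕₚ.m*n≡0⇒m≡0∨n≡0 ℤ.∣ i ∣ eq
... | inj₁ e = ℤₚ.∣i∣≡0⇒i≡0 e
... | inj₂ e = ℤₚ.∣i∣≡0⇒i≡0 e

norm-form : ∀ a b → Σ ℕ λ k → pos k ≡ (norm (a + b ω) ℤ.+ norm (a + b ω)) ℤ.+ (norm (a + b ω) ℤ.+ norm (a + b ω))
                            × ℤ.∣ b ∣ ℕ.* ℤ.∣ b ∣ ℕ.≤ k
norm-form a b = _ , sym (trans (4norm a b) (cong₂ (λ p q → p ℤ.+ (q ℤ.+ (q ℤ.+ q))) (square-pos (a ℤ.+ a ℤ.- b)) (square-pos b)))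
              , ℕₚ.≤-trans (ℕₚ.m≤m+n _ _) (ℕₚ.m≤n+m _ (ℤ.∣ a ℤ.+ a ℤ.- b ∣ ℕ.* ℤ.∣ a ℤ.+ a ℤ.- b ∣))

quadruple-nonneg : ∀ n k → pos k ≡ (n ℤ.+ n) ℤ.+ (n ℤ.+ n) → ℤ.0ℤ ℤ.≤ n
quadruple-nonneg (pos n)    k _  = ℤ.+≤+ z≤n
quadruple-nonneg (-[1+ n ]) k ()

norm-nonneg : ∀ x → ℤ.0ℤ ℤ.≤ norm x
norm-nonneg (a + b ω) = let k , e , _ = norm-form a b in quadruple-nonneg (norm (a + b ω)) k e

-- Four times the norm dominates b², so b = 0, and then the norm is a².
norm-zero : ∀ x → norm x ≡ ℤ.0ℤ → x ≡ 0ω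
norm-zero (a + b ω) eq = ω-ext a≡0 b≡0
  where
  k = proj₁ (norm-form a b)
  k≡0 : k ≡ 0
  k≡0 = ℤₚ.+-injective (trans (proj₁ (proj₂ (norm-form a b))) (cong (λ n → (n ℤ.+ n) ℤ.+ (n ℤ.+ n)) eq))
  b≡0 = square-zero b (ℕₚ.n≤0⇒n≡0 (subst (ℤ.∣ b ∣ ℕ.* ℤ.∣ b ∣ ℕ.≤_) k≡0 (proj₂ (proj₂ (norm-form a b)))))
  norm-real : norm (a + b ω) ≡ a ℤ.* a
  norm-real = trans (cong (λ b → norm (a + b ω)) b≡0) (let open +-*-Solver in
    solve 1 (λ a → a :* a :- a :* con ℤ.0ℤ :+ con ℤ.0ℤ :* con ℤ.0ℤ := a :* a) refl a)
  a≡0 = square-zero a (ℤₚ.+-injective (trans (sym (square-pos a)) (trans (sym norm-real) eq)))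

ℤω-domain : ∀ x y → x *ω y ≡ 0ω → x ≡ 0ω ⊎ y ≡ 0ω
ℤω-domain x y eq = Sum.map (norm-zero x) (norm-zero y)
  (ℤₚ.i*j≡0⇒i≡0∨j≡0 (norm x) (trans (sym (norm-* x y)) (cong norm eq)))

fromℕ-ι : ∀ n → E.fromℕ n ≡ ι (pos n)
fromℕ-ι zero    = refl
fromℕ-ι (suc n) = trans (E.fromℕ-+ 1 n) (cong (1ω +ω_) (fromℕ-ι n))

fromℤ-ι : ∀ i → E.fromℤ i ≡ ι i
fromℤ-ι (pos n)    = fromℕ-ι n
fromℤ-ι (-[1+ n ]) = cong (λ x → -ω x) (fromℕ-ι (suc n))

ι-injective : ∀ {i j} → ι i ≡ ι j → i ≡ j
ι-injective = cong re

_≟ω_ : (x y : ℤω) → Dec (x ≡ y)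
(a + b ω) ≟ω (c + d ω) with a ℤₚ.≟ c | b ℤₚ.≟ d
... | yes refl | yes refl = yes refl
... | no ¬p    | _        = no λ { refl → ¬p refl }
... | yes _    | no ¬q    = no λ { refl → ¬q refl }

-- Agreement of the two definitions of the determinant

columns : ∀ {A : Set} {m n} → (Fin m → Fin n → A) → Vec (Vec A m) n
columns M = Vec.tabulate λ j → Vec.tabulate λ i → M i j

module Dω = Determinant ℤω-ring

altSign-suc : ∀ j x → altSign (suc j) x ≡ -ω altSign j x
altSign-suc zero          x = refl
altSign-suc (suc zero)    x = sym (E.-‿involutive x)
altSign-suc (suc (suc j)) x = altSign-suc j x

sumω-cong : ∀ {m} {f g : Fin m → ℤω} → (∀ i → f i ≡ g i) → sumω f ≡ sumω g
sumω-cong {zero}  eq = refl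
sumω-cong {suc m} eq = cong₂ _+ω_ (eq zero) (sumω-cong (eq ∘ suc))

sumω-neg : ∀ {m} (f : Fin m → ℤω) → sumω (λ i → -ω f i) ≡ -ω sumω f
sumω-neg {zero}  f = refl
sumω-neg {suc m} f = trans (cong ((-ω f zero) +ω_) (sumω-neg (f ∘ suc))) (E.-‿+-comm (f zero) (sumω (f ∘ suc)))

laplace-tabulate : ∀ {V : Set} (φ : V → ℤω) {k} (G : List V → ℤω) (c : Fin (suc k) → V) →
  Dω.laplace φ G (Vec.toList (Vec.tabulate c))
    ≡ sumω (λ j → altSign (toℕ j) (φ (c j) *ω G (Vec.toList (Vec.tabulate (c ∘ punchIn j)))))
laplace-tabulate φ {zero}  G c = refl
laplace-tabulate φ {suc k} G c = cong ((φ (c zero) *ω G (Vec.toList (Vec.tabulate (c ∘ suc)))) +ω_)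
  (trans (cong (λ x → -ω x) (laplace-tabulate φ (G ∘ (c zero ∷_)) (c ∘ suc)))
    (trans (sym (sumω-neg term)) (sumω-cong {f = λ j → -ω term j} λ j → sym (altSign-suc (toℕ j) (φ (c (suc j)) *ω G (c zero ∷ Vec.toList (Vec.tabulate (c ∘ suc ∘ punchIn j))))))))
  where
  term : Fin (suc k) → ℤω
  term j = altSign (toℕ j) (φ (c (suc j)) *ω G (c zero ∷ Vec.toList (Vec.tabulate (c ∘ suc ∘ punchIn j))))

-- Both sides expand along the first row. On lists the deletion by `punchIn` becomes removal of an
-- entry, so the alternating property proved for `det′` becomes available for `det`.
det-det′ : ∀ {m} (M : Fin m → Fin m → ℤω) → det M ≡ Dω.det′ m (Vec.toList (columns M))
det-det′ {zero}  M = refl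
det-det′ {suc m} M = trans
  (sumω-cong λ j → cong (λ z → altSign (toℕ j) (M zero j *ω z)) (minor-eq j))
  (sym (laplace-tabulate Vec.head (Dω.det′ m ∘ List.map Vec.tail) col))
  where
  col : Fin (suc m) → Vec ℤω (suc m)
  col j = Vec.tabulate λ i → M i j
  minor : Fin (suc m) → Fin m → Fin m → ℤω
  minor j i k = M (suc i) (punchIn j k)
  minor-eq : ∀ j → det (minor j) ≡ Dω.det′ m (List.map Vec.tail (Vec.toList (Vec.tabulate (col ∘ punchIn j))))
  minor-eq j = trans (det-det′ (minor j)) (cong (Dω.det′ m)
    (trans (cong Vec.toList (Vecₚ.tabulate-∘ Vec.tail (col ∘ punchIn j)))
           (Vecₚ.toList-map Vec.tail (Vec.tabulate (col ∘ punchIn j)))))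

-- Polynomials with integer roots

module RootProduct (R : CRing) where
  open RingKit R

  rootProduct : Carrier → List ℤ → Carrier
  rootProduct x []      = 1#
  rootProduct x (l ∷ L) = (x - fromℤ l) * rootProduct x L

  rootProduct-++ : ∀ x L M → rootProduct x (L ++ M) ≡ rootProduct x L * rootProduct x M
  rootProduct-++ x []      M = sym (*-identityˡ _)
  rootProduct-++ x (l ∷ L) M = trans (cong ((x - fromℤ l) *_) (rootProduct-++ x L M)) (sym (*-assoc _ _ _))

record Hom (K A : CRing) : Set where
  private
    module K = RingKit K
    module A = RingKit A
  field
    ⟦_⟧ : K.Carrier → A.Carrier
    +-homo : ∀ x y → ⟦ x K.+ y ⟧ ≡ ⟦ x ⟧ A.+ ⟦ y ⟧
    *-homo : ∀ x y → ⟦ x K.* y ⟧ ≡ ⟦ x ⟧ A.* ⟦ y ⟧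
    neg-homo : ∀ x → ⟦ K.- x ⟧ ≡ A.- ⟦ x ⟧
    0-homo : ⟦ K.0# ⟧ ≡ A.0#
    1-homo : ⟦ K.1# ⟧ ≡ A.1#

  fromℕ-homo : ∀ n → ⟦ K.fromℕ n ⟧ ≡ A.fromℕ n
  fromℕ-homo zero    = 0-homo
  fromℕ-homo (suc n) = trans (cong ⟦_⟧ (K.fromℕ-+ 1 n))
    (trans (+-homo _ _) (trans (cong₂ A._+_ 1-homo (fromℕ-homo n)) (sym (A.fromℕ-+ 1 n))))

  fromℤ-homo : ∀ i → ⟦ K.fromℤ i ⟧ ≡ A.fromℤ i
  fromℤ-homo (pos n)    = fromℕ-homo n
  fromℤ-homo (-[1+ n ]) = trans (neg-homo _) (cong A.-_ (fromℕ-homo (suc n)))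

id-hom : ∀ K → Hom K K
id-hom K = record { ⟦_⟧ = id ; +-homo = λ _ _ → refl ; *-homo = λ _ _ → refl
                  ; neg-homo = λ _ → refl ; 0-homo = refl ; 1-homo = refl }

-- The properties that let a polynomial be recovered from its values at integers. `divisible`
-- replaces a count of roots: the constant coefficient of a polynomial vanishing at all large t is a
-- multiple of each such t.
record ArithmeticDomain (K : CRing) : Set where
  open RingKit K
  field
    domain      : ∀ x y → x * y ≡ 0# → x ≡ 0# ⊎ y ≡ 0#
    fromℤ-zero  : ∀ i → fromℤ i ≡ 0# → i ≡ ℤ.0ℤ
    divisible   : ∀ a T → (∀ t → T ℕ.≤ t → ∃ λ b → a ≡ fromℕ t * b) → a ≡ 0#

-- Polynomials as coefficient lists, lowest degree first.
module Polynomial (K : CRing) where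
  open RingKit K

  Poly : Set
  Poly = List Carrier

  infixl 6 _⊞_
  infixl 7 _⊠_

  _⊞_ : Poly → Poly → Poly
  []      ⊞ q       = q
  (a ∷ p) ⊞ []      = a ∷ p
  (a ∷ p) ⊞ (b ∷ q) = (a + b) ∷ (p ⊞ q)

  scale : Carrier → Poly → Poly
  scale c = List.map (c *_)

  neg : Poly → Poly
  neg = List.map (λ a → - a)

  _⊠_ : Poly → Poly → Poly
  []      ⊠ q = []
  (a ∷ p) ⊠ q = scale a q ⊞ (0# ∷ (p ⊠ q))

  -- Synthetic division by X - l; the remainder is the value at l.
  quot : Carrier → Poly → Poly
  quot l []      = []
  quot l (a ∷ p) = p ⊞ scale l (quot l p)

  rootPoly : List ℤ → Poly
  rootPoly []      = 1# ∷ []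
  rootPoly (l ∷ L) = (- fromℤ l ∷ 1# ∷ []) ⊠ rootPoly L

  coef : Poly → ℕ → Carrier
  coef []      i       = 0#
  coef (a ∷ p) zero    = a
  coef (a ∷ p) (suc i) = coef p i

  coef-⊞ : ∀ p q i → coef (p ⊞ q) i ≡ coef p i + coef q i
  coef-⊞ []      q       i       = sym (+-identityˡ _)
  coef-⊞ (a ∷ p) []      i       = sym (+-identityʳ _)
  coef-⊞ (a ∷ p) (b ∷ q) zero    = refl
  coef-⊞ (a ∷ p) (b ∷ q) (suc i) = coef-⊞ p q i

  coef-scale : ∀ c p i → coef (scale c p) i ≡ c * coef p i
  coef-scale c []      i       = sym (zeroʳ c)
  coef-scale c (a ∷ p) zero    = refl
  coef-scale c (a ∷ p) (suc i) = coef-scale c p i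

  coef-neg : ∀ p i → coef (neg p) i ≡ - coef p i
  coef-neg []      i       = sym -0#≈0#
  coef-neg (a ∷ p) zero    = refl
  coef-neg (a ∷ p) (suc i) = coef-neg p i

  Vanishes≥ : ℕ → Poly → Set
  Vanishes≥ k p = ∀ i → k ℕ.≤ i → coef p i ≡ 0#

  vanishes≥-length : ∀ p → Vanishes≥ (length p) p
  vanishes≥-length []      i       _        = refl
  vanishes≥-length (a ∷ p) (suc i) (s≤s le) = vanishes≥-length p i le

  coef-⊠-vanish : ∀ p q → Vanishes≥ 0 p → ∀ i → coef (p ⊠ q) i ≡ 0#
  coef-⊠-vanish []      q Z i = refl
  coef-⊠-vanish (a ∷ p) q Z i = begin
    coef (scale a q ⊞ (0# ∷ p ⊠ q)) i          ≡⟨ coef-⊞ (scale a q) _ i ⟩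
    coef (scale a q) i + coef (0# ∷ p ⊠ q) i   ≡⟨ cong₂ _+_ (trans (coef-scale a q i) (trans (cong (_* coef q i) (Z 0 z≤n)) (zeroˡ _))) (shifted i) ⟩
    0# + 0#                                    ≡⟨ +-identityˡ _ ⟩
    0#                                         ∎
    where
    open ≡-Reasoning
    shifted : ∀ i → coef (0# ∷ p ⊠ q) i ≡ 0#
    shifted zero    = refl
    shifted (suc i) = coef-⊠-vanish p q (λ j _ → Z (suc j) z≤n) i

  coef-⊠-top : ∀ p q m k → Vanishes≥ (suc m) p → Vanishes≥ (suc k) q →
               coef (p ⊠ q) (m ℕ.+ k) ≡ coef p m * coef q k
  coef-⊠-top []      q m       k Zp Zq = sym (zeroˡ _)
  coef-⊠-top (a ∷ p) q zero    k Zp Zq = begin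
    coef (scale a q ⊞ (0# ∷ p ⊠ q)) k          ≡⟨ coef-⊞ (scale a q) _ k ⟩
    coef (scale a q) k + coef (0# ∷ p ⊠ q) k   ≡⟨ cong₂ _+_ (coef-scale a q k) (shifted k) ⟩
    a * coef q k + 0#                          ≡⟨ +-identityʳ _ ⟩
    a * coef q k                               ∎
    where
    open ≡-Reasoning
    shifted : ∀ k → coef (0# ∷ p ⊠ q) k ≡ 0#
    shifted zero    = refl
    shifted (suc k) = coef-⊠-vanish p q (λ j _ → Zp (suc j) (s≤s z≤n)) k
  coef-⊠-top (a ∷ p) q (suc m) k Zp Zq = begin
    coef (scale a q ⊞ (0# ∷ p ⊠ q)) (suc m ℕ.+ k)             ≡⟨ coef-⊞ (scale a q) _ (suc m ℕ.+ k) ⟩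
    coef (scale a q) (suc m ℕ.+ k) + coef (p ⊠ q) (m ℕ.+ k)
      ≡⟨ cong₂ _+_ (trans (coef-scale a q (suc m ℕ.+ k)) (trans (cong (a *_) (Zq _ (s≤s (ℕₚ.m≤n+m k m)))) (zeroʳ a)))
                   (coef-⊠-top p q m k (λ i le → Zp (suc i) (s≤s le)) Zq) ⟩
    0# + coef p m * coef q k                                  ≡⟨ +-identityˡ _ ⟩
    coef p m * coef q k                                       ∎
    where open ≡-Reasoning

  -- An upper bound for the degree together with the coefficient there. Lists may end in zeros and c
  -- may be zero; monic means that c is `1#`.
  HasDegree : ℕ → Carrier → Poly → Set
  HasDegree n c p = Vanishes≥ (suc n) p × coef p n ≡ c

  quot-vanishes : ∀ l p k → Vanishes≥ k p → Vanishes≥ (ℕ.pred k) (quot l p)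
  quot-vanishes l []      k Z i le = refl
  quot-vanishes l (a ∷ p) k Z i le = begin
    coef (p ⊞ scale l (quot l p)) i        ≡⟨ coef-⊞ p _ i ⟩
    coef p i + coef (scale l (quot l p)) i ≡⟨ cong (coef p i +_) (coef-scale l (quot l p) i) ⟩
    coef p i + l * coef (quot l p) i       ≡⟨ cong₂ (λ u v → u + l * v) (Z (suc i) (le′ k le))
                                                (quot-vanishes l p (ℕ.pred k) (λ j le → Z (suc j) (le′ k le)) i
                                                  (ℕₚ.≤-trans (ℕₚ.pred[n]≤n {ℕ.pred k}) le)) ⟩
    0# + l * 0#                            ≡⟨ trans (+-identityˡ _) (zeroʳ l) ⟩
    0#                                     ∎
    where
    open ≡-Reasoning
    le′ : ∀ k {j} → ℕ.pred k ℕ.≤ j → k ℕ.≤ suc j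
    le′ zero    _  = z≤n
    le′ (suc k) le = s≤s le

  quot-degree : ∀ l p n c → HasDegree (suc n) c p → HasDegree n c (quot l p)
  quot-degree l p n c (Z , top) = quot-vanishes l p (suc (suc n)) Z , lead p Z top
    where
    open ≡-Reasoning
    lead : ∀ p → Vanishes≥ (suc (suc n)) p → coef p (suc n) ≡ c → coef (quot l p) n ≡ c
    lead []      Z top = top
    lead (a ∷ p) Z top = begin
      coef (p ⊞ scale l (quot l p)) n        ≡⟨ coef-⊞ p _ n ⟩
      coef p n + coef (scale l (quot l p)) n ≡⟨ cong₂ _+_ top (coef-scale l (quot l p) n) ⟩
      c + l * coef (quot l p) n              ≡⟨ cong (λ v → c + l * v)
                                                 (quot-vanishes l p (suc n) (λ j le → Z (suc j) (s≤s le)) n ℕₚ.≤-refl) ⟩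
      c + l * 0#                             ≡⟨ trans (cong (c +_) (zeroʳ l)) (+-identityʳ c) ⟩
      c                                      ∎

  -- Coefficients travel along η, so that one polynomial over K can be evaluated at integers and
  -- also at an element of the group algebra.
  module Eval {A : CRing} (η : Hom K A) where
    private module A = RingKit A
    open Hom η
    open RootProduct A

    ev : A.Carrier → Poly → A.Carrier
    ev x []      = A.0#
    ev x (a ∷ p) = ⟦ a ⟧ A.+ x A.* ev x p

    ev-⊞ : ∀ x p q → ev x (p ⊞ q) ≡ ev x p A.+ ev x q
    ev-⊞ x []      q       = sym (A.+-identityˡ _)
    ev-⊞ x (a ∷ p) []      = sym (A.+-identityʳ _)
    ev-⊞ x (a ∷ p) (b ∷ q) = trans (cong₂ (λ u v → u A.+ x A.* v) (+-homo a b) (ev-⊞ x p q))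
      (A.solve 5 (λ a b x p q → (a A.:+ b) A.:+ x A.:* (p A.:+ q) A.:= (a A.:+ x A.:* p) A.:+ (b A.:+ x A.:* q))
        refl ⟦ a ⟧ ⟦ b ⟧ x (ev x p) (ev x q))

    ev-scale : ∀ x c p → ev x (scale c p) ≡ ⟦ c ⟧ A.* ev x p
    ev-scale x c []      = sym (A.zeroʳ _)
    ev-scale x c (a ∷ p) = trans (cong₂ (λ u v → u A.+ x A.* v) (*-homo c a) (ev-scale x c p))
      (A.solve 4 (λ c a x p → c A.:* a A.:+ x A.:* (c A.:* p) A.:= c A.:* (a A.:+ x A.:* p))
        refl ⟦ c ⟧ ⟦ a ⟧ x (ev x p))

    ev-neg : ∀ x p → ev x (neg p) ≡ A.- ev x p
    ev-neg x []      = sym A.-0#≈0#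
    ev-neg x (a ∷ p) = trans (cong₂ (λ u v → u A.+ x A.* v) (neg-homo a) (ev-neg x p))
      (A.solve 3 (λ a x p → A.:- a A.:+ x A.:* (A.:- p) A.:= A.:- (a A.:+ x A.:* p)) refl ⟦ a ⟧ x (ev x p))

    ev-⊠ : ∀ x p q → ev x (p ⊠ q) ≡ ev x p A.* ev x q
    ev-⊠ x []      q = sym (A.zeroˡ _)
    ev-⊠ x (a ∷ p) q = trans (ev-⊞ x (scale a q) (0# ∷ p ⊠ q))
      (trans (cong₂ A._+_ (ev-scale x a q) (cong₂ (λ u v → u A.+ x A.* v) 0-homo (ev-⊠ x p q)))
        (A.solve 4 (λ a x p q → a A.:* q A.:+ (A.:0 A.:+ x A.:* (p A.:* q)) A.:= (a A.:+ x A.:* p) A.:* q)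
          refl ⟦ a ⟧ x (ev x p) (ev x q)))

    ev-vanish : ∀ x p → Vanishes≥ 0 p → ev x p ≡ A.0#
    ev-vanish x []      Z = refl
    ev-vanish x (a ∷ p) Z = trans
      (cong₂ (λ u v → u A.+ x A.* v) (trans (cong ⟦_⟧ (Z 0 z≤n)) 0-homo) (ev-vanish x p (λ i _ → Z (suc i) z≤n)))
      (trans (A.+-identityˡ _) (A.zeroʳ x))

    ev-rootPoly : ∀ x L → ev x (rootPoly L) ≡ rootProduct x L
    ev-rootPoly x []      = trans (cong₂ A._+_ 1-homo (A.zeroʳ x)) (A.+-identityʳ _)
    ev-rootPoly x (l ∷ L) = trans (ev-⊠ x (- fromℤ l ∷ 1# ∷ []) (rootPoly L))
      (cong₂ A._*_ (trans (cong₂ (λ u v → u A.+ x A.* (v A.+ x A.* A.0#)) (trans (neg-homo _) (cong A.-_ (fromℤ-homo l))) 1-homo)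
                      (A.solve 2 (λ l x → A.:- l A.:+ x A.:* (A.:1 A.:+ x A.:* A.:0) A.:= x A.:- l)
                         refl (A.fromℤ l) x))
                   (ev-rootPoly x L))

  open Eval (id-hom K)
  open RootProduct K

  ev-quot : ∀ l p x → ev x p ≡ (x - l) * ev x (quot l p) + ev l p
  ev-quot l []      x = solve 2 (λ x l → :0 := (x :- l) :* :0 :+ :0) refl x l
  ev-quot l (a ∷ p) x = begin
    a + x * ev x p
      ≡⟨ solve 4 (λ a x l p → a :+ x :* p := (x :- l) :* p :+ (a :+ l :* p)) refl a x l (ev x p) ⟩
    (x - l) * ev x p + (a + l * ev x p)
      ≡⟨ cong (λ z → (x - l) * ev x p + (a + l * z)) (ev-quot l p x) ⟩
    (x - l) * ev x p + (a + l * ((x - l) * ev x (quot l p) + ev l p))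
      ≡⟨ solve 6 (λ a x l p q r → (x :- l) :* p :+ (a :+ l :* ((x :- l) :* q :+ r))
                                  := (x :- l) :* (p :+ l :* q) :+ (a :+ l :* r)) refl a x l (ev x p) (ev x (quot l p)) (ev l p) ⟩
    (x - l) * (ev x p + l * ev x (quot l p)) + (a + l * ev l p)
      ≡⟨ cong (λ z → (x - l) * z + (a + l * ev l p))
           (trans (ev-⊞ x p (scale l (quot l p))) (cong (ev x p +_) (ev-scale x l (quot l p)))) ⟨
    (x - l) * ev x (p ⊞ scale l (quot l p)) + (a + l * ev l p) ∎
    where open ≡-Reasoning

  module Splitting (D : ArithmeticDomain K) where
    open ArithmeticDomain D

    -- The constant coefficient is divisible by every t from T on, hence zero; the bound 1 ≤ T makes
    -- t nonzero, so t can be cancelled and the tail vanishes at the same points.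
    vanishing : ∀ p T → 1 ℕ.≤ T → (∀ t → T ℕ.≤ t → ev (fromℕ t) p ≡ 0#) → Vanishes≥ 0 p
    vanishing []      T T>0 eq i _ = refl
    vanishing (a ∷ p) T T>0 eq = λ { zero _ → a≡0 ; (suc i) _ → vanishing p T T>0 eq′ i z≤n }
      where
      a≡0 : a ≡ 0#
      a≡0 = divisible a T λ t le → - ev (fromℕ t) p ,
        (begin
          a                                             ≡⟨ solve 3 (λ a t p → a := (a :+ t :* p) :+ t :* (:- p)) refl a (fromℕ t) (ev (fromℕ t) p) ⟩
          (a + fromℕ t * ev (fromℕ t) p) + fromℕ t * (- ev (fromℕ t) p)  ≡⟨ cong (_+ fromℕ t * (- ev (fromℕ t) p)) (eq t le) ⟩
          0# + fromℕ t * (- ev (fromℕ t) p)             ≡⟨ +-identityˡ _ ⟩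
          fromℕ t * (- ev (fromℕ t) p)                  ∎)
        where open ≡-Reasoning
      eq′ : ∀ t → T ℕ.≤ t → ev (fromℕ t) p ≡ 0#
      eq′ t le with domain (fromℕ t) (ev (fromℕ t) p)
                     (trans (sym (+-identityˡ _)) (trans (cong (_+ fromℕ t * ev (fromℕ t) p) (sym a≡0)) (eq t le)))
      ... | inj₂ e = e
      ... | inj₁ e with fromℤ-zero (pos t) e
      ...   | refl = ⊥-elim (ℕₚ.<⇒≱ T>0 le)

    1≢0 : 1# ≢ 0#
    1≢0 e with fromℤ-zero ℤ.1ℤ e
    ... | ()

    -- The product of p with the top coefficient of q sits in positive degree, where the constant 1
    -- has coefficient zero. So the length bound on q descends until q vanishes, which contradicts
    -- the product being 1.
    monic-unit : ∀ n p q → HasDegree (suc n) 1# p → ¬ (∀ t → ev (fromℤ t) p * ev (fromℤ t) q ≡ 1#)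
    monic-unit n p q (Zp , top) eq = 1≢0 (trans (sym (eq ℤ.0ℤ))
      (trans (cong (ev 0# p *_) (ev-vanish 0# q (descend (length q) (vanishes≥-length q)))) (zeroʳ _)))
      where
      r : Poly
      r = (p ⊠ q) ⊞ neg (1# ∷ [])
      r-vanish : Vanishes≥ 0 r
      r-vanish = vanishing r 1 ℕₚ.≤-refl λ t _ → trans (ev-⊞ (fromℕ t) (p ⊠ q) _)
        (trans (cong₂ _+_ (trans (ev-⊠ (fromℕ t) p q) (eq (pos t))) (ev-neg (fromℕ t) (1# ∷ [])))
          (solve 1 (λ t → :1 :+ :- (:1 :+ t :* :0) := :0) refl (fromℕ t)))
      pq-vanish : ∀ i → coef (p ⊠ q) (suc i) ≡ 0#
      pq-vanish i = trans (sym (trans (coef-⊞ (p ⊠ q) (neg (1# ∷ [])) (suc i)) (+-identityʳ _))) (r-vanish (suc i) z≤n)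
      descend : ∀ k → Vanishes≥ k q → Vanishes≥ 0 q
      descend zero    Z = Z
      descend (suc k) Z = descend k λ i le → lower i (ℕₚ.m≤n⇒m<n∨m≡n le)
        where
        lower : ∀ i → k ℕ.< i ⊎ k ≡ i → coef q i ≡ 0#
        lower i (inj₁ lt)   = Z i lt
        lower i (inj₂ refl) = trans (sym (*-identityˡ _)) (trans (cong (_* coef q k) (sym top))
          (trans (sym (coef-⊠-top p q (suc n) k Zp Z)) (pq-vanish (n ℕ.+ k))))

    degree-0 : ∀ p x → HasDegree 0 1# p → ev x p ≡ 1#
    degree-0 []      x (Z , top) = top
    degree-0 (a ∷ p) x (Z , top) = trans (cong₂ (λ u v → u + x * v) top (ev-vanish x p λ i _ → Z (suc i) (s≤s z≤n)))
      (trans (cong (1# +_) (zeroʳ x)) (+-identityʳ 1#))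

    factor-root : ∀ p l → ev (fromℤ l) p ≡ 0# → ∀ x → ev x p ≡ (x - fromℤ l) * ev x (quot (fromℤ l) p)
    factor-root p l e x = trans (ev-quot (fromℤ l) p x) (trans (cong ((x - fromℤ l) * ev x (quot (fromℤ l) p) +_) e) (+-identityʳ _))

    -- Pointwise cancellation fails at t = l. It works for t beyond the absolute value of l, and
    -- `vanishing` extends the identity to every point.
    cancel-root : ∀ p q l L → (∀ t → (fromℤ t - fromℤ l) * (ev (fromℤ t) p * ev (fromℤ t) q) ≡ rootProduct (fromℤ t) (l ∷ L)) →
                  ∀ t → ev (fromℤ t) p * ev (fromℤ t) q ≡ rootProduct (fromℤ t) L
    cancel-root p q l L eq t = begin
      ev (fromℤ t) p * ev (fromℤ t) q     ≡⟨ solve 2 (λ a b → a := (a :- b) :+ b) refl _ (rootProduct (fromℤ t) L) ⟩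
      (ev (fromℤ t) p * ev (fromℤ t) q - rootProduct (fromℤ t) L) + rootProduct (fromℤ t) L
        ≡⟨ cong (_+ rootProduct (fromℤ t) L) (trans (sym (ev-r (fromℤ t))) (ev-vanish (fromℤ t) r r-vanish)) ⟩
      0# + rootProduct (fromℤ t) L        ≡⟨ +-identityˡ _ ⟩
      rootProduct (fromℤ t) L             ∎
      where
      open ≡-Reasoning
      r : Poly
      r = (p ⊠ q) ⊞ neg (rootPoly L)
      ev-r : ∀ x → ev x r ≡ ev x p * ev x q - rootProduct x L
      ev-r x = trans (ev-⊞ x (p ⊠ q) _) (cong₂ _+_ (ev-⊠ x p q) (trans (ev-neg x (rootPoly L)) (cong -_ (ev-rootPoly x L))))
      r-vanish : Vanishes≥ 0 r
      r-vanish = vanishing r (suc ℤ.∣ l ∣) (s≤s z≤n) λ t le → trans (ev-r (fromℕ t)) (large t le)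
        where
        large : ∀ t → ℤ.∣ l ∣ ℕ.< t → ev (fromℕ t) p * ev (fromℕ t) q - rootProduct (fromℕ t) L ≡ 0#
        large t lt with domain (fromℕ t - fromℤ l) (ev (fromℕ t) p * ev (fromℕ t) q - rootProduct (fromℕ t) L)
          (trans (solve 3 (λ a b c → a :* (b :- c) := a :* b :- a :* c) refl _ _ _)
            (trans (cong (_- rootProduct (fromℕ t) (l ∷ L)) (eq (pos t))) (-‿inverseʳ _)))
        ... | inj₂ e = e
        ... | inj₁ e = ⊥-elim (ℕₚ.<-irrefl (cong ℤ.∣_∣ (sym t≡l)) lt)
          where
          t≡l : pos t ≡ l
          t≡l = ℤₚ.i-j≡0⇒i≡j (pos t) l (fromℤ-zero _
            (trans (fromℤ-+ (pos t) (ℤ.- l)) (trans (cong (fromℕ t +_) (fromℤ-neg l)) e)))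

    -- Induction on the roots of the product: at the root l one of the two factors vanishes because
    -- K is a domain, and X - l is divided out of that factor. Roots falling to p are collected,
    -- roots falling to q are discarded.
    monic-splits : ∀ L n p q → HasDegree n 1# p →
      (∀ t → ev (fromℤ t) p * ev (fromℤ t) q ≡ rootProduct (fromℤ t) L) →
      Σ (Vec ℤ n) λ μs → ∀ t → ev (fromℤ t) p ≡ rootProduct (fromℤ t) (Vec.toList μs)
    monic-splits []      zero    p q D eq = [] , λ t → degree-0 p _ D
    monic-splits []      (suc n) p q D eq = ⊥-elim (monic-unit n p q D eq)
    monic-splits (l ∷ L) n       p q D eq with domain (ev (fromℤ l) p) (ev (fromℤ l) q)
      (trans (eq l) (trans (cong (_* rootProduct (fromℤ l) L) (-‿inverseʳ _)) (zeroˡ _)))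
    monic-splits (l ∷ L) zero    p q D eq | inj₁ e = ⊥-elim (1≢0 (trans (sym (degree-0 p _ D)) e))
    monic-splits (l ∷ L) (suc n) p q D eq | inj₁ e =
      let μs , split = monic-splits L n (quot (fromℤ l) p) q (quot-degree (fromℤ l) p n 1# D)
            (cancel-root (quot (fromℤ l) p) q l L λ t →
              trans (sym (*-assoc _ _ _)) (trans (cong (_* ev (fromℤ t) q) (sym (factor-root p l e (fromℤ t)))) (eq t)))
      in l ∷ μs , λ t → trans (factor-root p l e (fromℤ t)) (cong ((fromℤ t - fromℤ l) *_) (split t))
    ... | inj₂ e = monic-splits L n p (quot (fromℤ l) q) D
            (cancel-root p (quot (fromℤ l) q) l L λ t →
              trans (solve 3 (λ a b c → a :* (b :* c) := b :* (a :* c)) refl _ _ _)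
                (trans (cong (ev (fromℤ t) p *_) (sym (factor-root q l e (fromℤ t)))) (eq t)))

-- Matrices and characteristic polynomials

module Matrix (R : CRing) where
  open RingKit R
  open Determinant R

  detM : ∀ {n} → (Fin n → Fin n → Carrier) → Carrier
  detM {n} M = det′ n (Vec.toList (columns M))

  δM : ∀ {n} → Fin n → Fin n → Carrier
  δM u v = if does (u Fin.≟ v) then 1# else 0#

  columns-cong : ∀ {m n} {M N : Fin m → Fin n → Carrier} → (∀ i j → M i j ≡ N i j) → columns M ≡ columns N
  columns-cong eq = Vecₚ.tabulate-cong λ j → Vecₚ.tabulate-cong λ i → eq i j

  detM-cong : ∀ {n} {M N : Fin n → Fin n → Carrier} → (∀ i j → M i j ≡ N i j) → detM M ≡ detM N
  detM-cong {n} eq = cong (det′ n ∘ Vec.toList) (columns-cong eq)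

  tabulate-const : ∀ m (a : Carrier) → Vec.tabulate {n = m} (λ _ → a) ≡ Vec.replicate m a
  tabulate-const zero    a = refl
  tabulate-const (suc m) a = cong (a ∷_) (tabulate-const m a)

  columns-δ : ∀ n → columns (δM {n}) ≡ basis n
  columns-δ zero    = refl
  columns-δ (suc n) = cong₂ (λ p q → (1# ∷ p) ∷ q) (tabulate-const n 0#)
    (trans (Vecₚ.tabulate-∘ (0# ∷_) (λ j → Vec.tabulate λ i → δM i j)) (cong (Vec.map (0# ∷_)) (columns-δ n)))

  detM-δ : ∀ n → detM (δM {n}) ≡ 1#
  detM-δ n = trans (cong (det′ n ∘ Vec.toList) (columns-δ n)) (det′-basis n)

  0ᵥ-tabulate : ∀ m {f : Fin m → Carrier} → (∀ i → f i ≡ 0#) → Vec.tabulate f ≡ 0ᵥ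
  0ᵥ-tabulate m eq = trans (Vecₚ.tabulate-cong eq) (tabulate-const m 0#)

  +ᵥ-tabulate : ∀ {m} (f g : Fin m → Carrier) → Vec.tabulate f +ᵥ Vec.tabulate g ≡ Vec.tabulate λ i → f i + g i
  +ᵥ-tabulate {zero}  f g = refl
  +ᵥ-tabulate {suc m} f g = cong (f zero + g zero ∷_) (+ᵥ-tabulate (f ∘ suc) (g ∘ suc))

  ·-tabulate : ∀ {m} a (f : Fin m → Carrier) → a · Vec.tabulate f ≡ Vec.tabulate λ i → a * f i
  ·-tabulate a f = sym (Vecₚ.tabulate-∘ (a *_) f)

  comb-tabulate : ∀ {m n} (M : Fin m → Fin n → Carrier) (b : Fin n → Carrier) →
                  comb (columns M) (Vec.tabulate b) ≡ Vec.tabulate λ i → sum λ j → M i j * b j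
  comb-tabulate {m} {zero}  M b = sym (0ᵥ-tabulate m λ _ → refl)
  comb-tabulate {m} {suc n} M b = begin
    (b zero · Vec.tabulate (λ i → M i zero)) +ᵥ comb (columns (λ i j → M i (suc j))) (Vec.tabulate (b ∘ suc))
      ≡⟨ cong₂ _+ᵥ_ (trans (·-tabulate (b zero) _) (Vecₚ.tabulate-cong λ i → *-comm (b zero) (M i zero)))
                    (comb-tabulate (λ i j → M i (suc j)) (b ∘ suc)) ⟩
    Vec.tabulate (λ i → M i zero * b zero) +ᵥ Vec.tabulate (λ i → sum λ j → M i (suc j) * b (suc j))
      ≡⟨ +ᵥ-tabulate _ _ ⟩
    _ ∎
    where open ≡-Reasoning

  detM-* : ∀ {n} (M N : Fin n → Fin n → Carrier) →
           detM (λ i k → sum λ j → M i j * N j k) ≡ detM M * detM N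
  detM-* {n} M N = begin
    det′ n (Vec.toList (columns λ i k → sum λ j → M i j * N j k))
      ≡⟨ cong (det′ n ∘ Vec.toList) (Vecₚ.tabulate-cong λ k → comb-tabulate M (λ j → N j k)) ⟨
    det′ n (Vec.toList (Vec.tabulate λ k → comb (columns M) (Vec.tabulate λ j → N j k)))
      ≡⟨ cong (det′ n) (trans (cong Vec.toList (Vecₚ.tabulate-∘ (comb (columns M)) _)) (Vecₚ.toList-map (comb (columns M)) (columns N))) ⟩
    det′ n (List.map (comb (columns M)) (Vec.toList (columns N)))
      ≡⟨ det′-* (columns M) (Vec.toList (columns N)) (Vecₚ.length-toList (columns N)) ⟩
    detM N * detM M
      ≡⟨ *-comm _ _ ⟩
    detM M * detM N ∎
    where open ≡-Reasoning

  detM-kernel : ∀ {n} (M : Fin (suc n) → Fin (suc n) → Carrier) (b : Fin (suc n) → Carrier) →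
                (∀ i → sum (λ j → M i j * b j) ≡ 0#) → b zero * detM M ≡ 0#
  detM-kernel M b eq = det′-kernel (columns M) (Vec.tabulate b)
    (trans (comb-tabulate M b) (0ᵥ-tabulate _ eq))

  detM-scalar : ∀ {n} a → detM (λ i j → a * δM {n} i j) ≡ a ^ n
  detM-scalar {n} a = trans (cong (det′ n)
    (trans (cong Vec.toList (trans (Vecₚ.tabulate-cong λ j → sym (scaled j))
             (trans (Vecₚ.tabulate-∘ (λ v → (a · v) +ᵥ 0ᵥ) _) (cong (Vec.map (λ v → (a · v) +ᵥ 0ᵥ)) (columns-δ n)))))
           (Vecₚ.toList-map (λ v → (a · v) +ᵥ 0ᵥ) (basis n))))
    (det′-scalar n a)
    where
    scaled : ∀ j → (a · Vec.tabulate (λ i → δM i j)) +ᵥ 0ᵥ ≡ Vec.tabulate (λ i → a * δM i j)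
    scaled j = trans (cong₂ _+ᵥ_ (·-tabulate a (λ i → δM i j)) (sym (tabulate-const n 0#)))
      (trans (+ᵥ-tabulate _ _) (Vecₚ.tabulate-cong λ i → +-identityʳ _))

map-columns : ∀ {A B : Set} {m n} (f : A → B) (M : Fin m → Fin n → A) →
              List.map (Vec.map f) (Vec.toList (columns M)) ≡ Vec.toList (columns λ i j → f (M i j))
map-columns f M = trans (sym (Vecₚ.toList-map (Vec.map f) (columns M)))
  (cong Vec.toList (trans (sym (Vecₚ.tabulate-∘ (Vec.map f) _)) (Vecₚ.tabulate-cong λ j → sym (Vecₚ.tabulate-∘ f _))))

module PolynomialMatrix (K : CRing) where
  open RingKit K
  open Polynomial K
  open Matrix K
  private module DP = RawDeterminant _⊞_ _⊠_ neg [] (1# ∷ [])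

  detP : ∀ {n} → (Fin n → Fin n → Poly) → Poly
  detP {n} M = DP.det′ n (Vec.toList (columns M))

  module _ {A : CRing} (η : Hom K A) (x : RingKit.Carrier A) where
    private
      module A = RingKit A
      module MA = Matrix A
    open Eval η
    open Hom η

    ev-detP : ∀ {n} (M : Fin n → Fin n → Poly) → ev x (detP M) ≡ MA.detM (λ u v → ev x (M u v))
    -- `det′-rel` compares two images of one list of columns; the polynomial columns are their own
    -- image under `id`.
    ev-detP {n} M = trans (cong (ev x ∘ DP.det′ n) (sym (trans (Listₚ.map-cong Vecₚ.map-id cs) (Listₚ.map-id cs))))
        (trans (det′-rel n cs) (cong (DA.det′ n) (map-columns (ev x) M)))
      where
      module DA = RawDeterminant A._+_ A._*_ A.-_ A.0# A.1#
      cs = Vec.toList (columns M)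
      open DeterminantRelation _⊞_ _⊠_ neg [] (1# ∷ []) A._+_ A._*_ A.-_ A.0# A.1# id (ev x)
        (λ p _ y → ev x p ≡ y) (λ _ → refl)
        (trans (cong₂ A._+_ 1-homo (A.zeroʳ x)) (A.+-identityʳ _))
        (λ t k {p} {_} {q} e f → trans (ev-⊞ x (t ⊠ p) (neg q))
          (cong₂ A._+_ (trans (ev-⊠ x t p) (cong (ev x t A.*_) e)) (trans (ev-neg x q) (cong A.-_ f))))

  linear : Carrier × Carrier → Poly
  linear (d , h) = - h ∷ d ∷ []

  charPoly : ∀ {n} → (Fin n → Fin n → Carrier) → Poly
  charPoly H = detP λ u v → linear (δM u v , H u v)

  -- Each entry has the form d X - h, so every row raises the degree by at most one, and the
  -- coefficient in degree n is the determinant of the matrix of the d, which is the identity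
  -- matrix.
  charPoly-monic : ∀ {n} (H : Fin n → Fin n → Carrier) → HasDegree n 1# (charPoly H)
  charPoly-monic {n} H = subst (λ c → HasDegree n c (charPoly H))
      (trans (cong (D.det′ n) (map-columns proj₁ T)) (detM-δ n))
      (subst (λ cs → HasDegree n (D.det′ n (List.map (Vec.map proj₁) (Vec.toList (columns T)))) (DP.det′ n cs))
        (map-columns linear T) (det′-rel n (Vec.toList (columns T))))
    where
    T : Fin n → Fin n → Carrier × Carrier
    T u v = δM u v , H u v
    module D = RawDeterminant _+_ _*_ -_ 0# 1#
    step-vanish : ∀ d h k p q → Vanishes≥ (suc k) p → Vanishes≥ (suc (suc k)) q →
                  Vanishes≥ (suc (suc k)) ((linear (d , h) ⊠ p) ⊞ neg q)
    step-vanish d h k p q Zp Zq (suc i) (s≤s le) = begin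
      coef ((linear (d , h) ⊠ p) ⊞ neg q) (suc i)
        ≡⟨ coef-⊞ (linear (d , h) ⊠ p) (neg q) (suc i) ⟩
      coef (linear (d , h) ⊠ p) (1 ℕ.+ i) + coef (neg q) (suc i)
        ≡⟨ cong₂ _+_ (trans (coef-⊠-top (linear (d , h)) p 1 i (vanishes≥-length (linear (d , h)))
                              (λ j lt → Zp j (ℕₚ.≤-trans le (ℕₚ.<⇒≤ lt))))
                            (trans (cong (d *_) (Zp i le)) (zeroʳ d)))
                     (trans (coef-neg q (suc i)) (trans (cong -_ (Zq (suc i) (s≤s le))) -0#≈0#)) ⟩
      0# + 0#
        ≡⟨ +-identityˡ 0# ⟩
      0# ∎
      where open ≡-Reasoning
    step : ∀ t k {p a q b} → HasDegree k a p → HasDegree (suc k) b q →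
           HasDegree (suc k) ((proj₁ t * a) + (- b)) ((linear t ⊠ p) ⊞ neg q)
    step (d , h) k {p} {a} {q} {b} (Zp , tp) (Zq , tq) = step-vanish d h k p q Zp Zq ,
      trans (coef-⊞ (linear (d , h) ⊠ p) (neg q) (suc k))
        (cong₂ _+_ (trans (coef-⊠-top (linear (d , h)) p 1 k (vanishes≥-length (linear (d , h))) Zp) (cong (d *_) tp))
                   (trans (coef-neg q (suc k)) (cong -_ tq)))
    open DeterminantRelation _⊞_ _⊠_ neg [] (1# ∷ []) _+_ _*_ -_ 0# 1# linear proj₁
      (λ p k c → HasDegree k c p)
      (λ k → (λ _ _ → refl) , refl) (vanishes≥-length (1# ∷ []) , refl) step

  ev-charPoly : ∀ {A : CRing} (η : Hom K A) x {n} (H : Fin n → Fin n → Carrier) → let module A = RingKit A in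
    Eval.ev η x (charPoly H) ≡ Matrix.detM A (λ u v → x A.* Hom.⟦_⟧ η (δM u v) A.- Hom.⟦_⟧ η (H u v))
  ev-charPoly {A} η x H = trans (ev-detP η x (λ u v → linear (δM u v , H u v)))
    (Matrix.detM-cong A λ u v →
      trans (cong (A._+ x A.* (⟦ δM u v ⟧ A.+ x A.* A.0#)) (neg-homo _))
        (A.solve 3 (λ h x d → A.:- h A.:+ x A.:* (d A.:+ x A.:* A.:0) A.:= x A.:* d A.:- h) refl ⟦ H u v ⟧ x ⟦ δM u v ⟧))
    where
    module A = RingKit A
    open Hom η

ω-fromℤ-zero : ∀ i → E.fromℤ i ≡ 0ω → i ≡ ℤ.0ℤ
ω-fromℤ-zero i e = ι-injective (trans (sym (fromℤ-ι i)) e)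

ι-*ω : ∀ t c d → ι t *ω (c + d ω) ≡ (t ℤ.* c) + (t ℤ.* d) ω
ι-*ω t c d = let open +-*-Solver in ω-ext
  (solve 3 (λ t c d → t :* c :- con ℤ.0ℤ :* d := t :* c) refl t c d)
  (solve 3 (λ t c d → t :* d :+ con ℤ.0ℤ :* c :- con ℤ.0ℤ :* d := t :* d) refl t c d)

small-multiple : ∀ t i a → a ≡ pos t ℤ.* i → ℤ.∣ a ∣ ℕ.< t → a ≡ ℤ.0ℤ
small-multiple t i a eq lt = ℤₚ.∣i∣≡0⇒i≡0 (small ℤ.∣ i ∣ (trans (cong ℤ.∣_∣ eq) (ℤₚ.abs-* (pos t) i)))
  where
  small : ∀ k → ℤ.∣ a ∣ ≡ t ℕ.* k → ℤ.∣ a ∣ ≡ 0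
  small zero    e = trans e (ℕₚ.*-zeroʳ t)
  small (suc k) e = ⊥-elim (ℕₚ.<⇒≱ lt (subst (t ℕ.≤_) (sym e) (ℕₚ.m≤m*n t (suc k))))

ω-small-multiple : ∀ t a b → a ≡ E.fromℕ t *ω b → ℤ.∣ re a ∣ ℕ.+ ℤ.∣ om a ∣ ℕ.< t → a ≡ 0ω
ω-small-multiple t a (c + d ω) eq lt = ω-ext
  (small-multiple t c (re a) (cong re eq′) (ℕₚ.≤-<-trans (ℕₚ.m≤m+n _ _) lt))
  (small-multiple t d (om a) (cong om eq′) (ℕₚ.≤-<-trans (ℕₚ.m≤n+m _ ℤ.∣ re a ∣) lt))
  where
  eq′ : a ≡ (pos t ℤ.* c) + (pos t ℤ.* d) ω
  eq′ = trans eq (trans (cong (_*ω (c + d ω)) (fromℕ-ι t)) (ι-*ω (pos t) c d))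

ω-divisible : ∀ a T → (∀ t → T ℕ.≤ t → ∃ λ b → a ≡ E.fromℕ t *ω b) → a ≡ 0ω
ω-divisible a T div = ω-small-multiple t a (proj₁ (div t T≤t)) (proj₂ (div t T≤t)) (ℕₚ.m≤n+m _ T)
  where
  -- Large enough for the hypothesis and larger than both coordinates of a, so that a multiple of t
  -- equal to a must be zero.
  t = T ℕ.+ suc (ℤ.∣ re a ∣ ℕ.+ ℤ.∣ om a ∣)
  T≤t = ℕₚ.m≤m+n T _

ℤω-arithmetic : ArithmeticDomain ℤω-ring
ℤω-arithmetic = record { domain = ℤω-domain ; fromℤ-zero = ω-fromℤ-zero ; divisible = ω-divisible }

-- Group algebras

module GroupKit (Γ : FinAbGroup) where
  open FinAbGroup Γ public using (n; _⊕_; 𝟘; ⊝_; isAbelianGroup)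

  G : Set
  G = Fin n

  abelianGroup : AbelianGroup 0ℓ 0ℓ
  abelianGroup = record { isAbelianGroup = isAbelianGroup }

  open AbelianGroup abelianGroup public
    using () renaming (assoc to ⊕-assoc; comm to ⊕-comm; identityˡ to ⊕-identityˡ; identityʳ to ⊕-identityʳ;
                       inverseˡ to ⊕-inverseˡ; inverseʳ to ⊕-inverseʳ)
  open Algebra.Properties.Group (AbelianGroup.group abelianGroup) public
    using () renaming (⁻¹-involutive to ⊝-involutive; ε⁻¹≈ε to ⊝-𝟘; inverseʳ-unique to ⊝-unique)
  open Algebra.Properties.AbelianGroup abelianGroup public
    using () renaming (⁻¹-∙-comm to ⊝-⊕)

  infixl 6 _−_
  infixr 8 _∙_

  _−_ : G → G → G
  a − b = a ⊕ (⊝ b)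

  _∙_ : ℕ → G → G
  _∙_ = pow Γ

  x⊕y−y : ∀ x y → (x ⊕ y) − y ≡ x
  x⊕y−y x y = trans (⊕-assoc x y (⊝ y)) (trans (cong (x ⊕_) (⊕-inverseʳ y)) (⊕-identityʳ x))

  x−y⊕y : ∀ x y → (x − y) ⊕ y ≡ x
  x−y⊕y x y = trans (⊕-assoc x (⊝ y) y) (trans (cong (x ⊕_) (⊕-inverseˡ y)) (⊕-identityʳ x))

  −-−-swap : ∀ z x y → (z − x) − y ≡ (z − y) − x
  −-−-swap z x y = trans (⊕-assoc z (⊝ x) (⊝ y)) (trans (cong (z ⊕_) (⊕-comm (⊝ x) (⊝ y))) (sym (⊕-assoc z (⊝ y) (⊝ x))))

  −-⊕ : ∀ z x y → z − (x ⊕ y) ≡ (z − y) − x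
  −-⊕ z x y = trans (cong (z ⊕_) (sym (⊝-⊕ x y)))
    (trans (sym (⊕-assoc z (⊝ x) (⊝ y))) (−-−-swap z x y))

  ⊝-− : ∀ x y → ⊝ (x − y) ≡ y − x
  ⊝-− x y = trans (sym (⊝-⊕ x (⊝ y))) (trans (cong ((⊝ x) ⊕_) (⊝-involutive y)) (⊕-comm (⊝ x) y))

  z−[z−x] : ∀ z x → z − (z − x) ≡ x
  z−[z−x] z x = trans (cong (z ⊕_) (⊝-− z x)) (trans (⊕-comm z (x − z)) (x−y⊕y x z))

  −-telescope : ∀ w u v → (w − u) − (v − u) ≡ w − v
  −-telescope w u v = trans (−-⊕ (w − u) v (⊝ u)) (cong (_− v)
    (trans (cong ((w − u) ⊕_) (⊝-involutive u)) (x−y⊕y w u)))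

  −-solve : ∀ {z g k} → z − g ≡ k → z ≡ g ⊕ k
  −-solve {z} {g} eq = trans (sym (x−y⊕y z g)) (trans (cong (_⊕ g) eq) (⊕-comm _ g))

  ∙-+ : ∀ j k x → (j ℕ.+ k) ∙ x ≡ (j ∙ x) ⊕ (k ∙ x)
  ∙-+ zero    k x = sym (⊕-identityˡ _)
  ∙-+ (suc j) k x = trans (cong (x ⊕_) (∙-+ j k x)) (sym (⊕-assoc x _ _))

  ∙-* : ∀ j k x → (j ℕ.* k) ∙ x ≡ j ∙ k ∙ x
  ∙-* zero    k x = refl
  ∙-* (suc j) k x = trans (∙-+ k (j ℕ.* k) x) (cong ((k ∙ x) ⊕_) (∙-* j k x))

  ∙-𝟘 : ∀ k → k ∙ 𝟘 ≡ 𝟘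
  ∙-𝟘 zero    = refl
  ∙-𝟘 (suc k) = trans (⊕-identityˡ _) (∙-𝟘 k)

  ∙-comm : ∀ j k x → j ∙ k ∙ x ≡ k ∙ j ∙ x
  ∙-comm j k x = trans (sym (∙-* j k x)) (trans (cong (_∙ x) (ℕₚ.*-comm j k)) (∙-* k j x))

  ∙-1 : ∀ x → 1 ∙ x ≡ x
  ∙-1 = ⊕-identityʳ

  ∙-⊝ : ∀ k x → k ∙ (⊝ x) ≡ ⊝ (k ∙ x)
  ∙-⊝ zero    x = sym ⊝-𝟘
  ∙-⊝ (suc k) x = trans (cong ((⊝ x) ⊕_) (∙-⊝ k x)) (⊝-⊕ x (k ∙ x))

module GroupAlgebra (K : CRing) (Γ : FinAbGroup) where
  open RingKit K
  open GroupKit Γ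

  -- Vectors are used because coefficientwise equality of vectors yields the propositional equality
  -- that `CRing` demands.
  Alg : Set
  Alg = Vec Carrier n

  infixl 9 _[_]
  _[_] : Alg → G → Carrier
  _[_] = Vec.lookup

  mk : (G → Carrier) → Alg
  mk = Vec.tabulate

  mk-[] : ∀ f z → mk f [ z ] ≡ f z
  mk-[] = Vecₚ.lookup∘tabulate

  ext : ∀ {a b : Alg} → (∀ z → a [ z ] ≡ b [ z ]) → a ≡ b
  ext {a} {b} eq = trans (sym (Vecₚ.tabulate∘lookup a)) (trans (Vecₚ.tabulate-cong eq) (Vecₚ.tabulate∘lookup b))

  δ′ : G → G → Carrier → Carrier
  δ′ g z c = if does (z Fin.≟ g) then c else 0#

  δ′-≡ : ∀ g c → δ′ g g c ≡ c
  δ′-≡ g c rewrite dec-true (g Fin.≟ g) refl = refl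

  δ′-≢ : ∀ {g z} c → z ≢ g → δ′ g z c ≡ 0#
  δ′-≢ {g} {z} c ne rewrite dec-false (z Fin.≟ g) ne = refl

  single : Carrier → G → Alg
  single c g = mk λ z → δ′ g z c

  single-≡ : ∀ c g → single c g [ g ] ≡ c
  single-≡ c g = trans (mk-[] _ g) (δ′-≡ g c)

  single-≢ : ∀ c {g z} → z ≢ g → single c g [ z ] ≡ 0#
  single-≢ c {g} {z} ne = trans (mk-[] _ z) (δ′-≢ c ne)

  infixl 6 _⊞_
  infixl 7 _⋆_

  _⊞_ _⋆_ : Alg → Alg → Alg
  a ⊞ b = mk λ z → a [ z ] + b [ z ]
  a ⋆ b = mk λ z → sum λ x → a [ x ] * b [ z − x ]

  ⊟_ : Alg → Alg
  ⊟ a = mk λ z → - a [ z ]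

  0A 1A : Alg
  0A = mk λ _ → 0#
  1A = single 1# 𝟘

  sum-δ : ∀ {m} (g : Fin m) (f : Fin m → Carrier) → (∀ z → z ≢ g → f z ≡ 0#) → sum f ≡ f g
  sum-δ {suc m} zero    f eq = trans (cong (f zero +_)
    (trans (sum-cong-≗ λ i → eq (suc i) λ ()) (sum-replicate-zero m))) (+-identityʳ _)
  sum-δ {suc m} (suc g) f eq = trans (cong₂ _+_ (eq zero λ ())
    (sum-δ g (f ∘ suc) λ z ne → eq (suc z) (ne ∘ Finₚ.suc-injective))) (+-identityˡ _)

  shift : G → Permutation n n
  shift y = permutation (_⊕ y) (_− y) (λ x → x−y⊕y x y) (λ x → x⊕y−y x y)

  reflect : G → Permutation n n
  reflect z = permutation (λ x → z − x) (λ x → z − x) (z−[z−x] z) (z−[z−x] z)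

  single-⋆ : ∀ c g b z → (single c g ⋆ b) [ z ] ≡ c * b [ z − g ]
  single-⋆ c g b z = trans (mk-[] _ z) (trans
    (sum-δ g _ λ x ne → trans (cong (_* b [ z − x ]) (single-≢ c ne)) (zeroˡ _))
    (cong (_* b [ z − g ]) (single-≡ c g)))

  ⋆-comm : ∀ a b → a ⋆ b ≡ b ⋆ a
  ⋆-comm a b = Vecₚ.tabulate-cong λ z → trans (sum-permute _ (reflect z))
    (sum-cong-≗ λ x → trans (cong (λ y → a [ z − x ] * b [ y ]) (z−[z−x] z x)) (*-comm _ _))

  ⋆-assoc : ∀ a b c → (a ⋆ b) ⋆ c ≡ a ⋆ (b ⋆ c)
  ⋆-assoc a b c = Vecₚ.tabulate-cong λ z → begin
    sum (λ x → (a ⋆ b) [ x ] * c [ z − x ])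
      ≡⟨ sum-cong-≗ (λ x → trans (cong (_* c [ z − x ]) (mk-[] _ x)) (*-distribʳ-sum (c [ z − x ]) (λ y → a [ y ] * b [ x − y ]))) ⟩
    sum (λ x → sum λ y → a [ y ] * b [ x − y ] * c [ z − x ])
      ≡⟨ ∑-comm (λ x y → a [ y ] * b [ x − y ] * c [ z − x ]) ⟩
    sum (λ y → sum λ x → a [ y ] * b [ x − y ] * c [ z − x ])
      ≡⟨ sum-cong-≗ (λ y → sum-permute (λ x → a [ y ] * b [ x − y ] * c [ z − x ]) (shift y)) ⟩
    sum (λ y → sum λ x → a [ y ] * b [ (x ⊕ y) − y ] * c [ z − (x ⊕ y) ])
      ≡⟨ sum-cong-≗ (λ y → sum-cong-≗ λ x → trans
           (cong₂ (λ p q → a [ y ] * b [ p ] * c [ q ]) (x⊕y−y x y) (−-⊕ z x y)) (*-assoc _ _ _)) ⟩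
    sum (λ y → sum λ x → a [ y ] * (b [ x ] * c [ (z − y) − x ]))
      ≡⟨ sum-cong-≗ (λ y → *-distribˡ-sum (a [ y ]) (λ x → b [ x ] * c [ (z − y) − x ])) ⟨
    sum (λ y → a [ y ] * sum λ x → b [ x ] * c [ (z − y) − x ])
      ≡⟨ sum-cong-≗ (λ y → cong (a [ y ] *_) (mk-[] _ (z − y))) ⟨
    sum (λ y → a [ y ] * (b ⋆ c) [ z − y ]) ∎
    where open ≡-Reasoning

  ⋆-identityˡ : ∀ a → 1A ⋆ a ≡ a
  ⋆-identityˡ a = ext λ z → trans (single-⋆ 1# 𝟘 a z) (trans (*-identityˡ _)
    (cong (a [_]) (trans (cong (z ⊕_) ⊝-𝟘) (⊕-identityʳ z))))

  ⋆-distribˡ : ∀ a b c → a ⋆ (b ⊞ c) ≡ a ⋆ b ⊞ a ⋆ c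
  ⋆-distribˡ a b c = Vecₚ.tabulate-cong λ z → begin
    sum (λ x → a [ x ] * (b ⊞ c) [ z − x ])
      ≡⟨ sum-cong-≗ (λ x → trans (cong (a [ x ] *_) (mk-[] _ (z − x))) (distribˡ _ _ _)) ⟩
    sum (λ x → a [ x ] * b [ z − x ] + a [ x ] * c [ z − x ])
      ≡⟨ ∑-distrib-+ (λ x → a [ x ] * b [ z − x ]) (λ x → a [ x ] * c [ z − x ]) ⟩
    sum (λ x → a [ x ] * b [ z − x ]) + sum (λ x → a [ x ] * c [ z − x ])
      ≡⟨ cong₂ _+_ (mk-[] _ z) (mk-[] _ z) ⟨
    (a ⋆ b) [ z ] + (a ⋆ c) [ z ] ∎
    where open ≡-Reasoning

  ⊞-comm : ∀ a b → a ⊞ b ≡ b ⊞ a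
  ⊞-comm a b = Vecₚ.tabulate-cong λ z → +-comm _ _

  ⊞-identityˡ : ∀ a → 0A ⊞ a ≡ a
  ⊞-identityˡ a = ext λ z → trans (mk-[] _ z) (trans (cong (_+ a [ z ]) (mk-[] _ z)) (+-identityˡ _))

  ⊞-inverseˡ : ∀ a → (⊟ a) ⊞ a ≡ 0A
  ⊞-inverseˡ a = Vecₚ.tabulate-cong λ z → trans (cong (_+ a [ z ]) (mk-[] _ z)) (-‿inverseˡ _)

  isCommutativeRingA : IsCommutativeRing _≡_ _⊞_ _⋆_ ⊟_ 0A 1A
  isCommutativeRingA = record
    { isRing = record
      { +-isAbelianGroup = record
        { isGroup = record
          { isMonoid = record
            { isSemigroup = record
              { isMagma = record
                { isEquivalence = isEquivalence
                ; ∙-cong = cong₂ _⊞_ }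
              ; assoc = λ a b c → Vecₚ.tabulate-cong λ z → trans (cong (_+ c [ z ]) (mk-[] _ z))
                  (trans (+-assoc _ _ _) (sym (cong (a [ z ] +_) (mk-[] _ z)))) }
            ; identity = ⊞-identityˡ , λ a → trans (⊞-comm a 0A) (⊞-identityˡ a) }
          ; inverse = ⊞-inverseˡ , λ a → trans (⊞-comm a (⊟ a)) (⊞-inverseˡ a)
          ; ⁻¹-cong = cong ⊟_ }
        ; comm = ⊞-comm }
      ; *-cong = cong₂ _⋆_
      ; *-assoc = ⋆-assoc
      ; *-identity = ⋆-identityˡ , λ a → trans (⋆-comm a 1A) (⋆-identityˡ a)
      ; distrib = ⋆-distribˡ , λ a b c → trans (⋆-comm (b ⊞ c) a)
          (trans (⋆-distribˡ a b c) (cong₂ _⊞_ (⋆-comm a b) (⋆-comm a c))) }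
    ; *-comm = ⋆-comm
    }

  ringA : CRing
  ringA = record { isCommutativeRing = isCommutativeRingA }

  single-+ : ∀ c d g → single (c + d) g ≡ single c g ⊞ single d g
  single-+ c d g = Vecₚ.tabulate-cong λ z → trans (at (does (z Fin.≟ g))) (sym (cong₂ _+_ (mk-[] _ z) (mk-[] _ z)))
    where
    at : ∀ b → (if b then c + d else 0#) ≡ (if b then c else 0#) + (if b then d else 0#)
    at true  = refl
    at false = sym (+-identityˡ 0#)

  single-neg : ∀ c g → single (- c) g ≡ ⊟ single c g
  single-neg c g = Vecₚ.tabulate-cong λ z → trans (at (does (z Fin.≟ g))) (sym (cong -_ (mk-[] _ z)))
    where
    at : ∀ b → (if b then - c else 0#) ≡ - (if b then c else 0#)
    at true  = refl
    at false = sym -0#≈0#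

  single-0 : ∀ g → single 0# g ≡ 0A
  single-0 g = Vecₚ.tabulate-cong λ z → at (does (z Fin.≟ g))
    where
    at : ∀ b → (if b then 0# else 0#) ≡ 0#
    at true  = refl
    at false = refl

  single-* : ∀ c d g k → single c g ⋆ single d k ≡ single (c * d) (g ⊕ k)
  single-* c d g k = ext λ z → trans (single-⋆ c g (single d k) z) (at z (z − g Fin.≟ k))
    where
    at : ∀ z → Dec (z − g ≡ k) → c * single d k [ z − g ] ≡ single (c * d) (g ⊕ k) [ z ]
    at z (yes eq) with refl ← −-solve {z} {g} {k} eq =
      trans (cong (c *_) (trans (cong (single d k [_]) eq) (single-≡ d k))) (sym (single-≡ (c * d) (g ⊕ k)))
    at z (no ne) = trans (cong (c *_) (single-≢ d ne))
      (trans (zeroʳ c) (sym (single-≢ (c * d) λ e → ne (trans (cong (_− g) (trans e (⊕-comm g k))) (x⊕y−y k g)))))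

  constant : Hom K ringA
  constant = record
    { ⟦_⟧      = λ c → single c 𝟘
    ; +-homo   = λ c d → single-+ c d 𝟘
    ; *-homo   = λ c d → trans (cong (single (c * d)) (sym (⊕-identityˡ 𝟘))) (sym (single-* c d 𝟘 𝟘))
    ; neg-homo = λ c → single-neg c 𝟘
    ; 0-homo   = single-0 𝟘
    ; 1-homo   = refl
    }

  module A = RingKit ringA

  sum-[] : ∀ {m} (F : Fin m → Alg) z → A.sum F [ z ] ≡ sum λ i → F i [ z ]
  sum-[] {zero}  F z = mk-[] _ z
  sum-[] {suc m} F z = trans (mk-[] _ z) (cong (F zero [ z ] +_) (sum-[] (F ∘ suc) z))

  sum-single : ∀ a → A.sum (λ g → single (a [ g ]) g) ≡ a
  sum-single a = ext λ z → trans (sum-[] (λ g → single (a [ g ]) g) z)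
    (trans (sum-δ z (λ g → single (a [ g ]) g [ z ]) λ g ne → single-≢ (a [ g ]) (ne ∘ sym)) (single-≡ (a [ z ]) z))

  single-^ : ∀ c g k → single c g A.^ k ≡ single (c ^ k) (k ∙ g)
  single-^ c g zero    = refl
  single-^ c g (suc k) = trans (cong (single c g ⋆_) (single-^ c g k)) (single-* c (c ^ k) g (k ∙ g))

  constant-⋆ : ∀ c a z → (single c 𝟘 ⋆ a) [ z ] ≡ c * a [ z ]
  constant-⋆ c a z = trans (single-⋆ c 𝟘 a z) (cong (λ y → c * a [ y ]) (trans (cong (z ⊕_) ⊝-𝟘) (⊕-identityʳ z)))

  fromℤ-⋆ : ∀ i a z → (A.fromℤ i ⋆ a) [ z ] ≡ fromℤ i * a [ z ]
  fromℤ-⋆ i a z = trans (cong (λ c → (c ⋆ a) [ z ]) (sym (Hom.fromℤ-homo constant i))) (constant-⋆ (fromℤ i) a z)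

  convMatrix : Alg → G → G → Carrier
  convMatrix a u v = a [ v − u ]

  convMatrix-⋆ : ∀ a b u w → convMatrix (a ⋆ b) u w ≡ sum λ v → convMatrix a u v * convMatrix b v w
  convMatrix-⋆ a b u w = trans (mk-[] _ (w − u)) (trans
    (sum-permute _ (shift (⊝ u)))
    (sum-cong-≗ λ v → cong (λ y → a [ v − u ] * b [ y ]) (−-telescope w u v)))

  convMatrix-constant : ∀ c u v → convMatrix (single c 𝟘) u v ≡ c * Matrix.δM K u v
  convMatrix-constant c u v with u Fin.≟ v
  ... | yes refl = trans (cong (single c 𝟘 [_]) (⊕-inverseʳ u)) (trans (single-≡ c 𝟘) (sym (*-identityʳ c)))
  ... | no ne    = trans (single-≢ c λ e → ne (sym (trans (−-solve e) (⊕-identityʳ u)))) (sym (zeroʳ c))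

-- Elements annihilated by a product of integer linear factors

module SplitElements (R : CRing) where
  open RingKit R
  open RootProduct R

  Split : Carrier → Set
  Split x = Σ (List ℤ) λ L → rootProduct x L ≡ 0#

  -- (x + y - a - b) = (x - a) + (y - b): the first summand lowers the first
  -- annihilating product, the second summand the second one.
  split-sum : ∀ x y as bs → Σ (List ℤ) λ L → ∀ z →
    z * rootProduct x as ≡ 0# → z * rootProduct y bs ≡ 0# → z * rootProduct (x + y) L ≡ 0#
  split-sum x y []       bs       = [] , λ z p q → p
  split-sum x y (a ∷ as) []       = [] , λ z p q → q
  split-sum x y (a ∷ as) (b ∷ bs) =
    let L₁ , f₁ = split-sum x y as (b ∷ bs)
        L₂ , f₂ = split-sum x y (a ∷ as) bs
    in (a ℤ.+ b) ∷ (L₁ ++ L₂) , λ z p q → begin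
      z * ((x + y - fromℤ (a ℤ.+ b)) * rootProduct (x + y) (L₁ ++ L₂))
        ≡⟨ cong₂ (λ c r → z * ((x + y - c) * r)) (fromℤ-+ a b) (rootProduct-++ (x + y) L₁ L₂) ⟩
      z * ((x + y - (fromℤ a + fromℤ b)) * (rootProduct (x + y) L₁ * rootProduct (x + y) L₂))
        ≡⟨ solve 7 (λ z x y a b r s → z :* ((x :+ y :- (a :+ b)) :* (r :* s))
                     := s :* ((z :* (x :- a)) :* r) :+ r :* ((z :* (y :- b)) :* s))
             refl z x y (fromℤ a) (fromℤ b) (rootProduct (x + y) L₁) (rootProduct (x + y) L₂) ⟩
      rootProduct (x + y) L₂ * ((z * (x - fromℤ a)) * rootProduct (x + y) L₁)
        + rootProduct (x + y) L₁ * ((z * (y - fromℤ b)) * rootProduct (x + y) L₂)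
        ≡⟨ cong₂ (λ u v → rootProduct (x + y) L₂ * u + rootProduct (x + y) L₁ * v)
             (f₁ _ (trans (*-assoc _ _ _) p) (times (x - fromℤ a) z _ q))
             (f₂ _ (times (y - fromℤ b) z _ p) (trans (*-assoc _ _ _) q)) ⟩
      rootProduct (x + y) L₂ * 0# + rootProduct (x + y) L₁ * 0#
        ≡⟨ solve 2 (λ r s → r :* :0 :+ s :* :0 := :0) refl _ _ ⟩
      0# ∎
    where
    open ≡-Reasoning
    times : ∀ c z r → z * r ≡ 0# → (z * c) * r ≡ 0#
    times c z r eq = trans (solve 3 (λ c z r → (z :* c) :* r := c :* (z :* r)) refl c z r) (trans (cong (c *_) eq) (zeroʳ c))

  split-+ : ∀ {x y} → Split x → Split y → Split (x + y)
  split-+ {x} {y} (as , p) (bs , q) =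
    let L , f = split-sum x y as bs
    in L , trans (sym (*-identityˡ _)) (f 1# (trans (*-identityˡ _) p) (trans (*-identityˡ _) q))

  rootProduct-scale : ∀ c x L → ∃ λ u → rootProduct (fromℤ c * x) (List.map (c ℤ.*_) L) ≡ u * rootProduct x L
  rootProduct-scale c x []      = 1# , sym (*-identityˡ _)
  rootProduct-scale c x (l ∷ L) =
    let u , eq = rootProduct-scale c x L
    in fromℤ c * u , trans (cong₂ (λ d r → (fromℤ c * x - d) * r) (fromℤ-* c l) eq)
      (solve 5 (λ c x l u r → (c :* x :- c :* l) :* (u :* r) := (c :* u) :* ((x :- l) :* r))
        refl (fromℤ c) x (fromℤ l) u (rootProduct x L))

  split-scale : ∀ c {x} → Split x → Split (fromℤ c * x)
  split-scale c {x} (L , p) =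
    let u , eq = rootProduct-scale c x L
    in List.map (c ℤ.*_) L , trans eq (trans (cong (u *_) p) (zeroʳ u))

  split-0 : Split 0#
  split-0 = ℤ.0ℤ ∷ [] , solve 0 ((:0 :- :0) :* :1 := :0) refl

  geometric : Carrier → ℕ → Carrier
  geometric x zero    = 0#
  geometric x (suc k) = geometric x k + x ^ k

  geometric-shift : ∀ x k → x * geometric x k + 1# ≡ geometric x k + x ^ k
  geometric-shift x zero    = solve 1 (λ x → x :* :0 :+ :1 := :0 :+ :1) refl x
  geometric-shift x (suc k) = begin
    x * (geometric x k + x ^ k) + 1#
      ≡⟨ solve 3 (λ x g p → x :* (g :+ p) :+ :1 := (x :* g :+ :1) :+ x :* p) refl x (geometric x k) (x ^ k) ⟩
    (x * geometric x k + 1#) + x * x ^ k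
      ≡⟨ cong (_+ x * x ^ k) (geometric-shift x k) ⟩
    (geometric x k + x ^ k) + x * x ^ k ∎
    where open ≡-Reasoning

  geometric-fixed : ∀ x m → x ^ m ≡ 1# → x * geometric x m ≡ geometric x m
  geometric-fixed x m eq = begin
    x * geometric x m                ≡⟨ solve 1 (λ a → a := (a :+ :1) :- :1) refl _ ⟩
    (x * geometric x m + 1#) - 1#    ≡⟨ cong (_- 1#) (trans (geometric-shift x m) (cong (geometric x m +_) eq)) ⟩
    (geometric x m + 1#) - 1#        ≡⟨ solve 1 (λ a → (a :+ :1) :- :1 := a) refl _ ⟩
    geometric x m                    ∎
    where open ≡-Reasoning

  -- Every power of x acts as 1 on e. For e itself a geometric sum of k terms this says that e² = k
  -- e, so e is a multiple of an idempotent up to scaling.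
  geometric-* : ∀ x e → x * e ≡ e → ∀ k → geometric x k * e ≡ fromℕ k * e
  geometric-* x e eq zero    = refl
  geometric-* x e eq (suc k) = begin
    (geometric x k + x ^ k) * e        ≡⟨ distribʳ _ _ _ ⟩
    geometric x k * e + x ^ k * e      ≡⟨ cong₂ _+_ (geometric-* x e eq k) (power k) ⟩
    fromℕ k * e + e                    ≡⟨ solve 2 (λ k e → k :* e :+ e := (:1 :+ k) :* e) refl (fromℕ k) e ⟩
    (1# + fromℕ k) * e                 ≡⟨ cong (_* e) (fromℕ-+ 1 k) ⟨
    fromℕ (suc k) * e                  ∎
    where
    open ≡-Reasoning
    power : ∀ k → x ^ k * e ≡ e
    power zero    = *-identityˡ e
    power (suc k) = trans (*-assoc _ _ _) (trans (cong (x *_) (power k)) eq)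

  -- α and β play the rôles of (1 ± i√3)/2.
  module _ (α β : Carrier) (αα : α * α ≡ - β) (ββ : β * β ≡ - α) (αβ : α * β ≡ 1#) where

    ψ : ℕ → Carrier
    ψ 0                   = 0#
    ψ 1                   = α
    ψ 2                   = β
    ψ (suc (suc (suc k))) = ψ k

    twisted : Carrier → ℕ → Carrier
    twisted y zero    = 0#
    twisted y (suc k) = twisted y k + ψ k * y ^ k

    ψ-3 : ∀ c m → ψ (c ℕ.+ m ℕ.* 3) ≡ ψ c
    ψ-3 0                   zero    = refl
    ψ-3 0                   (suc m) = ψ-3 0 m
    ψ-3 1                   zero    = refl
    ψ-3 1                   (suc m) = ψ-3 1 m
    ψ-3 2                   zero    = refl
    ψ-3 2                   (suc m) = ψ-3 2 m
    ψ-3 (suc (suc (suc c))) m       = ψ-3 c m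

    -- Terms are grouped in blocks of three: residue 0 contributes nothing, and residues 1 and 2
    -- give the same factor in each block.
    twisted-geometric : ∀ y m → twisted y (m ℕ.* 3) ≡ (α * y + β * (y * y)) * geometric (y ^ 3) m
    twisted-geometric y zero    = sym (zeroʳ _)
    twisted-geometric y (suc m) = begin
      twisted y k + ψ k * y ^ k + ψ (suc k) * (y * y ^ k) + ψ (suc (suc k)) * (y * (y * y ^ k))
        ≡⟨ cong₂ _+_ (cong₂ _+_ (cong₂ (λ s p → s + p * y ^ k) (twisted-geometric y m) (ψ-3 0 m))
             (cong (_* (y * y ^ k)) (ψ-3 1 m))) (cong (_* (y * (y * y ^ k))) (ψ-3 2 m)) ⟩
      u * geometric (y ^ 3) m + 0# * y ^ k + α * (y * y ^ k) + β * (y * (y * y ^ k))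
        ≡⟨ solve 5 (λ α β y g p → (α :* y :+ β :* (y :* y)) :* g :+ :0 :* p :+ α :* (y :* p) :+ β :* (y :* (y :* p))
                     := (α :* y :+ β :* (y :* y)) :* (g :+ p)) refl α β y (geometric (y ^ 3) m) (y ^ k) ⟩
      u * (geometric (y ^ 3) m + y ^ k)
        ≡⟨ cong (λ p → u * (geometric (y ^ 3) m + p)) (trans (cong (y ^_) (ℕₚ.*-comm m 3)) (sym (^-assocʳ y 3 m))) ⟩
      u * (geometric (y ^ 3) m + (y ^ 3) ^ m) ∎
      where
      open ≡-Reasoning
      k = m ℕ.* 3
      u = α * y + β * (y * y)

    -- Since y³ acts as 1 on e and e² = m e, the relations between α and β give g² = m (2e - g) and
    -- g e = m g; eliminating e leaves the cubic. Its roots 0, m and -2m are the values of g under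
    -- characters.
    cubic : ∀ y e m → y ^ 3 * e ≡ e → e * e ≡ m * e →
            let g = (α * y + β * (y * y)) * e in g * ((g - m) * (g + (m + m))) ≡ 0#
    cubic y e m ye ee = begin
      g * ((g - m) * (g + (m + m)))
        ≡⟨ solve 2 (λ g m → g :* ((g :- m) :* (g :+ (m :+ m))) := g :* (g :* g :+ m :* g :- (m :* m :+ m :* m))) refl g m ⟩
      g * (g * g + m * g - (m * m + m * m))
        ≡⟨ cong (λ s → g * (s + m * g - (m * m + m * m))) gg ⟩
      g * (m * (e + e - g) + m * g - (m * m + m * m))
        ≡⟨ solve 3 (λ g m e → g :* (m :* (e :+ e :- g) :+ m :* g :- (m :* m :+ m :* m))
                     := (m :+ m) :* (g :* e :- m :* g)) refl g m e ⟩
      (m + m) * (g * e - m * g)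
        ≡⟨ cong (λ s → (m + m) * (s - m * g)) ge ⟩
      (m + m) * (m * g - m * g)
        ≡⟨ solve 2 (λ m g → (m :+ m) :* (m :* g :- m :* g) := :0) refl m g ⟩
      0# ∎
      where
      open ≡-Reasoning
      u = α * y + β * (y * y)
      g = u * e
      ge : g * e ≡ m * g
      ge = trans (*-assoc u e e) (trans (cong (u *_) ee) (solve 3 (λ u m e → u :* (m :* e) := m :* (u :* e)) refl u m e))
      gg : g * g ≡ m * (e + e - g)
      gg = begin
        g * g
          ≡⟨ solve 4 (λ α β y e → ((α :* y :+ β :* (y :* y)) :* e) :* ((α :* y :+ β :* (y :* y)) :* e)
               := (α :* α) :* ((y :* y) :* (e :* e)) :+ (α :* β :+ α :* β) :* (y :^ 3 :* (e :* e))
                  :+ (β :* β) :* (y :* (y :^ 3 :* (e :* e)))) refl α β y e ⟩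
        (α * α) * ((y * y) * (e * e)) + (α * β + α * β) * (y ^ 3 * (e * e)) + (β * β) * (y * (y ^ 3 * (e * e)))
          ≡⟨ cong (λ s → (α * α) * ((y * y) * s) + (α * β + α * β) * (y ^ 3 * s) + (β * β) * (y * (y ^ 3 * s))) ee ⟩
        (α * α) * ((y * y) * (m * e)) + (α * β + α * β) * (y ^ 3 * (m * e)) + (β * β) * (y * (y ^ 3 * (m * e)))
          ≡⟨ cong (λ s → (α * α) * ((y * y) * (m * e)) + (α * β + α * β) * s + (β * β) * (y * s))
               (trans (solve 3 (λ t m e → t :* (m :* e) := m :* (t :* e)) refl (y ^ 3) m e) (cong (m *_) ye)) ⟩
        (α * α) * ((y * y) * (m * e)) + (α * β + α * β) * (m * e) + (β * β) * (y * (m * e))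
          ≡⟨ cong₂ (λ s t → s * ((y * y) * (m * e)) + (α * β + α * β) * (m * e) + t * (y * (m * e))) αα ββ ⟩
        (- β) * ((y * y) * (m * e)) + (α * β + α * β) * (m * e) + (- α) * (y * (m * e))
          ≡⟨ cong (λ s → (- β) * ((y * y) * (m * e)) + (s + s) * (m * e) + (- α) * (y * (m * e))) αβ ⟩
        (- β) * ((y * y) * (m * e)) + (1# + 1#) * (m * e) + (- α) * (y * (m * e))
          ≡⟨ solve 5 (λ α β y m e → (:- β) :* ((y :* y) :* (m :* e)) :+ (:1 :+ :1) :* (m :* e) :+ (:- α) :* (y :* (m :* e))
               := m :* (e :+ e :- (α :* y :+ β :* (y :* y)) :* e)) refl α β y m e ⟩
        m * (e + e - g) ∎

    split-twisted : ∀ y m → y ^ (m ℕ.* 3) ≡ 1# → Split (twisted y (m ℕ.* 3))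
    split-twisted y m eq = ℤ.0ℤ ∷ pos m ∷ (ℤ.- (pos m ℤ.+ pos m)) ∷ [] , (begin
      (g - 0#) * ((g - fromℕ m) * ((g - fromℤ (ℤ.- (pos m ℤ.+ pos m))) * 1#))
        ≡⟨ cong (λ c → (g - 0#) * ((g - fromℕ m) * ((g - c) * 1#)))
             (trans (fromℤ-neg (pos m ℤ.+ pos m)) (cong -_ (fromℤ-+ (pos m) (pos m)))) ⟩
      (g - 0#) * ((g - fromℕ m) * ((g - - (fromℕ m + fromℕ m)) * 1#))
        ≡⟨ solve 2 (λ g m → (g :- :0) :* ((g :- m) :* ((g :- :- (m :+ m)) :* :1))
                            := g :* ((g :- m) :* (g :+ (m :+ m)))) refl g (fromℕ m) ⟩
      g * ((g - fromℕ m) * (g + (fromℕ m + fromℕ m)))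
        ≡⟨ cong (λ g → g * ((g - fromℕ m) * (g + (fromℕ m + fromℕ m)))) (twisted-geometric y m) ⟩
      _ ≡⟨ cubic y e (fromℕ m) ye (geometric-* (y ^ 3) e ye m) ⟩
      0# ∎)
      where
      open ≡-Reasoning
      g = twisted y (m ℕ.* 3)
      e = geometric (y ^ 3) m
      ye : y ^ 3 * e ≡ e
      ye = geometric-fixed (y ^ 3) m (trans (^-assocʳ y 3 m) (trans (cong (y ^_) (ℕₚ.*-comm 3 m)) eq))

-- Orders of group elements

inverse-mod : ∀ j m → 0 ℕ.< m → Coprime j m → ∃ λ j′ → ∃ λ a → ∃ λ b → j′ ℕ.* j ℕ.+ a ℕ.* m ≡ 1 ℕ.+ b ℕ.* m
inverse-mod j (suc m) _ c with coprime-Bézout c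
... | Bézout.+- x y eq = x , 0 , y , trans (ℕₚ.+-identityʳ _) (sym eq)
-- Here 1 + x j is a multiple of the modulus `suc m`, so the inverse of j is -x, represented without
-- subtraction by m x.
... | Bézout.-+ x y eq = m ℕ.* x , 1 , m ℕ.* y , (begin
  m ℕ.* x ℕ.* j ℕ.+ 1 ℕ.* suc m     ≡⟨ regroup m x j ⟩
  1 ℕ.+ m ℕ.* (1 ℕ.+ x ℕ.* j)       ≡⟨ cong (λ z → 1 ℕ.+ m ℕ.* z) eq ⟩
  1 ℕ.+ m ℕ.* (y ℕ.* suc m)         ≡⟨ cong suc (ℕₚ.*-assoc m y (suc m)) ⟨
  1 ℕ.+ m ℕ.* y ℕ.* suc m           ∎)
  where
  open ≡-Reasoning
  regroup : ∀ m x j → m ℕ.* x ℕ.* j ℕ.+ 1 ℕ.* suc m ≡ 1 ℕ.+ m ℕ.* (1 ℕ.+ x ℕ.* j)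
  regroup = solve-∀

prime-3 : Prime 3
prime-3 = from-yes (prime? 3)

module Orders (Γ : FinAbGroup) where
  open GroupKit Γ

  *-kills : ∀ k m z → m ∙ z ≡ 𝟘 → (k ℕ.* m) ∙ z ≡ 𝟘
  *-kills k m z eq = trans (∙-* k m z) (trans (cong (k ∙_) eq) (∙-𝟘 k))

  kills-multiple : ∀ m z → m ∙ z ≡ 𝟘 → ∀ i → m ∙ i ∙ z ≡ 𝟘
  kills-multiple m z eq i = trans (∙-comm m i z) (trans (cong (i ∙_) eq) (∙-𝟘 i))

  ∙-mod : ∀ k a m z → m ∙ z ≡ 𝟘 → (k ℕ.+ a ℕ.* m) ∙ z ≡ k ∙ z
  ∙-mod k a m z eq = trans (∙-+ k (a ℕ.* m) z) (trans (cong ((k ∙ z) ⊕_) (*-kills a m z eq)) (⊕-identityʳ _))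

  -- One inverse modulo m serves every z killed by m, and when 3 divides m the congruence descends
  -- to one modulo 3.
  inverse-acts : ∀ j m → 0 ℕ.< m → Coprime j m →
    ∃ λ j′ → (∀ z → m ∙ z ≡ 𝟘 → j′ ∙ j ∙ z ≡ z) × (3 ∣ m → (j′ ℕ.* j) % 3 ≡ 1)
  inverse-acts j m m>0 c = j′ , acts , mod3
    where
    open ≡-Reasoning
    inv = inverse-mod j m m>0 c
    j′ = proj₁ inv
    a = proj₁ (proj₂ inv)
    b = proj₁ (proj₂ (proj₂ inv))
    eq = proj₂ (proj₂ (proj₂ inv))
    acts : ∀ z → m ∙ z ≡ 𝟘 → j′ ∙ j ∙ z ≡ z
    acts z mz = begin
      j′ ∙ j ∙ z                    ≡⟨ ∙-* j′ j z ⟨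
      (j′ ℕ.* j) ∙ z                ≡⟨ ∙-mod (j′ ℕ.* j) a m z mz ⟨
      (j′ ℕ.* j ℕ.+ a ℕ.* m) ∙ z    ≡⟨ cong (_∙ z) eq ⟩
      (1 ℕ.+ b ℕ.* m) ∙ z           ≡⟨ ∙-mod 1 b m z mz ⟩
      1 ∙ z                         ≡⟨ ∙-1 z ⟩
      z                             ∎
    mod3 : 3 ∣ m → (j′ ℕ.* j) % 3 ≡ 1
    mod3 (divides q refl) = begin
      (j′ ℕ.* j) % 3                          ≡⟨ [m+kn]%n≡m%n (j′ ℕ.* j) (a ℕ.* q) 3 ⟨
      (j′ ℕ.* j ℕ.+ a ℕ.* q ℕ.* 3) % 3        ≡⟨ cong (λ z → (j′ ℕ.* j ℕ.+ z) % 3) (ℕₚ.*-assoc a q 3) ⟩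
      (j′ ℕ.* j ℕ.+ a ℕ.* (q ℕ.* 3)) % 3      ≡⟨ cong (_% 3) eq ⟩
      (1 ℕ.+ b ℕ.* (q ℕ.* 3)) % 3             ≡⟨ cong (λ z → (1 ℕ.+ z) % 3) (ℕₚ.*-assoc b q 3) ⟨
      (1 ℕ.+ b ℕ.* q ℕ.* 3) % 3               ≡⟨ [m+kn]%n≡m%n 1 (b ℕ.* q) 3 ⟩
      1                                       ∎

  -- Upward search from m, with d the distance to an exponent already known to kill x.
  least-order : ∀ x d m → 0 ℕ.< m → (∀ j → 0 ℕ.< j → j ℕ.< m → j ∙ x ≢ 𝟘) → (m ℕ.+ d) ∙ x ≡ 𝟘 →
                Σ ℕ λ k → IsOrder Γ x k × k ℕ.≤ m ℕ.+ d
  least-order x d m m>0 below eq with m ∙ x Fin.≟ 𝟘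
  ... | yes e = m , (m>0 , e , below) , ℕₚ.m≤m+n m d
  least-order x zero    m m>0 below eq | no ne = ⊥-elim (ne (trans (cong (_∙ x) (sym (ℕₚ.+-identityʳ m))) eq))
  least-order x (suc d) m m>0 below eq | no ne =
    let k , ord , le = least-order x d (suc m) (s≤s z≤n) below′ (trans (cong (_∙ x) (sym (ℕₚ.+-suc m d))) eq)
    in k , ord , subst (k ℕ.≤_) (sym (ℕₚ.+-suc m d)) le
    where
    below′ : ∀ j → 0 ℕ.< j → j ℕ.< suc m → j ∙ x ≢ 𝟘
    below′ j j>0 (s≤s j≤m) with ℕₚ.m≤n⇒m<n∨m≡n j≤m
    ... | inj₁ j<m  = below j j>0 j<m
    ... | inj₂ refl = ne

  -- Two of the first n + 1 multiples of x coincide. The bound m ≤ n takes the place of Lagrange's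
  -- theorem in everything that follows.
  order : ∀ x → Σ ℕ λ m → IsOrder Γ x m × m ℕ.≤ n
  order x with Finₚ.pigeonhole (ℕₚ.n<1+n n) (λ i → toℕ i ∙ x)
  ... | i , j , i<j , eq = let m , ord , le = least-order x (ℕ.pred d) 1 (s≤s z≤n)
                                 (λ { (suc _) _ (s≤s ()) }) (trans (cong (_∙ x) d-suc) d∙x)
                           in m , ord , ℕₚ.≤-trans le (subst (ℕ._≤ n) (sym d-suc)
                                (ℕₚ.≤-trans (ℕₚ.m∸n≤m (toℕ j) (toℕ i)) (ℕₚ.≤-pred (Finₚ.toℕ<n j))))
    where
    d = toℕ j ℕ.∸ toℕ i
    d-suc : suc (ℕ.pred d) ≡ d
    d-suc = ℕₚ.suc-pred d {{ℕ.>-nonZero (ℕₚ.m<n⇒0<n∸m i<j)}}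
    d∙x : d ∙ x ≡ 𝟘
    d∙x = begin
      d ∙ x                                      ≡⟨ x⊕y−y (d ∙ x) (toℕ i ∙ x) ⟨
      ((d ∙ x) ⊕ (toℕ i ∙ x)) − (toℕ i ∙ x)      ≡⟨ cong (_− (toℕ i ∙ x)) (∙-+ d (toℕ i) x) ⟨
      ((d ℕ.+ toℕ i) ∙ x) − (toℕ i ∙ x)          ≡⟨ cong (λ k → (k ∙ x) − (toℕ i ∙ x)) (ℕₚ.m∸n+n≡m (ℕₚ.<⇒≤ i<j)) ⟩
      (toℕ j ∙ x) − (toℕ i ∙ x)                  ≡⟨ cong (_− (toℕ i ∙ x)) eq ⟨
      (toℕ i ∙ x) − (toℕ i ∙ x)                  ≡⟨ ⊕-inverseʳ _ ⟩
      𝟘                                          ∎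
      where open ≡-Reasoning

  order-% : ∀ {x m} → IsOrder Γ x m → ∀ k → ∃ λ r → r ℕ.< m × k ∙ x ≡ r ∙ x × ∃ λ q → k ≡ r ℕ.+ q ℕ.* m
  order-% {x} {suc m} (_ , mx , _) k = k % suc m , m%n<n k (suc m) ,
    trans (cong (_∙ x) (m≡m%n+[m/n]*n k (suc m))) (∙-mod (k % suc m) (k / suc m) (suc m) x mx) ,
    k / suc m , m≡m%n+[m/n]*n k (suc m)

  order-∣ : ∀ {x m} → IsOrder Γ x m → ∀ k → k ∙ x ≡ 𝟘 → m ∣ k
  order-∣ {x} {m} ord@(_ , _ , least) k eq with order-% ord k
  ... | zero  , r<m , e , q , k≡ = divides q k≡
  ... | suc r , r<m , e , q , k≡ = ⊥-elim (least (suc r) (s≤s z≤n) r<m (trans (sym e) eq))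

  order-unique : ∀ {x m m′} → IsOrder Γ x m → IsOrder Γ x m′ → m ≡ m′
  order-unique {x} {m} {m′} (m>0 , mx , l) (m′>0 , m′x , l′) with ℕₚ.<-cmp m m′
  ... | tri< lt _ _ = ⊥-elim (l′ m m>0 lt mx)
  ... | tri≈ _ e _  = e
  ... | tri> _ _ gt = ⊥-elim (l m′ m′>0 gt m′x)

  order-injective : ∀ {x m} → IsOrder Γ x m → ∀ i j → i ℕ.≤ j → j ℕ.< m → i ∙ x ≡ j ∙ x → i ≡ j
  order-injective {x} {m} (_ , _ , least) i j i≤j j<m eq with ℕₚ.m≤n⇒m<n∨m≡n i≤j
  ... | inj₂ e   = e
  ... | inj₁ i<j = ⊥-elim (least (j ℕ.∸ i) (ℕₚ.m<n⇒0<n∸m i<j) (ℕₚ.≤-<-trans (ℕₚ.m∸n≤m j i) j<m) (begin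
    (j ℕ.∸ i) ∙ x                               ≡⟨ x⊕y−y ((j ℕ.∸ i) ∙ x) (i ∙ x) ⟨
    (((j ℕ.∸ i) ∙ x) ⊕ (i ∙ x)) − (i ∙ x)       ≡⟨ cong (_− (i ∙ x)) (∙-+ (j ℕ.∸ i) i x) ⟨
    ((j ℕ.∸ i ℕ.+ i) ∙ x) − (i ∙ x)             ≡⟨ cong (λ k → (k ∙ x) − (i ∙ x)) (ℕₚ.m∸n+n≡m i≤j) ⟩
    (j ∙ x) − (i ∙ x)                           ≡⟨ cong (_− (i ∙ x)) eq ⟨
    (i ∙ x) − (i ∙ x)                           ≡⟨ ⊕-inverseʳ _ ⟩
    𝟘                                           ∎))
    where open ≡-Reasoning

  ⊝-kills : ∀ k x → k ∙ (⊝ x) ≡ 𝟘 → k ∙ x ≡ 𝟘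
  ⊝-kills k x eq = trans (sym (⊝-involutive _)) (trans (cong ⊝_ (trans (sym (∙-⊝ k x)) eq)) ⊝-𝟘)

  order-⊝ : ∀ {x m} → IsOrder Γ x m → IsOrder Γ (⊝ x) m
  order-⊝ {x} {m} (m>0 , mx , least) = m>0 , trans (∙-⊝ m x) (trans (cong ⊝_ mx) ⊝-𝟘) ,
    λ k k>0 k<m e → least k k>0 k<m (⊝-kills k x e)

  ⊝-power : ∀ m x → suc m ∙ x ≡ 𝟘 → m ∙ x ≡ ⊝ x
  ⊝-power m x eq = ⊝-unique x (m ∙ x) eq

  -- If j = q d and m = r d, then r already kills `j ∙ y`; its order r d therefore divides r, which
  -- forces d = 1.
  order-coprime : ∀ {y m} j → IsOrder Γ y m → IsOrder Γ (j ∙ y) m → Coprime j m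
  order-coprime {y} {m} j (m>0 , my , _) ord′ {d} (divides q refl , divides r refl) = d≡1 r m>0 le
    where
    le : r ℕ.* d ∣ r
    le = order-∣ ord′ r (trans (sym (∙-* r (q ℕ.* d) y)) (trans (cong (_∙ y) (swap r q d)) (*-kills q (r ℕ.* d) y my)))
      where
      swap : ∀ r q d → r ℕ.* (q ℕ.* d) ≡ q ℕ.* (r ℕ.* d)
      swap = solve-∀
    d≡1 : ∀ r → 0 ℕ.< r ℕ.* d → r ℕ.* d ∣ r → d ≡ 1
    d≡1 (suc r) _ div = ∣1⇒≡1 (*-cancelʳ-∣ (suc r) (subst (_∣ 1 ℕ.* suc r) (ℕₚ.*-comm (suc r) d)
      (subst (suc r ℕ.* d ∣_) (sym (ℕₚ.*-identityˡ (suc r))) div)))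

  -- The order of y divides m′ j, and 3 is prime.
  order-3 : ∀ {y m m′} j → IsOrder Γ y m → IsOrder Γ (j ∙ y) m′ → 3 ∣ m → 3 ∤ j → 3 ∣ m′
  order-3 {y} {m} {m′} j ord (_ , m′jy , _) 3∣m 3∤j
    with euclidsLemma m′ j prime-3 (∣-trans 3∣m (order-∣ ord (m′ ℕ.* j) (trans (∙-* m′ j y) m′jy)))
  ... | inj₁ 3∣m′ = 3∣m′
  ... | inj₂ 3∣j  = ⊥-elim (3∤j 3∣j)

  order-coprime-∙ : ∀ {y m} j → IsOrder Γ y m → Coprime j m → IsOrder Γ (j ∙ y) m
  order-coprime-∙ {y} {m} j (m>0 , my , least) c =
    m>0 , kills-multiple m y my j ,
    λ k k>0 k<m e → least k k>0 k<m (trans (sym (proj₁ (proj₂ inv) (k ∙ y) (kills-multiple m y my k)))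
      (trans (cong (proj₁ inv ∙_) (trans (∙-comm j k y) e)) (∙-𝟘 (proj₁ inv))))
    where inv = inverse-acts j m m>0 c

mod3-cases : ∀ k → (k % 3 ≡ 0 ⊎ k % 3 ≡ 1) ⊎ k % 3 ≡ 2
mod3-cases k = cases (k % 3) (m%n<n k 3)
  where
  cases : ∀ r → r ℕ.< 3 → (r ≡ 0 ⊎ r ≡ 1) ⊎ r ≡ 2
  cases 0 _ = inj₁ (inj₁ refl)
  cases 1 _ = inj₁ (inj₂ refl)
  cases 2 _ = inj₂ refl
  cases (suc (suc (suc r))) (s≤s (s≤s (s≤s ())))

mod3-form : ∀ k {r} → k % 3 ≡ r → ∃ λ q → k ≡ r ℕ.+ q ℕ.* 3
mod3-form k refl = k / 3 , m≡m%n+[m/n]*n k 3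

mod3-* : ∀ a b {r s} → a % 3 ≡ r → b % 3 ≡ s → (a ℕ.* b) % 3 ≡ (r ℕ.* s) % 3
mod3-* a b refl refl = %-distribˡ-* a b 3

-- Units modulo 3 are their own inverses.
mod3-cancel : ∀ a b → (a ℕ.* b) % 3 ≡ 1 → a % 3 ≡ b % 3
mod3-cancel a b eq with mod3-cases a | mod3-cases b
... | inj₁ (inj₁ e) | inj₁ (inj₁ f) = trans e (sym f)
... | inj₁ (inj₂ e) | inj₁ (inj₂ f) = trans e (sym f)
... | inj₂ e        | inj₂ f        = trans e (sym f)
... | inj₁ (inj₁ e) | inj₁ (inj₂ f) with () ← trans (sym eq) (mod3-* a b e f)
... | inj₁ (inj₁ e) | inj₂ f        with () ← trans (sym eq) (mod3-* a b e f)
... | inj₁ (inj₂ e) | inj₁ (inj₁ f) with () ← trans (sym eq) (mod3-* a b e f)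
... | inj₁ (inj₂ e) | inj₂ f        with () ← trans (sym eq) (mod3-* a b e f)
... | inj₂ e        | inj₁ (inj₁ f) with () ← trans (sym eq) (mod3-* a b e f)
... | inj₂ e        | inj₁ (inj₂ f) with () ← trans (sym eq) (mod3-* a b e f)

3∣suc⇒mod3≡2 : ∀ m → 3 ∣ suc m → m % 3 ≡ 2
3∣suc⇒mod3≡2 m (divides (suc q) eq) = trans (cong (_% 3) (ℕₚ.suc-injective eq)) ([m+kn]%n≡m%n 2 q 3)

-- Decomposition of symmetric elements into the W(g)

-- The structure of ℤ[ω] on which elimination rests. `coordinates` is the arithmetic input: every
-- value is an integer combination of α and β, the values of W(g) and W(-g) at g.
record Eisenstein (K : CRing) : Set where
  open RingKit K
  field
    α β : Carrier
    αα : α * α ≡ - β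
    ββ : β * β ≡ - α
    αβ : α * β ≡ 1#
    conj : Carrier → Carrier
    conj-+ : ∀ x y → conj (x + y) ≡ conj x + conj y
    conj-scale : ∀ i x → conj (fromℤ i * x) ≡ fromℤ i * conj x
    conj-0 : conj 0# ≡ 0#
    conj-α : conj α ≡ β
    conj-β : conj β ≡ α
    coordinates : ∀ x → ∃ λ a → ∃ λ b → x ≡ fromℤ a * α + fromℤ b * β
    _≟_ : (x y : Carrier) → Dec (x ≡ y)

module Elimination (K : CRing) (Eis : Eisenstein K) (Γ : FinAbGroup) where
  open RingKit K
  open Eisenstein Eis
  open GroupKit Γ
  open Orders Γ
  open GroupAlgebra K Γ hiding (module A)
  private
    module A = RingKit ringA
    module SK = SplitElements K
    module SA = SplitElements ringA
    module C = Hom constant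

  ψ : ℕ → Carrier
  ψ = SK.ψ α β αα ββ αβ

  αA βA : Alg
  αA = C.⟦ α ⟧
  βA = C.⟦ β ⟧

  ααA : αA ⋆ αA ≡ ⊟ βA
  ααA = trans (sym (C.*-homo α α)) (trans (cong C.⟦_⟧ αα) (C.neg-homo β))

  ββA : βA ⋆ βA ≡ ⊟ αA
  ββA = trans (sym (C.*-homo β β)) (trans (cong C.⟦_⟧ ββ) (C.neg-homo α))

  αβA : αA ⋆ βA ≡ 1A
  αβA = trans (sym (C.*-homo α β)) (cong C.⟦_⟧ αβ)

  ψ-A : ∀ k → SA.ψ αA βA ααA ββA αβA k ≡ C.⟦ ψ k ⟧
  ψ-A 0                   = sym C.0-homo
  ψ-A 1                   = refl
  ψ-A 2                   = refl
  ψ-A (suc (suc (suc k))) = ψ-A k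

  ψ-mod : ∀ r q → ψ (r ℕ.+ q ℕ.* 3) ≡ ψ r
  ψ-mod = SK.ψ-3 α β αα ββ αβ

  -- Doubling exchanges the residues 1 and 2 modulo 3, just as conjugation exchanges α and β.
  ψ-double : ∀ i → ψ (2 ℕ.* i) ≡ conj (ψ i)
  ψ-double 0                   = sym conj-0
  ψ-double 1                   = sym conj-α
  ψ-double 2                   = sym conj-β
  ψ-double (suc (suc (suc i))) = trans (cong ψ (regroup i)) (ψ-double i)
    where
    regroup : ∀ i → 2 ℕ.* (3 ℕ.+ i) ≡ 6 ℕ.+ 2 ℕ.* i
    regroup = solve-∀

  ψ-*1 : ∀ k i → k % 3 ≡ 1 → ψ (k ℕ.* i) ≡ ψ i
  ψ-*1 k i eq with mod3-form k eq
  ... | q , refl = trans (cong ψ (regroup q i)) (ψ-mod i (q ℕ.* i))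
    where
    regroup : ∀ q i → (1 ℕ.+ q ℕ.* 3) ℕ.* i ≡ i ℕ.+ q ℕ.* i ℕ.* 3
    regroup = solve-∀

  ψ-*2 : ∀ k i → k % 3 ≡ 2 → ψ (k ℕ.* i) ≡ conj (ψ i)
  ψ-*2 k i eq with mod3-form k eq
  ... | q , refl = trans (cong ψ (regroup q i)) (trans (ψ-mod (2 ℕ.* i) (q ℕ.* i)) (ψ-double i))
    where
    regroup : ∀ q i → (2 ℕ.+ q ℕ.* 3) ℕ.* i ≡ 2 ℕ.* i ℕ.+ q ℕ.* i ℕ.* 3
    regroup = solve-∀

  ψ-3∣ : ∀ i → 3 ∣ i → ψ i ≡ 0#
  ψ-3∣ i (divides q refl) = ψ-mod 0 q

  -- W g m = Σ_{j<m} ψ(j) [j g]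
  W : G → ℕ → Alg
  W g = SA.twisted αA βA ααA ββA αβA (single 1# g)

  generator-^ : ∀ g k → single 1# g A.^ k ≡ single 1# (k ∙ g)
  generator-^ g k = trans (single-^ 1# g k) (cong (λ c → single c (k ∙ g)) (1^ k))

  W-suc : ∀ g k → W g (suc k) ≡ W g k ⊞ single (ψ k) (k ∙ g)
  W-suc g k = cong (W g k ⊞_) (trans (cong₂ _⋆_ (ψ-A k) (generator-^ g k))
    (trans (single-* (ψ k) 1# 𝟘 (k ∙ g)) (cong₂ single (*-identityʳ _) (⊕-identityˡ _))))

  W-suc-[] : ∀ g k z → W g (suc k) [ z ] ≡ W g k [ z ] + single (ψ k) (k ∙ g) [ z ]
  W-suc-[] g k z = trans (cong (_[ z ]) (W-suc g k)) (mk-[] _ z)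

  W-outside : ∀ g k z → (∀ i → z ≢ i ∙ g) → W g k [ z ] ≡ 0#
  W-outside g zero    z out = mk-[] _ z
  W-outside g (suc k) z out = trans (W-suc-[] g k z)
    (trans (cong₂ _+_ (W-outside g k z out) (single-≢ (ψ k) (out k))) (+-identityˡ _))

  W-above : ∀ {g m} → IsOrder Γ g m → ∀ k i → k ℕ.≤ i → i ℕ.< m → W g k [ i ∙ g ] ≡ 0#
  W-above {g} ord zero    i _   i<m = mk-[] _ (i ∙ g)
  W-above {g} ord (suc k) i k<i i<m = trans (W-suc-[] g k (i ∙ g))
    (trans (cong₂ _+_ (W-above ord k i (ℕₚ.<⇒≤ k<i) i<m)
             (single-≢ (ψ k) λ e → ℕₚ.<-irrefl (order-injective ord k i (ℕₚ.<⇒≤ k<i) i<m (sym e)) k<i))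
      (+-identityˡ _))

  W-below : ∀ {g m} → IsOrder Γ g m → ∀ k i → i ℕ.< k → k ℕ.≤ m → W g k [ i ∙ g ] ≡ ψ i
  W-below {g} ord (suc k) i (s≤s i≤k) k<m with ℕₚ.m≤n⇒m<n∨m≡n i≤k
  ... | inj₁ i<k  = trans (W-suc-[] g k (i ∙ g))
    (trans (cong₂ _+_ (W-below ord k i i<k (ℕₚ.<⇒≤ k<m))
             (single-≢ (ψ k) λ e → ℕₚ.<-irrefl (order-injective ord i k i≤k k<m e) i<k))
      (+-identityʳ _))
  ... | inj₂ refl = trans (W-suc-[] g k (k ∙ g))
    (trans (cong₂ _+_ (W-above ord k k ℕₚ.≤-refl k<m) (single-≡ (ψ k) (k ∙ g))) (+-identityˡ _))

  W-at : ∀ {g m} → IsOrder Γ g m → 3 ∣ m → ∀ i → W g m [ i ∙ g ] ≡ ψ i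
  W-at {g} ord (divides q refl) i with order-% ord i
  ... | r , r<m , e , p , refl = trans (cong (W g (q ℕ.* 3) [_]) e)
    (trans (W-below ord (q ℕ.* 3) r r<m ℕₚ.≤-refl)
      (sym (trans (cong (λ t → ψ (r ℕ.+ t)) (sym (ℕₚ.*-assoc p q 3))) (ψ-mod r (p ℕ.* q)))))

  split-W : ∀ {g m} → IsOrder Γ g m → 3 ∣ m → SA.Split (W g m)
  split-W {g} (_ , mg , _) (divides q refl) = SA.split-twisted αA βA ααA ββA αβA (single 1# g) q
    (trans (generator-^ g (q ℕ.* 3)) (cong (single 1#) mg))

  multiple? : ∀ {g m} → IsOrder Γ g m → ∀ z → (∃ λ i → z ≡ i ∙ g) ⊎ (∀ i → z ≢ i ∙ g)
  multiple? {g} {m} ord z with Finₚ.any? {m} (λ i → z Fin.≟ toℕ i ∙ g)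
  ... | yes (i , e) = inj₁ (toℕ i , e)
  ... | no none     = inj₂ λ i e → let r , r<m , e′ , _ = order-% ord i in
    none (Fin.fromℕ< r<m , trans e (trans e′ (cong (_∙ g) (sym (Finₚ.toℕ-fromℕ< r<m)))))

  -- These conditions are closed under integer combinations and hold for each W(g). In `invariant`
  -- the partner k′ expresses that k is invertible on the multiples of z without naming the order of
  -- z; both multipliers are 1 modulo 3, so the condition is symmetric.
  record Good (f : Alg) : Set where
    field
      invariant : ∀ z k k′ → k % 3 ≡ 1 → k′ % 3 ≡ 1 → k′ ∙ k ∙ z ≡ z → f [ k ∙ z ] ≡ f [ z ]
      hermitian : ∀ z → f [ ⊝ z ] ≡ conj (f [ z ])
      supported : ∀ z m → IsOrder Γ z m → 3 ∤ m → f [ z ] ≡ 0#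
  open Good

  good-W : ∀ {g m} → IsOrder Γ g m → 3 ∣ m → Good (W g m)
  good-W {g} {m@(suc m′)} ord@(_ , mg , _) 3∣m = record { invariant = inv ; hermitian = herm ; supported = supp }
    where
    inv : ∀ z k k′ → k % 3 ≡ 1 → k′ % 3 ≡ 1 → k′ ∙ k ∙ z ≡ z → W g m [ k ∙ z ] ≡ W g m [ z ]
    inv z k k′ k1 k′1 eq with multiple? ord z
    ... | inj₁ (i , refl) = trans (cong (W g m [_]) (sym (∙-* k i g)))
      (trans (W-at ord 3∣m (k ℕ.* i)) (trans (ψ-*1 k i k1) (sym (W-at ord 3∣m i))))
    ... | inj₂ out        = trans (W-outside g m (k ∙ z)
      (λ i e → out (k′ ℕ.* i) (trans (sym eq) (trans (cong (k′ ∙_) e) (sym (∙-* k′ i g))))))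
      (sym (W-outside g m z out))
    -- The multiplier -1 is represented by m′ = m - 1, which is 2 modulo 3, so passing to the
    -- inverse conjugates the value of `ψ`.
    inverse-multiple : ∀ i → ⊝ (i ∙ g) ≡ (m′ ℕ.* i) ∙ g
    inverse-multiple i = trans
      (sym (⊝-power m′ (i ∙ g) (kills-multiple m g mg i))) (sym (∙-* m′ i g))
    herm : ∀ z → W g m [ ⊝ z ] ≡ conj (W g m [ z ])
    herm z with multiple? ord z
    ... | inj₁ (i , refl) = trans (cong (W g m [_]) (inverse-multiple i))
      (trans (W-at ord 3∣m (m′ ℕ.* i)) (trans (ψ-*2 m′ i (3∣suc⇒mod3≡2 m′ 3∣m)) (cong conj (sym (W-at ord 3∣m i)))))
    ... | inj₂ out = trans (W-outside g m (⊝ z)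
      (λ i e → out (m′ ℕ.* i) (trans (sym (⊝-involutive z)) (trans (cong ⊝_ e) (inverse-multiple i)))))
      (trans (sym conj-0) (cong conj (sym (W-outside g m z out))))
    supp : ∀ z m′ → IsOrder Γ z m′ → 3 ∤ m′ → W g m [ z ] ≡ 0#
    supp z m′ ord′ 3∤m′ with multiple? ord z
    ... | inj₂ out = W-outside g m z out
    ... | inj₁ (i , refl) with 3 ∣? i
    ...   | yes 3∣i = trans (W-at ord 3∣m i) (ψ-3∣ i 3∣i)
    ...   | no 3∤i  = ⊥-elim (3∤m′ (order-3 i ord ord′ 3∣m 3∤i))

  addMultiple : Alg → ℤ → Alg → Alg
  addMultiple f c w = f ⊞ A.fromℤ c ⋆ w

  addMultiple-[] : ∀ f c w z → addMultiple f c w [ z ] ≡ f [ z ] + fromℤ c * w [ z ]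
  addMultiple-[] f c w z = trans (mk-[] _ z) (cong (f [ z ] +_) (fromℤ-⋆ c w z))

  good-addMultiple : ∀ {f w} c → Good f → Good w → Good (addMultiple f c w)
  good-addMultiple {f} {w} c F H = record
    { invariant = λ z k k′ k1 k′1 eq → trans (addMultiple-[] f c w (k ∙ z))
        (trans (cong₂ (λ p q → p + fromℤ c * q) (F .invariant z k k′ k1 k′1 eq) (H .invariant z k k′ k1 k′1 eq))
          (sym (addMultiple-[] f c w z)))
    ; hermitian = λ z → trans (addMultiple-[] f c w (⊝ z))
        (trans (cong₂ (λ p q → p + fromℤ c * q) (F .hermitian z) (H .hermitian z))
          (trans (cong (conj (f [ z ]) +_) (sym (conj-scale c (w [ z ]))))
            (trans (sym (conj-+ _ _)) (cong conj (sym (addMultiple-[] f c w z))))))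
    ; supported = λ z m ord 3∤m → trans (addMultiple-[] f c w z)
        (trans (cong₂ (λ p q → p + fromℤ c * q) (F .supported z m ord 3∤m) (H .supported z m ord 3∤m))
          (trans (+-identityˡ _) (zeroʳ _)))
    }

  -- Every generator of the cyclic group of g is reached from g: by `invariant` if j is 1 modulo 3,
  -- and through the inverse by `hermitian` if j is 2. One zero at g therefore clears all generators
  -- at once.
  good-conjugate : ∀ {f} → Good f → ∀ {g m} → IsOrder Γ g m → 3 ∣ m → f [ g ] ≡ 0# →
                   ∀ j → 3 ∤ j → IsOrder Γ (j ∙ g) m → f [ j ∙ g ] ≡ 0#
  good-conjugate {f} F {g} {suc m} ord@(m>0 , mg , _) 3∣m f0 j 3∤j ord′
    with inverse-acts j (suc m) m>0 (order-coprime j ord ord′) | mod3-cases j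
  ... | _                | inj₁ (inj₁ j0) = ⊥-elim (3∤j (m%n≡0⇒n∣m j 3 j0))
  ... | j′ , acts , mod3 | inj₁ (inj₂ j1) =
    trans (F .invariant g j j′ j1 (trans (mod3-cancel j′ j (mod3 3∣m)) j1) (acts g mg)) f0
  -- The order is `suc m`, so m j represents -j, and it is 1 modulo 3.
  ... | j′ , acts , mod3 | inj₂ j2 = trans (cong (f [_]) (sym (⊝-involutive _)))
    (trans (F .hermitian (⊝ (j ∙ g))) (trans (cong conj (trans (cong (f [_]) (sym k∙g))
      (trans (F .invariant g (m ℕ.* j) (m ℕ.* j′) k1 k′1 back) f0))) conj-0))
    where
    m2 : m % 3 ≡ 2
    m2 = 3∣suc⇒mod3≡2 m 3∣m
    k1 : (m ℕ.* j) % 3 ≡ 1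
    k1 = mod3-* m j m2 j2
    k′1 : (m ℕ.* j′) % 3 ≡ 1
    k′1 = mod3-* m j′ m2 (trans (mod3-cancel j′ j (mod3 3∣m)) j2)
    k∙g : (m ℕ.* j) ∙ g ≡ ⊝ (j ∙ g)
    k∙g = trans (∙-* m j g) (⊝-power m (j ∙ g) (kills-multiple (suc m) g mg j))
    back : (m ℕ.* j′) ∙ (m ℕ.* j) ∙ g ≡ g
    back = begin
      (m ℕ.* j′) ∙ (m ℕ.* j) ∙ g    ≡⟨ cong ((m ℕ.* j′) ∙_) k∙g ⟩
      (m ℕ.* j′) ∙ (⊝ (j ∙ g))      ≡⟨ ∙-⊝ (m ℕ.* j′) (j ∙ g) ⟩
      ⊝ ((m ℕ.* j′) ∙ j ∙ g)        ≡⟨ cong ⊝_ (trans (∙-* m j′ (j ∙ g)) (cong (m ∙_) (acts g mg))) ⟩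
      ⊝ (m ∙ g)                     ≡⟨ cong ⊝_ (⊝-power m g mg) ⟩
      ⊝ (⊝ g)                       ≡⟨ ⊝-involutive g ⟩
      g                             ∎
      where open ≡-Reasoning

  -- With f(g) = aα + bβ, the element f - a W(g) - b W(-g) vanishes at g and differs
  -- from f only inside ⟨g⟩.
  module Step {f : Alg} (F : Good f) {g : G} {m : ℕ} (ord : IsOrder Γ g (suc m)) (3∣m : 3 ∣ suc m) where
    a b : ℤ
    a = proj₁ (coordinates (f [ g ]))
    b = proj₁ (proj₂ (coordinates (f [ g ])))

    w w⁻ f′ : Alg
    w  = W g (suc m)
    w⁻ = W (⊝ g) (suc m)
    f′ = addMultiple (addMultiple f (ℤ.- a) w) (ℤ.- b) w⁻

    f′-good : Good f′
    f′-good = good-addMultiple (ℤ.- b) (good-addMultiple (ℤ.- a) F (good-W ord 3∣m)) (good-W (order-⊝ ord) 3∣m)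

    f′-[] : ∀ z → f′ [ z ] ≡ f [ z ] + fromℤ (ℤ.- a) * w [ z ] + fromℤ (ℤ.- b) * w⁻ [ z ]
    f′-[] z = trans (addMultiple-[] (addMultiple f (ℤ.- a) w) (ℤ.- b) w⁻ z) (cong (_+ fromℤ (ℤ.- b) * w⁻ [ z ]) (addMultiple-[] f (ℤ.- a) w z))

    f′-g : f′ [ g ] ≡ 0#
    f′-g = begin
      f′ [ g ]
        ≡⟨ f′-[] g ⟩
      f [ g ] + fromℤ (ℤ.- a) * w [ g ] + fromℤ (ℤ.- b) * w⁻ [ g ]
        ≡⟨ cong₂ (λ p q → f [ g ] + p + q) (cong₂ _*_ (fromℤ-neg a) w-g) (cong₂ _*_ (fromℤ-neg b) w⁻-g) ⟩
      f [ g ] + (- fromℤ a) * α + (- fromℤ b) * β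
        ≡⟨ cong (λ p → p + (- fromℤ a) * α + (- fromℤ b) * β) (proj₂ (proj₂ (coordinates (f [ g ])))) ⟩
      fromℤ a * α + fromℤ b * β + (- fromℤ a) * α + (- fromℤ b) * β
        ≡⟨ solve 4 (λ a b α β → a :* α :+ b :* β :+ (:- a) :* α :+ (:- b) :* β := :0) refl (fromℤ a) (fromℤ b) α β ⟩
      0# ∎
      where
      open ≡-Reasoning
      w-g : w [ g ] ≡ α
      w-g = trans (cong (w [_]) (sym (∙-1 g))) (W-at ord 3∣m 1)
      -- As a multiple of -g, the element g is m (-g) with m of residue 2 modulo 3.
      w⁻-g : w⁻ [ g ] ≡ β
      w⁻-g = trans (cong (w⁻ [_]) (trans (sym (⊝-involutive g)) (sym (⊝-power m (⊝ g) (proj₁ (proj₂ (order-⊝ ord)))))))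
        (trans (W-at (order-⊝ ord) 3∣m m) (trans (cong ψ (proj₂ (mod3-form m (3∣suc⇒mod3≡2 m 3∣m)))) (ψ-mod 2 (proj₁ (mod3-form m (3∣suc⇒mod3≡2 m 3∣m))))))

    ⊝-multiple : ∀ {z} i → z ≡ i ∙ (⊝ g) → z ≡ (m ℕ.* i) ∙ g
    ⊝-multiple i e = trans e (trans (∙-⊝ i g) (trans (sym (⊝-power m (i ∙ g)
      (kills-multiple (suc m) g (proj₁ (proj₂ ord)) i))) (sym (∙-* m i g))))

    f′-outside : ∀ z → (∀ i → z ≢ i ∙ g) → f′ [ z ] ≡ f [ z ]
    f′-outside z out = trans (f′-[] z) (trans
      (cong₂ (λ p q → f [ z ] + fromℤ (ℤ.- a) * p + fromℤ (ℤ.- b) * q) (W-outside g (suc m) z out)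
        (W-outside (⊝ g) (suc m) z λ i e → out (m ℕ.* i) (⊝-multiple i e)))
      (solve 3 (λ f a b → f :+ a :* :0 :+ b :* :0 := f) refl (f [ z ]) _ _))

    f′-3∣ : ∀ i → 3 ∣ i → f′ [ i ∙ g ] ≡ f [ i ∙ g ]
    f′-3∣ i 3∣i = trans (f′-[] (i ∙ g)) (trans
      (cong₂ (λ p q → f [ i ∙ g ] + fromℤ (ℤ.- a) * p + fromℤ (ℤ.- b) * q)
        (trans (W-at ord 3∣m i) (ψ-3∣ i 3∣i))
        (trans (cong (w⁻ [_]) i∙g) (trans (W-at (order-⊝ ord) 3∣m (m ℕ.* i)) (ψ-3∣ (m ℕ.* i) (∣n⇒∣m*n m 3∣i)))))
      (solve 3 (λ f a b → f :+ a :* :0 :+ b :* :0 := f) refl (f [ i ∙ g ]) _ _))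
      where
      i∙g : i ∙ g ≡ (m ℕ.* i) ∙ (⊝ g)
      i∙g = trans (sym (⊝-involutive _)) (trans (sym (trans (∙-⊝ (m ℕ.* i) g) (cong ⊝_ (trans (∙-* m i g)
        (⊝-power m (i ∙ g) (kills-multiple (suc m) g (proj₁ (proj₂ ord)) i)))))) refl)

    -- Elements of the current order that are already cleared stay cleared: outside the cyclic group
    -- of g nothing changes, at multiples i g with 3 dividing i both corrections vanish, and the
    -- other multiples of this order are generators.
    f′-zero : ∀ z → IsOrder Γ z (suc m) → f [ z ] ≡ 0# → f′ [ z ] ≡ 0#
    f′-zero z ord′ fz with multiple? ord z
    ... | inj₂ out = trans (f′-outside z out) fz
    ... | inj₁ (i , refl) with 3 ∣? i
    ...   | yes 3∣i = trans (f′-3∣ i 3∣i) fz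
    ...   | no 3∤i  = good-conjugate f′-good ord 3∣m f′-g i 3∤i ord′

    -- Multiples of g have order at most `suc m`, so elements of larger order are untouched.
    f′-above : ∀ z k → IsOrder Γ z k → suc m ℕ.< k → f [ z ] ≡ 0# → f′ [ z ] ≡ 0#
    f′-above z k (_ , _ , least) lt fz with multiple? ord z
    ... | inj₂ out        = trans (f′-outside z out) fz
    ... | inj₁ (i , refl) = ⊥-elim (least (suc m) (s≤s z≤n) lt
      (kills-multiple (suc m) g (proj₁ (proj₂ ord)) i))

    split-f : SA.Split f′ → SA.Split f
    split-f s = subst SA.Split restore (SA.split-+ s (SA.split-+ (SA.split-scale a (split-W ord 3∣m)) (SA.split-scale b (split-W (order-⊝ ord) 3∣m))))
      where
      restore : f′ ⊞ (A.fromℤ a ⋆ w ⊞ A.fromℤ b ⋆ w⁻) ≡ f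
      restore = trans (cong₂ (λ p q → (f ⊞ p ⋆ w ⊞ q ⋆ w⁻) ⊞ (A.fromℤ a ⋆ w ⊞ A.fromℤ b ⋆ w⁻)) (A.fromℤ-neg a) (A.fromℤ-neg b))
        (A.solve 5 (λ f a b w v → (f A.:+ (A.:- a) A.:* w A.:+ (A.:- b) A.:* v) A.:+ (a A.:* w A.:+ b A.:* v) A.:= f)
          refl f (A.fromℤ a) (A.fromℤ b) w w⁻)

  Above : ℕ → Alg → Set
  Above M f = ∀ z k → IsOrder Γ z k → M ℕ.< k → f [ z ] ≡ 0#

  Level : ℕ → List G → Alg → Set
  Level M todo f = ∀ z → IsOrder Γ z M → f [ z ] ≡ 0# ⊎ z ∈ todo

  -- The continuation `rec` stands for the recursive call, so that `eliminate` is visibly structural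
  -- in the level and the list.
  visit : ∀ M g todo → (∀ f → Good f → Above M f → Level M todo f → SA.Split f) →
          ∀ f → Good f → Above M f → Level M (g ∷ todo) f → SA.Split f
  visit M g todo rec f F above level = cases (order g) ((f [ g ]) ≟ 0#)
    where
    skip : (IsOrder Γ g M → f [ g ] ≡ 0#) → SA.Split f
    skip fg = rec f F above λ z ord → drop z ord (level z ord)
      where
      drop : ∀ z → IsOrder Γ z M → f [ z ] ≡ 0# ⊎ z ∈ (g ∷ todo) → f [ z ] ≡ 0# ⊎ z ∈ todo
      drop z ord (inj₁ e)           = inj₁ e
      drop z ord (inj₂ (here refl)) = inj₁ (fg ord)
      drop z ord (inj₂ (there z∈))  = inj₂ z∈
    reduce : ∀ m → suc m ≡ M → IsOrder Γ g (suc m) → 3 ∣ suc m → SA.Split f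
    reduce m refl ord 3∣m = S.split-f (rec S.f′ S.f′-good
      (λ z k ordz lt → S.f′-above z k ordz lt (above z k ordz lt)) λ z ordz → keep z ordz (level z ordz))
      where
      module S = Step F ord 3∣m
      keep : ∀ z → IsOrder Γ z (suc m) → f [ z ] ≡ 0# ⊎ z ∈ (g ∷ todo) → S.f′ [ z ] ≡ 0# ⊎ z ∈ todo
      keep z ordz (inj₁ e)           = inj₁ (S.f′-zero z ordz e)
      keep z ordz (inj₂ (here refl)) = inj₁ S.f′-g
      keep z ordz (inj₂ (there z∈))  = inj₂ z∈
    cases : (Σ ℕ λ k → IsOrder Γ g k × k ℕ.≤ n) → Dec (f [ g ] ≡ 0#) → SA.Split f
    cases _                 (yes e) = skip λ _ → e
    cases (suc m , ord , _) (no ne) with suc m ℕₚ.≟ M | 3 ∣? suc m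
    ... | no k≢M | _       = skip λ ord′ → ⊥-elim (k≢M (order-unique ord ord′))
    ... | yes _  | no 3∤m  = ⊥-elim (ne (F .supported g (suc m) ord 3∤m))
    ... | yes eq | yes 3∣m = reduce m eq ord 3∣m

  eliminate : ∀ M todo f → Good f → Above M f → Level M todo f → SA.Split f
  eliminate M       (g ∷ todo) = visit M g todo (eliminate M todo)
  eliminate zero    []         f F above level = subst SA.Split (sym f≡0) SA.split-0
    where
    f≡0 : f ≡ 0A
    f≡0 = ext λ z → let k , ord , _ = order z in trans (above z k ord (proj₁ ord)) (sym (mk-[] _ z))
  eliminate (suc M) []         f F above level = eliminate M (List.allFin n) f F above′ (λ z _ → inj₂ (∈-allFin z))
    where
    above′ : Above M f
    above′ z k ord lt with ℕₚ.m≤n⇒m<n∨m≡n lt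
    ... | inj₁ lt′  = above z k ord lt′
    ... | inj₂ refl with level z ord
    ...   | inj₁ e = e

  good-split : ∀ f → Good f → SA.Split f
  good-split f F = eliminate n (List.allFin n) f F
    (λ z k ord lt → let k′ , ord′ , le = order z in
      ⊥-elim (ℕₚ.<⇒≱ lt (subst (ℕ._≤ n) (order-unique ord′ ord) le)))
    (λ z _ → inj₂ (∈-allFin z))

-- Characteristic polynomials of convolution matrices

module ConvolutionCharPoly (K : CRing) (Γ : FinAbGroup) where
  open RingKit K
  open GroupKit Γ
  open GroupAlgebra K Γ hiding (module A; _⊞_)
  open Polynomial K
  open PolynomialMatrix K
  open Matrix K
  open RootProduct K
  open Eval (id-hom K)
  private
    module A = RingKit ringA
    module C = Hom constant
    module RA = RootProduct ringA
    module SA = SplitElements ringA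

  module _ (h : Alg) where

    -- The quotient (P(t) - P(h)) / (t - h) for the polynomial P with root list L.
    cofactor : Carrier → List ℤ → Alg
    cofactor t []      = A.0#
    cofactor t (l ∷ L) = C.⟦ t - fromℤ l ⟧ A.* cofactor t L A.+ RA.rootProduct h L

    cofactor-* : ∀ t L → (C.⟦ t ⟧ A.- h) A.* cofactor t L ≡ C.⟦ rootProduct t L ⟧ A.- RA.rootProduct h L
    cofactor-* t []      = trans (A.zeroʳ (C.⟦ t ⟧ A.- h)) (sym (trans (cong (A._- A.1#) C.1-homo) (A.-‿inverseʳ A.1#)))
    cofactor-* t (l ∷ L) = begin
      (τ A.- h) A.* (C.⟦ t - fromℤ l ⟧ A.* q A.+ r)
        ≡⟨ cong (λ c → (τ A.- h) A.* (c A.* q A.+ r)) lin ⟩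
      (τ A.- h) A.* ((τ A.- λ′) A.* q A.+ r)
        ≡⟨ A.solve 5 (λ t h l q r → (t A.:- h) A.:* ((t A.:- l) A.:* q A.:+ r)
                       A.:= (t A.:- l) A.:* ((t A.:- h) A.:* q) A.:+ (t A.:- h) A.:* r) refl τ h λ′ q r ⟩
      (τ A.- λ′) A.* ((τ A.- h) A.* q) A.+ (τ A.- h) A.* r
        ≡⟨ cong (λ s → (τ A.- λ′) A.* s A.+ (τ A.- h) A.* r) (cofactor-* t L) ⟩
      (τ A.- λ′) A.* (C.⟦ rootProduct t L ⟧ A.- r) A.+ (τ A.- h) A.* r
        ≡⟨ A.solve 5 (λ t h l p r → (t A.:- l) A.:* (p A.:- r) A.:+ (t A.:- h) A.:* r
                       A.:= (t A.:- l) A.:* p A.:- (h A.:- l) A.:* r) refl τ h λ′ C.⟦ rootProduct t L ⟧ r ⟩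
      (τ A.- λ′) A.* C.⟦ rootProduct t L ⟧ A.- (h A.- λ′) A.* r
        ≡⟨ cong (λ c → c A.* C.⟦ rootProduct t L ⟧ A.- (h A.- λ′) A.* r) lin ⟨
      C.⟦ t - fromℤ l ⟧ A.* C.⟦ rootProduct t L ⟧ A.- (h A.- λ′) A.* r
        ≡⟨ cong (A._- (h A.- λ′) A.* r) (C.*-homo _ _) ⟨
      C.⟦ rootProduct t (l ∷ L) ⟧ A.- RA.rootProduct h (l ∷ L) ∎
      where
      open ≡-Reasoning
      τ = C.⟦ t ⟧
      λ′ = A.fromℤ l
      q = cofactor t L
      r = RA.rootProduct h L
      lin : C.⟦ t - fromℤ l ⟧ ≡ τ A.- λ′
      lin = trans (C.+-homo _ _) (cong (τ A.+_) (trans (C.neg-homo _) (cong A.-_ (C.fromℤ-homo l))))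

    -- The coefficient of `cofactor` at z as a polynomial in t; the determinant of these entries is
    -- the complementary factor of the characteristic polynomial.
    cofactorPoly : List ℤ → G → Poly
    cofactorPoly []      z = []
    cofactorPoly (l ∷ L) z = (- fromℤ l ∷ 1# ∷ []) ⊠ cofactorPoly L z ⊞ (RA.rootProduct h L [ z ] ∷ [])

    ev-cofactorPoly : ∀ t L z → ev t (cofactorPoly L z) ≡ cofactor t L [ z ]
    ev-cofactorPoly t []      z = sym (mk-[] _ z)
    ev-cofactorPoly t (l ∷ L) z = begin
      ev t ((- fromℤ l ∷ 1# ∷ []) ⊠ cofactorPoly L z ⊞ (r ∷ []))
        ≡⟨ trans (ev-⊞ t ((- fromℤ l ∷ 1# ∷ []) ⊠ cofactorPoly L z) (r ∷ []))
             (cong (_+ (r + t * 0#)) (ev-⊠ t (- fromℤ l ∷ 1# ∷ []) (cofactorPoly L z))) ⟩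
      (- fromℤ l + t * (1# + t * 0#)) * ev t (cofactorPoly L z) + (r + t * 0#)
        ≡⟨ solve 4 (λ l t q r → (:- l :+ t :* (:1 :+ t :* :0)) :* q :+ (r :+ t :* :0)
                                := (t :- l) :* q :+ r) refl (fromℤ l) t (ev t (cofactorPoly L z)) r ⟩
      (t - fromℤ l) * ev t (cofactorPoly L z) + r
        ≡⟨ cong (λ q → (t - fromℤ l) * q + r) (ev-cofactorPoly t L z) ⟩
      (t - fromℤ l) * cofactor t L [ z ] + r
        ≡⟨ cong (_+ r) (constant-⋆ (t - fromℤ l) (cofactor t L) z) ⟨
      (C.⟦ t - fromℤ l ⟧ A.* cofactor t L) [ z ] + r
        ≡⟨ mk-[] _ z ⟨
      cofactor t (l ∷ L) [ z ] ∎
      where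
      open ≡-Reasoning
      r = RA.rootProduct h L [ z ]

    charPoly-convMatrix : ∀ t → ev t (charPoly (convMatrix h)) ≡ detM (convMatrix (C.⟦ t ⟧ A.- h))
    charPoly-convMatrix t = trans (ev-charPoly (id-hom K) t (convMatrix h)) (detM-cong λ u v →
      sym (trans (mk-[] _ (v − u)) (cong₂ _+_ (convMatrix-constant t u v) (mk-[] _ (v − u)))))

    rootProduct-^ : ∀ t L k → rootProduct t L ^ k ≡ rootProduct t (List.concat (List.replicate k L))
    rootProduct-^ t L zero    = refl
    rootProduct-^ t L (suc k) = trans (cong (rootProduct t L *_) (rootProduct-^ t L k))
      (sym (rootProduct-++ t L (List.concat (List.replicate k L))))

    -- With P(h) = 0 the element t - h times its cofactor is the constant P(t). Passing to
    -- convolution matrices and taking determinants gives P(t) to the power n on the right.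
    charPoly-divides : ∀ L → RA.rootProduct h L ≡ A.0# → ∀ t →
      ev t (charPoly (convMatrix h)) * ev t (detP λ u v → cofactorPoly L (v − u))
        ≡ rootProduct t (List.concat (List.replicate n L))
    charPoly-divides L eq t = begin
      ev t (charPoly (convMatrix h)) * ev t (detP λ u v → cofactorPoly L (v − u))
        ≡⟨ cong₂ _*_ (charPoly-convMatrix t) (trans (ev-detP (id-hom K) t {n} (λ u v → cofactorPoly L (v − u))) (detM-cong λ u v → ev-cofactorPoly t L (v − u))) ⟩
      detM (convMatrix (C.⟦ t ⟧ A.- h)) * detM (convMatrix (cofactor t L))
        ≡⟨ detM-* (convMatrix (C.⟦ t ⟧ A.- h)) (convMatrix (cofactor t L)) ⟨
      detM (λ u w → sum λ v → convMatrix (C.⟦ t ⟧ A.- h) u v * convMatrix (cofactor t L) v w)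
        ≡⟨ detM-cong (convMatrix-⋆ (C.⟦ t ⟧ A.- h) (cofactor t L)) ⟨
      detM (convMatrix ((C.⟦ t ⟧ A.- h) A.* cofactor t L))
        ≡⟨ cong (detM ∘ convMatrix) (trans (cofactor-* t L) (trans (cong (λ r → C.⟦ rootProduct t L ⟧ A.- r) eq)
             (trans (cong (C.⟦ rootProduct t L ⟧ A.+_) A.-0#≈0#) (A.+-identityʳ C.⟦ rootProduct t L ⟧)))) ⟩
      detM (convMatrix C.⟦ rootProduct t L ⟧)
        ≡⟨ detM-cong (convMatrix-constant (rootProduct t L)) ⟩
      detM {n} (λ u v → rootProduct t L * δM u v)
        ≡⟨ detM-scalar {n} (rootProduct t L) ⟩
      rootProduct t L ^ n
        ≡⟨ rootProduct-^ t L n ⟩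
      rootProduct t (List.concat (List.replicate n L)) ∎
      where open ≡-Reasoning

    split⇒charPoly-splits : ArithmeticDomain K → SA.Split h → Σ (Vec ℤ n) λ μs → ∀ t →
      ev (fromℤ t) (charPoly (convMatrix h)) ≡ rootProduct (fromℤ t) (Vec.toList μs)
    split⇒charPoly-splits D (L , eq) = Splitting.monic-splits D
      (List.concat (List.replicate n L)) n (charPoly (convMatrix h)) (detP λ u v → cofactorPoly L (v − u))
      (charPoly-monic (convMatrix h)) (λ t → charPoly-divides L eq (fromℤ t))

    -- Cayley–Hamilton: the matrix h I - H over the group algebra kills the vector of
    -- all group elements.
    charPoly-annihilates : Eval.ev constant h (charPoly (convMatrix h)) ≡ A.0#
    charPoly-annihilates = trans (ev-charPoly constant h (convMatrix h)) (vanish n refl)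
      where
      M : G → G → Alg
      M u v = h A.* C.⟦ δM u v ⟧ A.- C.⟦ convMatrix h u v ⟧
      kernel : ∀ u → A.sum (λ v → M u v A.* single 1# v) ≡ A.0#
      kernel u = ext λ z → begin
        A.sum (λ v → M u v A.* single 1# v) [ z ]
          ≡⟨ sum-[] (λ v → M u v A.* single 1# v) z ⟩
        sum (λ v → (M u v A.* single 1# v) [ z ])
          ≡⟨ sum-cong-≗ (λ v → entry v z) ⟩
        sum (λ v → h [ z − v ] * δM u v + - (convMatrix h u v * single 1# v [ z ]))
          ≡⟨ ∑-distrib-+ (λ v → h [ z − v ] * δM u v) (λ v → - (convMatrix h u v * single 1# v [ z ])) ⟩
        sum (λ v → h [ z − v ] * δM u v) + sum (λ v → - (convMatrix h u v * single 1# v [ z ]))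
          ≡⟨ cong₂ _+_
               (trans (sum-δ u _ λ v ne → trans (cong (h [ z − v ] *_) (δM-≢ (ne ∘ sym))) (zeroʳ _))
                      (trans (cong (h [ z − u ] *_) (δM-≡ u)) (*-identityʳ _)))
               (trans (sum-δ z _ λ v ne → trans (cong (λ s → - (convMatrix h u v * s)) (single-≢ 1# (ne ∘ sym)))
                                            (trans (cong -_ (zeroʳ _)) -0#≈0#))
                      (cong -_ (trans (cong (convMatrix h u z *_) (single-≡ 1# z)) (*-identityʳ _)))) ⟩
        h [ z − u ] + - h [ z − u ]
          ≡⟨ -‿inverseʳ _ ⟩
        0#
          ≡⟨ mk-[] _ z ⟨
        A.0# [ z ] ∎
        where
        open ≡-Reasoning
        δM-≡ : ∀ u → δM u u ≡ 1#
        δM-≡ u = δ′-≡ u 1#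
        δM-≢ : ∀ {u v : G} → u ≢ v → δM u v ≡ 0#
        δM-≢ ne = δ′-≢ 1# ne
        entry : ∀ v z → (M u v A.* single 1# v) [ z ] ≡ h [ z − v ] * δM u v + - (convMatrix h u v * single 1# v [ z ])
        entry v z = begin
          (M u v A.* single 1# v) [ z ]
            ≡⟨ cong (_[ z ]) (A.solve 4 (λ h d c s → (h A.:* d A.:- c) A.:* s A.:= s A.:* (d A.:* h) A.:+ A.:- (c A.:* s))
                 refl h C.⟦ δM u v ⟧ C.⟦ convMatrix h u v ⟧ (single 1# v)) ⟩
          (single 1# v A.* (C.⟦ δM u v ⟧ A.* h) A.+ A.- (C.⟦ convMatrix h u v ⟧ A.* single 1# v)) [ z ]
            ≡⟨ trans (mk-[] _ z) (cong₂ _+_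
                 (trans (single-⋆ 1# v (C.⟦ δM u v ⟧ A.* h) z) (trans (*-identityˡ _)
                   (trans (constant-⋆ (δM u v) h (z − v)) (*-comm _ _))))
                 (trans (mk-[] _ z) (cong -_ (constant-⋆ (convMatrix h u v) (single 1# v) z)))) ⟩
          h [ z − v ] * δM u v + - (convMatrix h u v * single 1# v [ z ]) ∎
      -- The kernel vector only yields a group element times the determinant; group elements are
      -- units, so the factor can be removed.
      invertible : ∀ v a → single 1# v A.* a ≡ A.0# → a ≡ A.0#
      invertible v a e = begin
        a                                              ≡⟨ A.*-identityˡ a ⟨
        1A A.* a                                       ≡⟨ cong (A._* a) (trans (single-* 1# 1# (⊝ v) v) (cong₂ single (*-identityʳ 1#) (⊕-inverseˡ v))) ⟨
        single 1# (⊝ v) A.* single 1# v A.* a          ≡⟨ A.*-assoc (single 1# (⊝ v)) (single 1# v) a ⟩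
        single 1# (⊝ v) A.* (single 1# v A.* a)        ≡⟨ cong (single 1# (⊝ v) A.*_) e ⟩
        single 1# (⊝ v) A.* A.0#                       ≡⟨ A.zeroʳ (single 1# (⊝ v)) ⟩
        A.0#                                           ∎
        where open ≡-Reasoning
      -- `detM-kernel` needs a size of the form `suc k`; size 0 is impossible because 𝟘 is an
      -- element.
      vanish : ∀ k → k ≡ n → Matrix.detM ringA M ≡ A.0#
      vanish zero    refl = ⊥-elim (no-elements 𝟘)
        where
        no-elements : ¬ Fin 0
        no-elements ()
      vanish (suc k) refl = invertible zero _ (Matrix.detM-kernel ringA M (single 1#) kernel)

ω₆-coordinates : ∀ x → ∃ λ a → ∃ λ b → x ≡ E.fromℤ a *ω ω₆ +ω E.fromℤ b *ω ω₆̄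
ω₆-coordinates (c + d ω) = c , c ℤ.- d , sym (trans (cong₂ (λ p q → p *ω ω₆ +ω q *ω ω₆̄) (fromℤ-ι c) (fromℤ-ι (c ℤ.- d)))
  (trans (cong₂ _+ω_ (ι-*ω c ℤ.1ℤ ℤ.1ℤ) (ι-*ω (c ℤ.- d) ℤ.0ℤ ℤ.-1ℤ)) (ω-ext
    (solve 2 (λ c d → c :* con ℤ.1ℤ :+ (c :- d) :* con ℤ.0ℤ := c) refl c d)
    (solve 2 (λ c d → c :* con ℤ.1ℤ :+ (c :- d) :* con ℤ.-1ℤ := d) refl c d))))
  where open +-*-Solver

conjω-ι : ∀ i → conjω (ι i) ≡ ι i
conjω-ι i = ω-ext (ℤₚ.+-identityʳ i) refl

ℤω-eisenstein : Eisenstein ℤω-ring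
ℤω-eisenstein = record
  { α = ω₆ ; β = ω₆̄ ; αα = refl ; ββ = refl ; αβ = refl
  ; conj = conjω ; conj-+ = conjω-+
  ; conj-scale = λ i x → trans (conjω-* (E.fromℤ i) x)
      (cong (_*ω conjω x) (trans (cong conjω (fromℤ-ι i)) (trans (conjω-ι i) (sym (fromℤ-ι i)))))
  ; conj-0 = refl ; conj-α = refl ; conj-β = refl
  ; coordinates = ω₆-coordinates ; _≟_ = _≟ω_ }

-- The adjacency matrix as a convolution, and integrality for sets in 𝔼

-- The case split of `HS` as a function of two Booleans, so that its symmetries and powers can be
-- found by cases.
hsEntry : Bool → Bool → ℤω
hsEntry true  true  = 1ω
hsEntry true  false = ω₆
hsEntry false true  = ω₆̄
hsEntry false false = 0ω

hsEntry-swap : ∀ a b → hsEntry b a ≡ conjω (hsEntry a b)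
hsEntry-swap true  true  = refl
hsEntry-swap true  false = refl
hsEntry-swap false true  = refl
hsEntry-swap false false = refl

mod3-reduce : ∀ {a r m} q → 3 ∣ m → a ≡ r ℕ.+ q ℕ.* m → r % 3 ≡ a % 3
mod3-reduce {a} {r} q (divides s refl) eq = begin
  r % 3                           ≡⟨ [m+kn]%n≡m%n r (q ℕ.* s) 3 ⟨
  (r ℕ.+ q ℕ.* s ℕ.* 3) % 3       ≡⟨ cong (λ t → (r ℕ.+ t) % 3) (ℕₚ.*-assoc q s 3) ⟩
  (r ℕ.+ q ℕ.* (s ℕ.* 3)) % 3     ≡⟨ cong (_% 3) eq ⟨
  a % 3                           ∎
  where open ≡-Reasoning

prodω-rootProduct : ∀ {m} t (μ : Fin m → ℤ) →
  prodω (λ u → ι (t ℤ.- μ u)) ≡ RootProduct.rootProduct ℤω-ring (E.fromℤ t) (Vec.toList (Vec.tabulate μ))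
prodω-rootProduct {zero}  t μ = refl
prodω-rootProduct {suc m} t μ = cong₂ _*ω_
  (trans (sym (fromℤ-ι (t ℤ.- μ zero))) (trans (E.fromℤ-+ t (ℤ.- μ zero)) (cong (E.fromℤ t +ω_) (E.fromℤ-neg (μ zero)))))
  (prodω-rootProduct t (μ ∘ suc))

module CayleyGraph (Γ : FinAbGroup) (S : Subset (FinAbGroup.n Γ)) where
  open GroupKit Γ
  open Orders Γ
  open GroupAlgebra ℤω-ring Γ
  open ConvolutionCharPoly ℤω-ring Γ
  open PolynomialMatrix ℤω-ring
  open Polynomial.Eval ℤω-ring (id-hom ℤω-ring)
  open RootProduct ℤω-ring

  connection : Alg
  connection = mk λ z → hsEntry (mem Γ S z) (mem Γ S (⊝ z))

  connection-[] : ∀ z → connection [ z ] ≡ hsEntry (mem Γ S z) (mem Γ S (⊝ z))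
  connection-[] = mk-[] _

  connection-hermitian : ∀ z → connection [ ⊝ z ] ≡ conjω (connection [ z ])
  connection-hermitian z = trans (connection-[] (⊝ z)) (trans (cong (hsEntry (mem Γ S (⊝ z)) ∘ mem Γ S) (⊝-involutive z))
    (trans (hsEntry-swap (mem Γ S z) (mem Γ S (⊝ z))) (cong conjω (sym (connection-[] z)))))

  HS-hsEntry : ∀ u v → HS Γ S u v ≡ hsEntry (mem Γ S (v − u)) (mem Γ S (u − v))
  HS-hsEntry u v with mem Γ S (v − u) | mem Γ S (u − v)
  ... | true  | true  = refl
  ... | true  | false = refl
  ... | false | true  = refl
  ... | false | false = refl

  HS-convMatrix : ∀ u v → HS Γ S u v ≡ convMatrix connection u v
  HS-convMatrix u v = trans (HS-hsEntry u v)
    (sym (trans (connection-[] (v − u)) (cong (hsEntry (mem Γ S (v − u)) ∘ mem Γ S) (⊝-− v u))))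

  charPolyAt-ev : ∀ t → charPolyAt Γ (HS Γ S) t ≡ ev (E.fromℤ t) (charPoly (convMatrix connection))
  charPolyAt-ev t = begin
    det (λ u v → (ι t *ω δ Γ u v) -ω HS Γ S u v)
      ≡⟨ det-det′ (λ u v → (ι t *ω δ Γ u v) -ω HS Γ S u v) ⟩
    Matrix.detM ℤω-ring (λ u v → (ι t *ω δ Γ u v) -ω HS Γ S u v)
      ≡⟨ Matrix.detM-cong ℤω-ring (λ u v → cong₂ (λ p q → (p *ω δ Γ u v) -ω q) (sym (fromℤ-ι t)) (HS-convMatrix u v)) ⟩
    Matrix.detM ℤω-ring (λ u v → (E.fromℤ t *ω δ Γ u v) -ω convMatrix connection u v)
      ≡⟨ ev-charPoly (id-hom ℤω-ring) (E.fromℤ t) (convMatrix connection) ⟨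
    ev (E.fromℤ t) (charPoly (convMatrix connection)) ∎
    where open ≡-Reasoning

  split⇒integral : SplitElements.Split ringA connection → HSIntegral Γ S
  split⇒integral s = Vec.lookup μs , λ t → trans (charPolyAt-ev t) (trans (proj₂ result t)
      (sym (trans (prodω-rootProduct t (Vec.lookup μs))
        (cong (rootProduct (E.fromℤ t) ∘ Vec.toList) (Vecₚ.tabulate∘lookup μs)))))
    where
    result = split⇒charPoly-splits connection ℤω-arithmetic s
    μs = proj₁ result

  ∈⇒mem : ∀ {z} → z ∈ₛ S → mem Γ S z ≡ true
  ∈⇒mem = Vecₚ.[]=⇒lookup

  mem⇒∈ : ∀ {z} → mem Γ S z ≡ true → z ∈ₛ S
  mem⇒∈ = Vecₚ.lookup⇒[]= _ S

  ∉⇒mem : ∀ {z} → z ∉ S → mem Γ S z ≡ false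
  ∉⇒mem {z} z∉ with mem Γ S z in eq
  ... | true  = ⊥-elim (z∉ (mem⇒∈ eq))
  ... | false = refl

  mem-cong : ∀ {y z} → (y ∈ₛ S → z ∈ₛ S) → (z ∈ₛ S → y ∈ₛ S) → mem Γ S y ≡ mem Γ S z
  mem-cong {y} {z} to from with mem Γ S y in eq
  ... | true  = sym (∈⇒mem (to (mem⇒∈ eq)))
  ... | false = sym (∉⇒mem λ z∈ → case-false (trans (sym (∈⇒mem (from z∈))) eq))
    where
    case-false : ¬ (true ≡ false)
    case-false ()

  module FromClasses (xs : List G) (in-Γ3 : All (InΓ3 Γ) xs)
                     (classes : ∀ y → (y ∈ₛ S) ⇔ Any (λ x → In⟪_⟫ Γ x y) xs) where
    open Elimination ℤω-ring ℤω-eisenstein Γ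

    -- `InΓ3` and `In⟪_⟫` each bring their own order of x; uniqueness of orders carries divisibility
    -- by 3 from the first to the second.
    with-order : ∀ {P : G → Set} {y} → (∀ x m → IsOrder Γ x m → 3 ∣ m → ∀ k → Coprime k m → k % 3 ≡ 1 → y ≡ k ∙ x → P x) →
                 Any (λ x → In⟪_⟫ Γ x y) xs → Any P xs
    with-order {P} {y} f = go in-Γ3
      where
      go : ∀ {xs} → All (InΓ3 Γ) xs → Any (λ x → In⟪_⟫ Γ x y) xs → Any P xs
      go ((m , ord , 3∣m) ∷ _) (here (m′ , ord′ , k , _ , _ , c , k1 , e)) =
        here (f _ m′ ord′ (subst (3 ∣_) (order-unique ord ord′) 3∣m) k (gcd≡1⇒coprime c) k1 e)
      go (_ ∷ ps) (there a) = there (go ps a)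

    -- If z = j x, then `k ∙ z` is r x with r the residue of k j modulo the order m. As 3 divides m,
    -- r is still 1 modulo 3; as k′ undoes k, `k ∙ z` has the same order as x, which makes r prime
    -- to m.
    closed : ∀ z k k′ → k % 3 ≡ 1 → k′ ∙ k ∙ z ≡ z → z ∈ₛ S → k ∙ z ∈ₛ S
    closed z k k′ k1 back z∈ = Equivalence.from (classes (k ∙ z)) (with-order member (Equivalence.to (classes z) z∈))
      where
      member : ∀ x m → IsOrder Γ x m → 3 ∣ m → ∀ j → Coprime j m → j % 3 ≡ 1 → z ≡ j ∙ x → In⟪_⟫ Γ x (k ∙ z)
      member x m ord@(m>0 , mx , _) 3∣m j c j1 refl with order-% ord (k ℕ.* j)
      ... | r , r<m , e , q , kj≡ = m , ord , r , r≥1 r r1 , r<m ,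
          coprime⇒gcd≡1 (order-coprime r ord (subst (λ y → IsOrder Γ y m) kz≡ kz-order)) , r1 , kz≡
        where
        r1 : r % 3 ≡ 1
        r1 = trans (mod3-reduce q 3∣m kj≡) (mod3-* k j k1 j1)
        r≥1 : ∀ r → r % 3 ≡ 1 → 1 ℕ.≤ r
        r≥1 (suc r) _ = s≤s z≤n
        kz≡ : k ∙ j ∙ x ≡ r ∙ x
        kz≡ = trans (sym (∙-* k j x)) e
        z-order : IsOrder Γ (j ∙ x) m
        z-order = order-coprime-∙ j ord c
        kz-order : IsOrder Γ (k ∙ j ∙ x) m
        kz-order = m>0 , kills-multiple m (j ∙ x) (proj₁ (proj₂ z-order)) k ,
          λ i i>0 i<m i0 → proj₂ (proj₂ z-order) i i>0 i<m
            (trans (cong (i ∙_) (sym back)) (trans (∙-comm i k′ (k ∙ j ∙ x)) (trans (cong (k′ ∙_) i0) (∙-𝟘 k′))))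

    order∤3⇒∉ : ∀ z m → IsOrder Γ z m → 3 ∤ m → z ∉ S
    order∤3⇒∉ z m ord 3∤m z∈ = empty (with-order {P = λ _ → ⊥} absurd (Equivalence.to (classes z) z∈))
      where
      absurd : ∀ x m′ → IsOrder Γ x m′ → 3 ∣ m′ → ∀ k → Coprime k m′ → k % 3 ≡ 1 → z ≡ k ∙ x → ⊥
      absurd x m′ ord′ 3∣m′ k c _ refl = 3∤m (subst (3 ∣_) (order-unique (order-coprime-∙ k ord′ c) ord) 3∣m′)
      empty : ∀ {xs : List G} → ¬ Any (λ _ → ⊥) xs
      empty (there a) = empty a

    good-connection : Good connection
    good-connection = record
      { invariant = λ z k k′ k1 k′1 back → trans (connection-[] (k ∙ z)) (trans
          (cong₂ hsEntry (sym (same z k k′ k1 k′1 back))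
            (trans (cong (mem Γ S) (sym (∙-⊝ k z)))
              (sym (same (⊝ z) k k′ k1 k′1 (trans (cong (k′ ∙_) (∙-⊝ k z)) (trans (∙-⊝ k′ (k ∙ z)) (cong ⊝_ back)))))))
          (sym (connection-[] z)))
      ; hermitian = connection-hermitian
      ; supported = λ z m ord 3∤m → trans (connection-[] z)
          (cong₂ hsEntry (∉⇒mem (order∤3⇒∉ z m ord 3∤m)) (∉⇒mem (order∤3⇒∉ (⊝ z) m (order-⊝ ord) 3∤m)))
      }
      where
      same : ∀ z k k′ → k % 3 ≡ 1 → k′ % 3 ≡ 1 → k′ ∙ k ∙ z ≡ z → mem Γ S z ≡ mem Γ S (k ∙ z)
      same z k k′ k1 k′1 back = mem-cong (closed z k k′ k1 back)
        (λ kz∈ → subst (_∈ₛ S) back (closed (k ∙ z) k′ k k′1 (cong (k ∙_) back) kz∈))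

  𝔼⇒integral : In𝔼 Γ S → HSIntegral Γ S
  𝔼⇒integral (_ , xs , in-Γ3 , classes) =
    split⇒integral (Elimination.good-split ℤω-ring ℤω-eisenstein Γ connection (FromClasses.good-connection xs in-Γ3 classes))

-- Frobenius

absorption : ∀ n k → suc k ℕ.* (suc n C suc k) ≡ suc n ℕ.* (n C k)
absorption n zero = trans (ℕₚ.*-identityˡ _) (trans (nC1≡n (suc n)) (sym (ℕₚ.*-identityʳ (suc n))))
absorption zero (suc k) = ℕₚ.*-zeroʳ (suc (suc k))
absorption (suc n) (suc k) = begin
  suc (suc k) ℕ.* (suc (suc n) C suc (suc k))
    ≡⟨ cong (suc (suc k) ℕ.*_) (nCk+nC[k+1]≡[n+1]C[k+1] (suc n) (suc k)) ⟨
  suc (suc k) ℕ.* (a ℕ.+ (suc n C suc (suc k)))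
    ≡⟨ regroup (suc k) a (suc n C suc (suc k)) ⟩
  a ℕ.+ suc k ℕ.* a ℕ.+ suc (suc k) ℕ.* (suc n C suc (suc k))
    ≡⟨ cong₂ (λ p q → a ℕ.+ p ℕ.+ q) (absorption n k) (absorption n (suc k)) ⟩
  a ℕ.+ suc n ℕ.* (n C k) ℕ.+ suc n ℕ.* (n C suc k)
    ≡⟨ regroup′ a (suc n) (n C k) (n C suc k) ⟩
  a ℕ.+ suc n ℕ.* ((n C k) ℕ.+ (n C suc k))
    ≡⟨ cong (λ c → a ℕ.+ suc n ℕ.* c) (nCk+nC[k+1]≡[n+1]C[k+1] n k) ⟩
  suc (suc n) ℕ.* (suc n C suc k) ∎
  where
  open ≡-Reasoning
  a = suc n C suc k
  regroup : ∀ k a b → suc k ℕ.* (a ℕ.+ b) ≡ a ℕ.+ k ℕ.* a ℕ.+ suc k ℕ.* b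
  regroup = solve-∀
  regroup′ : ∀ a n b c → a ℕ.+ n ℕ.* b ℕ.+ n ℕ.* c ≡ a ℕ.+ n ℕ.* (b ℕ.+ c)
  regroup′ = solve-∀

-- By `absorption` p divides k times the binomial coefficient, and p cannot divide k.
prime∣binomial : ∀ {p} → Prime p → ∀ k → 0 ℕ.< k → k ℕ.< p → p ∣ p C k
prime∣binomial {suc p} pr (suc k) _ k<p
  with euclidsLemma (suc k) (suc p C suc k) pr (divides (p C k) (trans (absorption p k) (ℕₚ.*-comm (suc p) (p C k))))
... | inj₁ p∣k = ⊥-elim (ℕₚ.<⇒≱ k<p (∣⇒≤ p∣k))
... | inj₂ p∣C = p∣C

module Congruence (R : CRing) (p : ℕ) where
  open RingKit R
  open RootProduct R

  infix 4 _≈_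
  record _≈_ (x y : Carrier) : Set where
    constructor _by_
    field
      quotient : Carrier
      equation : x ≡ y + fromℕ p * quotient

  ≡⇒≈ : ∀ {x y} → x ≡ y → x ≈ y
  ≡⇒≈ {x} refl = 0# by solve 2 (λ x p → x := x :+ p :* :0) refl x (fromℕ p)

  ≈-trans : ∀ {x y z} → x ≈ y → y ≈ z → x ≈ z
  ≈-trans {z = z} (r by refl) (s by refl) = (s + r) by
    solve 4 (λ z p r s → z :+ p :* s :+ p :* r := z :+ p :* (s :+ r)) refl z (fromℕ p) r s

  ≈-sym : ∀ {x y} → x ≈ y → y ≈ x
  ≈-sym {y = y} (r by refl) = (- r) by
    solve 3 (λ y p r → y := y :+ p :* r :+ p :* (:- r)) refl y (fromℕ p) r

  ≈-+ : ∀ {x y z w} → x ≈ y → z ≈ w → x + z ≈ y + w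
  ≈-+ {y = y} {w = w} (r by refl) (s by refl) = (r + s) by
    solve 5 (λ y w p r s → y :+ p :* r :+ (w :+ p :* s) := y :+ w :+ p :* (r :+ s)) refl y w (fromℕ p) r s

  ≈-* : ∀ {x y z w} → x ≈ y → z ≈ w → x * z ≈ y * w
  ≈-* {y = y} {w = w} (r by refl) (s by refl) = (r * w + y * s + r * (fromℕ p * s)) by
    solve 5 (λ y w p r s → (y :+ p :* r) :* (w :+ p :* s) := y :* w :+ p :* (r :* w :+ y :* s :+ r :* (p :* s)))
      refl y w (fromℕ p) r s

  ≈-neg : ∀ {x y} → x ≈ y → - x ≈ - y
  ≈-neg {y = y} (r by refl) = (- r) by solve 3 (λ y p r → :- (y :+ p :* r) := :- y :+ p :* (:- r)) refl y (fromℕ p) r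

  ≈-^ : ∀ {x y} k → x ≈ y → x ^ k ≈ y ^ k
  ≈-^ zero    e = ≡⇒≈ refl
  ≈-^ (suc k) e = ≈-* e (≈-^ k e)

  ≈-sum : ∀ {m} {F H : Fin m → Carrier} → (∀ i → F i ≈ H i) → sum F ≈ sum H
  ≈-sum {zero}  e = ≡⇒≈ refl
  ≈-sum {suc m} e = ≈-+ (e zero) (≈-sum (e ∘ suc))

  private
    module U = Algebra.Properties.Semiring.Mult semiring
    module M = Algebra.Properties.Semiring.Mult.TCOptimised semiring

  ×-fromℕ : ∀ k x → k U.× x ≡ fromℕ k * x
  ×-fromℕ k x = trans (cong (k U.×_) (sym (*-identityˡ x)))
    (trans (sym (U.×-assoc-* k 1# x)) (cong (_* x) (M.×ᵤ≈× k 1#)))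

  ×-multiple : ∀ k x → p ∣ k → k U.× x ≈ 0#
  ×-multiple k x (divides q refl) = (fromℕ q * x) by (begin
    (q ℕ.* p) U.× x           ≡⟨ ×-fromℕ (q ℕ.* p) x ⟩
    fromℕ (q ℕ.* p) * x       ≡⟨ cong (_* x) (fromℕ-* q p) ⟩
    fromℕ q * fromℕ p * x     ≡⟨ solve 3 (λ q p x → q :* p :* x := :0 :+ p :* (q :* x)) refl (fromℕ q) (fromℕ p) x ⟩
    0# + fromℕ p * (fromℕ q * x) ∎)
    where open ≡-Reasoning

-- Writing the prime as `suc q` lets `x ^ p` reduce to `x * x ^ q`, the form that is factored in
-- `^p-minus`.
module Frobenius (R : CRing) (q : ℕ) (pr : Prime (suc q)) where
  open RingKit R
  open RootProduct R
  open Congruence R (suc q)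

  private
    p : ℕ
    p = suc q
    module B = Algebra.Properties.CommutativeSemiring.Binomial commutativeSemiring

  ^p-+ : ∀ x y → (x + y) ^ p ≈ x ^ p + y ^ p
  ^p-+ x y = ≈-trans (≡⇒≈ (trans (B.theorem p x y) (cong (term zero +_) (sum-init-last (term ∘ suc)))))
    (≈-trans (≈-+ (≡⇒≈ first) (≈-+ middle (≡⇒≈ final)))
      (≡⇒≈ (solve 2 (λ a b → b :+ (:0 :+ a) := a :+ b) refl (x ^ p) (y ^ p))))
    where
    term : Fin (suc p) → Carrier
    term = B.binomialTerm x y p
    first : term zero ≡ y ^ p
    first = trans (+-identityʳ _) (*-identityˡ _)
    final : term (suc (Fin.fromℕ q)) ≡ x ^ p
    final = begin
      (p C toℕ (Fin.fromℕ p)) U.× (x ^ toℕ (Fin.fromℕ p) * y ^ (p ℕ.∸ toℕ (Fin.fromℕ p)))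
        ≡⟨ cong (λ k → (p C k) U.× (x ^ k * y ^ (p ℕ.∸ k))) (Finₚ.toℕ-fromℕ p) ⟩
      (p C p) U.× (x ^ p * y ^ (p ℕ.∸ p))
        ≡⟨ cong₂ (λ c k → c U.× (x ^ p * y ^ k)) (nCn≡1 p) (ℕₚ.n∸n≡0 p) ⟩
      1 U.× (x ^ p * 1#)
        ≡⟨ trans (+-identityʳ _) (*-identityʳ _) ⟩
      x ^ p ∎
      where
      open ≡-Reasoning
      module U = Algebra.Properties.Semiring.Mult semiring
    middle : sum (λ j → term (suc (Fin.inject₁ j))) ≈ 0#
    middle = ≈-trans (≈-sum {H = λ _ → 0#} λ j → ×-multiple _ _ (prime∣binomial pr _ (s≤s z≤n)
        (s≤s (subst (ℕ._< q) (sym (Finₚ.toℕ-inject₁ j)) (Finₚ.toℕ<n j)))))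
      (≡⇒≈ (sum-replicate-zero q))

  0^p : 0# ^ p ≡ 0#
  0^p = zeroˡ _

  ^p-sum : ∀ {m} (F : Fin m → Carrier) → sum F ^ p ≈ sum (λ i → F i ^ p)
  ^p-sum {zero}  F = ≡⇒≈ 0^p
  ^p-sum {suc m} F = ≈-trans (^p-+ (F zero) (sum (F ∘ suc))) (≈-+ (≡⇒≈ refl) (^p-sum (F ∘ suc)))

  ^p-fromℕ : ∀ k → fromℕ k ^ p ≈ fromℕ k
  ^p-fromℕ zero    = ≡⇒≈ 0^p
  ^p-fromℕ (suc k) = ≈-trans (≡⇒≈ (cong (_^ p) (fromℕ-+ 1 k)))
    (≈-trans (^p-+ 1# (fromℕ k)) (≈-trans (≈-+ (≡⇒≈ (1^ p)) (^p-fromℕ k)) (≡⇒≈ (sym (fromℕ-+ 1 k)))))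

  -- Additivity of the Frobenius map at x and - x, so that p = 2 needs no separate treatment.
  ^p-neg : ∀ x → (- x) ^ p ≈ - (x ^ p)
  ^p-neg x = ≈-trans (≡⇒≈ (solve 2 (λ a b → b := (a :+ b) :- a) refl (x ^ p) ((- x) ^ p)))
    (≈-trans (≈-+ (≈-trans (≈-sym (^p-+ x (- x))) (≡⇒≈ (trans (cong (_^ p) (-‿inverseʳ x)) 0^p))) (≡⇒≈ refl))
      (≡⇒≈ (+-identityˡ _)))

  ^p-fromℤ : ∀ i → fromℤ i ^ p ≈ fromℤ i
  ^p-fromℤ (pos n)    = ^p-fromℕ n
  ^p-fromℤ (-[1+ n ]) = ≈-trans (^p-neg (fromℕ (suc n))) (≈-neg (^p-fromℕ (suc n)))

  ^p-minus : ∀ x i → ∃ λ u → x ^ p - x ≈ (x - fromℤ i) * u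
  ^p-minus x i = y ^ q - 1# , ≈-trans (≈-+ (≈-trans (≡⇒≈ (cong (_^ p) x≡)) (≈-trans (^p-+ y (fromℤ i)) (≈-+ (≡⇒≈ refl) (^p-fromℤ i)))) (≡⇒≈ refl))
      (≡⇒≈ (solve 3 (λ x i z → (x :- i) :* z :+ i :- x := (x :- i) :* (z :- :1)) refl x (fromℤ i) (y ^ q)))
    where
    y = x - fromℤ i
    x≡ : x ≡ y + fromℤ i
    x≡ = solve 2 (λ x i → x := x :- i :+ i) refl x (fromℤ i)

  ^p-minus-power : ∀ x L → ∃ λ u → (x ^ p - x) ^ length L ≈ rootProduct x L * u
  ^p-minus-power x []      = 1# , ≡⇒≈ (sym (*-identityˡ _))
  ^p-minus-power x (l ∷ L) =
    let u , e = ^p-minus x l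
        v , f = ^p-minus-power x L
    in u * v , ≈-trans (≈-* e f)
      (≡⇒≈ (solve 4 (λ a u r v → (a :* u) :* (r :* v) := (a :* r) :* (u :* v)) refl (x - fromℤ l) u (rootProduct x L) v))

  ^p-minus-nilpotent : ∀ x L → rootProduct x L ≡ 0# → (x ^ p - x) ^ length L ≈ 0#
  ^p-minus-nilpotent x L eq = let u , e = ^p-minus-power x L in
    ≈-trans e (≡⇒≈ (trans (cong (_* u) eq) (zeroˡ u)))

  nilpotent-difference : ∀ x y L → rootProduct x L ≡ 0# → x ^ p ≈ y → ∀ k → length L ℕ.≤ k → (y - x) ^ k ≈ 0#
  nilpotent-difference x y L eq e k le = ≈-trans (≡⇒≈ (trans
      (cong ((y - x) ^_) (sym (ℕₚ.m+[n∸m]≡n le))) (^-homo-* (y - x) (length L) (k ℕ.∸ length L))))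
    (≈-trans (≈-* (≈-trans (≈-^ (length L) (≈-+ (≈-sym e) (≡⇒≈ refl))) (^p-minus-nilpotent x L eq)) (≡⇒≈ refl))
      (≡⇒≈ (zeroˡ _)))

-- Galois invariance

conjω-sum : ∀ {m} (F : Fin m → ℤω) → conjω (E.sum F) ≡ E.sum (conjω ∘ F)
conjω-sum {zero}  F = refl
conjω-sum {suc m} F = trans (conjω-+ (F zero) (E.sum (F ∘ suc))) (cong (conjω (F zero) +ω_) (conjω-sum (F ∘ suc)))

nonneg-sum-zero : ∀ {i j} → ℤ.0ℤ ℤ.≤ i → ℤ.0ℤ ℤ.≤ j → i ℤ.+ j ≡ ℤ.0ℤ → i ≡ ℤ.0ℤ × j ≡ ℤ.0ℤ
nonneg-sum-zero {pos zero} {pos zero} _ _ _ = refl , refl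

-- Positive definiteness of the Hermitian form: a sum of nonnegative norms vanishes only if every
-- term does.
norm-sum : ∀ {m} (x : Fin m → ℤω) → ∃ λ s → ℤ.0ℤ ℤ.≤ s × E.sum (λ i → x i *ω conjω (x i)) ≡ ι s
                                       × (s ≡ ℤ.0ℤ → ∀ i → x i ≡ 0ω)
norm-sum {zero}  x = ℤ.0ℤ , ℤ.+≤+ z≤n , refl , λ _ ()
norm-sum {suc m} x =
  let s , s≥0 , eq , zeros = norm-sum (x ∘ suc)
      c = norm (x zero)
  in c ℤ.+ s , ℤₚ.+-mono-≤ (norm-nonneg (x zero)) s≥0 , cong₂ _+ω_ (*-conjω (x zero)) eq ,
     λ e → λ { zero    → norm-zero (x zero) (proj₁ (nonneg-sum-zero (norm-nonneg (x zero)) s≥0 e))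
             ; (suc i) → zeros (proj₂ (nonneg-sum-zero (norm-nonneg (x zero)) s≥0 e)) i }

module SelfAdjointElements (Γ : FinAbGroup) where
  open GroupKit Γ
  open GroupAlgebra ℤω-ring Γ

  SelfAdjoint : Alg → Set
  SelfAdjoint a = ∀ z → a [ ⊝ z ] ≡ conjω (a [ z ])

  selfAdjoint-− : ∀ {a b} → SelfAdjoint a → SelfAdjoint b → SelfAdjoint (a A.- b)
  selfAdjoint-− {a} {b} sa sb z = begin
    (a A.- b) [ ⊝ z ]                       ≡⟨ trans (mk-[] _ (⊝ z)) (cong (a [ ⊝ z ] +ω_) (mk-[] _ (⊝ z))) ⟩
    a [ ⊝ z ] +ω (-ω (b [ ⊝ z ]))             ≡⟨ cong₂ (λ p q → p +ω (-ω q)) (sa z) (sb z) ⟩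
    conjω (a [ z ]) +ω (-ω conjω (b [ z ])) ≡⟨ cong (conjω (a [ z ]) +ω_) (conjω-neg (b [ z ])) ⟨
    conjω (a [ z ]) +ω conjω (-ω (b [ z ]))   ≡⟨ conjω-+ (a [ z ]) (-ω (b [ z ])) ⟨
    conjω (a [ z ] +ω (-ω (b [ z ])))         ≡⟨ cong conjω (trans (mk-[] _ z) (cong (a [ z ] +ω_) (mk-[] _ z))) ⟨
    conjω ((a A.- b) [ z ])                 ∎
    where open ≡-Reasoning

  inversion : Permutation n n
  inversion = permutation ⊝_ ⊝_ ⊝-involutive ⊝-involutive

  selfAdjoint-⋆ : ∀ {a b} → SelfAdjoint a → SelfAdjoint b → SelfAdjoint (a ⋆ b)
  selfAdjoint-⋆ {a} {b} sa sb z = begin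
    (a ⋆ b) [ ⊝ z ]
      ≡⟨ mk-[] _ (⊝ z) ⟩
    E.sum (λ x → a [ x ] *ω b [ (⊝ z) − x ])
      ≡⟨ E.sum-permute (λ x → a [ x ] *ω b [ (⊝ z) − x ]) inversion ⟩
    E.sum (λ x → a [ ⊝ x ] *ω b [ (⊝ z) − (⊝ x) ])
      ≡⟨ E.sum-cong-≗ (λ x → trans (cong₂ _*ω_ (sa x) (trans (cong (b [_]) (⊝-⊕ z (⊝ x))) (sb (z − x))))
                                   (sym (conjω-* (a [ x ]) (b [ z − x ])))) ⟩
    E.sum (λ x → conjω (a [ x ] *ω b [ z − x ]))
      ≡⟨ conjω-sum (λ x → a [ x ] *ω b [ z − x ]) ⟨
    conjω (E.sum (λ x → a [ x ] *ω b [ z − x ]))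
      ≡⟨ cong conjω (mk-[] _ z) ⟨
    conjω ((a ⋆ b) [ z ]) ∎
    where open ≡-Reasoning

  -- Self-adjointness turns the coefficient of `a ⋆ a` at 𝟘, a sum of products a(x) a(-x), into the
  -- sum of the norms of the a(x).
  selfAdjoint-reduced : ∀ a → SelfAdjoint a → a ⋆ a ≡ 0A → a ≡ 0A
  selfAdjoint-reduced a sa eq = ext λ z → trans (zeros s≡0 z) (sym (mk-[] _ z))
    where
    open ≡-Reasoning
    s = proj₁ (norm-sum (a [_]))
    zeros = proj₂ (proj₂ (proj₂ (norm-sum (a [_]))))
    s≡0 : s ≡ ℤ.0ℤ
    s≡0 = ι-injective (begin
      ι s                                            ≡⟨ proj₁ (proj₂ (proj₂ (norm-sum (a [_])))) ⟨
      E.sum (λ x → a [ x ] *ω conjω (a [ x ]))       ≡⟨ E.sum-cong-≗ (λ x → cong (a [ x ] *ω_) (trans (cong (a [_]) (⊕-identityˡ (⊝ x))) (sa x))) ⟨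
      E.sum (λ x → a [ x ] *ω a [ 𝟘 − x ])           ≡⟨ mk-[] _ 𝟘 ⟨
      (a ⋆ a) [ 𝟘 ]                                  ≡⟨ cong (_[ 𝟘 ]) eq ⟩
      0A [ 𝟘 ]                                       ≡⟨ mk-[] _ 𝟘 ⟩
      0ω                                             ∎)

  squared : ℕ → Alg → Alg
  squared zero    a = a
  squared (suc k) a = squared k (a ⋆ a)

  squared-^ : ∀ k a → squared k a ≡ a A.^ (2 ℕ.^ k)
  squared-^ zero    a = sym (A.*-identityʳ a)
  squared-^ (suc k) a = trans (squared-^ k (a ⋆ a)) (trans
    (cong (λ b → (a ⋆ b) A.^ (2 ℕ.^ k)) (sym (A.*-identityʳ a))) (A.^-assocʳ a 2 (2 ℕ.^ k)))

  -- Squares of self-adjoint elements are self-adjoint, so the squarings can be undone one at a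
  -- time.
  selfAdjoint-nilpotent : ∀ k a → SelfAdjoint a → squared k a ≡ 0A → a ≡ 0A
  selfAdjoint-nilpotent zero    a sa eq = eq
  selfAdjoint-nilpotent (suc k) a sa eq =
    selfAdjoint-reduced a sa (selfAdjoint-nilpotent k (a ⋆ a) (selfAdjoint-⋆ {a} {a} sa sa) eq)

  size : ∀ {m} → Vec ℤω m → ℕ
  size []      = 0
  size (x ∷ a) = (ℤ.∣ re x ∣ ℕ.+ ℤ.∣ om x ∣) ℕ.+ size a

  size-lookup : ∀ {m} (a : Vec ℤω m) z → ℤ.∣ re (Vec.lookup a z) ∣ ℕ.+ ℤ.∣ om (Vec.lookup a z) ∣ ℕ.≤ size a
  size-lookup (x ∷ a) zero    = ℕₚ.m≤m+n _ _
  size-lookup (x ∷ a) (suc z) = ℕₚ.≤-trans (size-lookup a z) (ℕₚ.m≤n+m _ _)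

  small-≈0 : ∀ p a → Congruence._≈_ ringA p a 0A → size a ℕ.< p → a ≡ 0A
  small-≈0 p a (r Congruence.by eq) lt = ext λ z → trans
    (ω-small-multiple p (a [ z ]) (r [ z ])
      (trans (cong (_[ z ]) (trans eq (⊞-identityˡ (A.fromℕ p ⋆ r)))) (fromℤ-⋆ (pos p) r z))
      (ℕₚ.≤-<-trans (size-lookup a z) lt))
    (sym (mk-[] _ z))

-- Residues modulo 6 and numbers without small prime factors

mod6-cases : ∀ r → r ℕ.< 6 → (r ≡ 1 ⊎ r ≡ 5) ⊎ (2 ∣ r ⊎ 3 ∣ r)
mod6-cases 0 _ = inj₂ (inj₁ (divides 0 refl))
mod6-cases 1 _ = inj₁ (inj₁ refl)
mod6-cases 2 _ = inj₂ (inj₁ (divides 1 refl))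
mod6-cases 3 _ = inj₂ (inj₂ (divides 1 refl))
mod6-cases 4 _ = inj₂ (inj₁ (divides 2 refl))
mod6-cases 5 _ = inj₁ (inj₂ refl)
mod6-cases (suc (suc (suc (suc (suc (suc r)))))) (s≤s (s≤s (s≤s (s≤s (s≤s (s≤s ()))))))

no-divisor : ∀ {p} → Prime p → ∀ d → d ≢ 1 → d ℕ.< p → d ∣ 6 → ¬ d ∣ p % 6
no-divisor {p} pr d d≢1 d<p d∣6 d∣r with prime⇒irreducible pr
  (subst (d ∣_) (sym (m≡m%n+[m/n]*n p 6)) (∣m∣n⇒∣m+n d∣r (∣n⇒∣m*n (p / 6) d∣6)))
... | inj₁ e = d≢1 e
... | inj₂ e = ℕₚ.<-irrefl e d<p

prime-mod6 : ∀ {p} → Prime p → 3 ℕ.< p → p % 6 ≡ 1 ⊎ p % 6 ≡ 5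
prime-mod6 {p} pr p>3 with mod6-cases (p % 6) (m%n<n p 6)
... | inj₁ unit       = unit
... | inj₂ (inj₁ 2∣r) = ⊥-elim (no-divisor pr 2 (λ ()) (ℕₚ.<⇒≤ p>3) (divides 3 refl) 2∣r)
... | inj₂ (inj₂ 3∣r) = ⊥-elim (no-divisor pr 3 (λ ()) p>3 (divides 2 refl) 3∣r)

-- The Galois action of a unit k modulo 6 on ℤ[ω]. Residues other than 1 default to conjugation; for
-- primes above 3 that residue is 5.
σ : ℕ → ℤω → ℤω
σ k x = if does (k % 6 ℕₚ.≟ 1) then x else conjω x

σ-1 : ∀ k x → k % 6 ≡ 1 → σ k x ≡ x
σ-1 k x eq rewrite eq = refl

σ-5 : ∀ k x → k % 6 ≡ 5 → σ k x ≡ conjω x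
σ-5 k x eq rewrite eq = refl

σ-conjω : ∀ k x → σ k (conjω x) ≡ conjω (σ k x)
σ-conjω k x = at (does (k % 6 ℕₚ.≟ 1))
  where
  at : ∀ b → (if b then conjω x else conjω (conjω x)) ≡ conjω (if b then x else conjω x)
  at true  = refl
  at false = refl

σ-cong : ∀ k k′ x → k % 6 ≡ k′ % 6 → σ k x ≡ σ k′ x
σ-cong k k′ x eq = cong (λ r → if does (r ℕₚ.≟ 1) then x else conjω x) eq

^-mod6 : ∀ x k {r} → x E.^ 6 ≡ 1ω → k % 6 ≡ r → x E.^ k ≡ x E.^ r
^-mod6 x k {r} eq refl = begin
  x E.^ k                                ≡⟨ cong (x E.^_) (m≡m%n+[m/n]*n k 6) ⟩
  x E.^ (r ℕ.+ k / 6 ℕ.* 6)              ≡⟨ E.^-homo-* x r (k / 6 ℕ.* 6) ⟩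
  x E.^ r *ω x E.^ (k / 6 ℕ.* 6)         ≡⟨ cong (λ j → x E.^ r *ω x E.^ j) (ℕₚ.*-comm (k / 6) 6) ⟩
  x E.^ r *ω x E.^ (6 ℕ.* (k / 6))       ≡⟨ cong (x E.^ r *ω_) (E.^-assocʳ x 6 (k / 6)) ⟨
  x E.^ r *ω (x E.^ 6) E.^ (k / 6)       ≡⟨ cong (λ y → x E.^ r *ω y E.^ (k / 6)) eq ⟩
  x E.^ r *ω 1ω E.^ (k / 6)              ≡⟨ cong (x E.^ r *ω_) (E.1^ (k / 6)) ⟩
  x E.^ r *ω 1ω                          ≡⟨ E.*-identityʳ (x E.^ r) ⟩
  x E.^ r                                ∎
  where open ≡-Reasoning

-- Nonzero entries are sixth roots of unity, so powers depend on k modulo 6, and the fifth power is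
-- the conjugate. For the entry 0 the residue guarantees a positive exponent.
hsEntry-^ : ∀ a b k → k % 6 ≡ 1 ⊎ k % 6 ≡ 5 → hsEntry a b E.^ k ≡ σ k (hsEntry a b)
hsEntry-^ a b k (inj₁ e) = trans (power a b k e) (sym (σ-1 k (hsEntry a b) e))
  where
  power : ∀ a b k → k % 6 ≡ 1 → hsEntry a b E.^ k ≡ hsEntry a b
  power true  true  k e = ^-mod6 1ω k refl e
  power true  false k e = ^-mod6 ω₆ k refl e
  power false true  k e = ^-mod6 ω₆̄ k refl e
  power false false (suc k) e = E.zeroˡ (0ω E.^ k)
hsEntry-^ a b k (inj₂ e) = trans (power a b k e) (sym (σ-5 k (hsEntry a b) e))
  where
  power : ∀ a b k → k % 6 ≡ 5 → hsEntry a b E.^ k ≡ conjω (hsEntry a b)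
  power true  true  k e = ^-mod6 1ω k refl e
  power true  false k e = ^-mod6 ω₆ k refl e
  power false true  k e = ^-mod6 ω₆̄ k refl e
  power false false (suc k) e = E.zeroˡ (0ω E.^ k)

coprime-* : ∀ {a b k} → Coprime a k → Coprime b k → Coprime (a ℕ.* b) k
coprime-* {a} {b} {k} ca cb {d} (d∣ab , d∣k) = cb (coprime-divisor d-a d∣ab , d∣k)
  where
  d-a : Coprime d a
  d-a (e∣d , e∣a) = ca (e∣a , ∣-trans e∣d d∣k)

-- The product of all positive j ≤ B that are prime to k.
coprime-multiple : ∀ k B → ∃ λ t → Coprime t k × (∀ j → 0 ℕ.< j → j ℕ.≤ B → Coprime j k → j ∣ t)
coprime-multiple k zero    = 1 , Coprimality.1-coprimeTo k , λ { (suc j) _ () _ }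
coprime-multiple k (suc B) with coprime-multiple k B | coprime? (suc B) k
... | t , c , div | yes cB = suc B ℕ.* t , coprime-* cB c , divides-all
  where
  divides-all : ∀ j → 0 ℕ.< j → j ℕ.≤ suc B → Coprime j k → j ∣ suc B ℕ.* t
  divides-all j j>0 j≤ cj with ℕₚ.m≤n⇒m<n∨m≡n j≤
  ... | inj₁ (s≤s j≤B) = ∣n⇒∣m*n (suc B) (div j j>0 j≤B cj)
  ... | inj₂ refl      = m∣m*n t
... | t , c , div | no ¬cB = t , c , divides-all
  where
  divides-all : ∀ j → 0 ℕ.< j → j ℕ.≤ suc B → Coprime j k → j ∣ t
  divides-all j j>0 j≤ cj with ℕₚ.m≤n⇒m<n∨m≡n j≤
  ... | inj₁ (s≤s j≤B) = div j j>0 j≤B cj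
  ... | inj₂ refl      = ⊥-elim (¬cB cj)

prime>1 : ∀ {p} → Prime p → p ≢ 1
prime>1 pr refl = ¬prime[1] pr

prime-coprime : ∀ {p} k → Prime p → ¬ p ∣ k → Coprime p k
prime-coprime k pr p∤k (d∣p , d∣k) with prime⇒irreducible pr d∣p
... | inj₁ e    = e
... | inj₂ refl = ⊥-elim (p∤k d∣k)

-- Take t prime to k and divisible by every prime q ≤ B that does not divide k. Such a q divides t M
-- but not k; a q dividing k divides neither t nor M. In both cases q does not divide k + t M.
rough-representative : ∀ k M B → Coprime k M → ∃ λ t → ∀ q → Prime q → q ∣ k ℕ.+ t ℕ.* M → B ℕ.< q
rough-representative k M B c with coprime-multiple k B
... | t , ct , div = t , large
  where
  large : ∀ q → Prime q → q ∣ k ℕ.+ t ℕ.* M → B ℕ.< q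
  large q pr q∣ with ℕₚ.<-≤-connex B q | q ∣? k
  ... | inj₁ B<q | _       = B<q
  ... | inj₂ q≤B | no q∤k  = ⊥-elim (q∤k (∣m+n∣m⇒∣n (subst (q ∣_) (ℕₚ.+-comm k (t ℕ.* M)) q∣)
      (∣m⇒∣m*n M (div q (ℕ.>-nonZero⁻¹ q {{prime⇒nonZero pr}}) q≤B (prime-coprime k pr q∤k)))))
  ... | inj₂ q≤B | yes q∣k with euclidsLemma t M pr (∣m+n∣m⇒∣n q∣ q∣k)
  ...   | inj₁ q∣t = ⊥-elim (prime>1 pr (ct (q∣t , q∣k)))
  ...   | inj₂ q∣M = ⊥-elim (prime>1 pr (c (q∣k , q∣M)))

common-multiple : ∀ M → ∃ λ e → 0 ℕ.< e × (∀ m → 0 ℕ.< m → m ℕ.≤ M → m ∣ e)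
common-multiple zero    = 1 , s≤s z≤n , λ { (suc m) _ () }
common-multiple (suc M) with common-multiple M
... | e , e>0 , div = suc M ℕ.* e , ℕₚ.*-mono-< {0} {suc M} {0} {e} (s≤s z≤n) e>0 , divides-all
  where
  divides-all : ∀ m → 0 ℕ.< m → m ℕ.≤ suc M → m ∣ suc M ℕ.* e
  divides-all m m>0 m≤ with ℕₚ.m≤n⇒m<n∨m≡n m≤
  ... | inj₁ (s≤s m≤M) = ∣n⇒∣m*n (suc M) (div m m>0 m≤M)
  ... | inj₂ refl      = m∣m*n e

n≤2^n : ∀ n → n ℕ.≤ 2 ℕ.^ n
n≤2^n zero    = z≤n
n≤2^n (suc n) = ℕₚ.≤-trans (ℕₚ.+-mono-≤ (ℕₚ.m^n>0 2 n) (n≤2^n n))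
  (ℕₚ.≤-reflexive (cong (2 ℕ.^ n ℕ.+_) (sym (ℕₚ.+-identityʳ (2 ℕ.^ n)))))

total : (ℕ → ℕ) → ℕ → ℕ
total s zero    = 0
total s (suc k) = total s k ℕ.+ s k

total-≥ : ∀ s N k → k ℕ.< N → s k ℕ.≤ total s N
total-≥ s (suc N) k (s≤s k≤N) with ℕₚ.m≤n⇒m<n∨m≡n k≤N
... | inj₁ k<N  = ℕₚ.≤-trans (total-≥ s N k k<N) (ℕₚ.m≤m+n _ _)
... | inj₂ refl = ℕₚ.m≤n+m _ _

%6⇒%3 : ∀ k {r} → k % 6 ≡ r → k % 3 ≡ r % 3
%6⇒%3 k refl = sym (m∣n⇒o%n%m≡o%m 3 6 k (divides 2 refl))

module GaloisInvariance (Γ : FinAbGroup) (S : Subset (FinAbGroup.n Γ))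
  (L : List ℤ)
  (annihilated : RootProduct.rootProduct (GroupAlgebra.ringA ℤω-ring Γ) (CayleyGraph.connection Γ S) L
                 ≡ GroupAlgebra.0A ℤω-ring Γ)
  where
  open GroupKit Γ
  open Orders Γ
  open GroupAlgebra ℤω-ring Γ
  open CayleyGraph Γ S
  open SelfAdjointElements Γ

  f : Alg
  f = connection

  -- The element h⁽ᵏ⁾ with `σ k` in place of the k-th power; the two agree for k of residue 1 or 5
  -- modulo 6, and this form is visibly periodic in k.
  conjugate : ℕ → Alg
  conjugate k = A.sum λ g → single (σ k (f [ g ])) (k ∙ g)

  conjugate-Frobenius : ∀ p → Prime p → p % 6 ≡ 1 ⊎ p % 6 ≡ 5 → Congruence._≈_ ringA p (f A.^ p) (conjugate p)
  conjugate-Frobenius (suc q) pr u = ≈-trans (≡⇒≈ (cong (A._^ suc q) (sym (sum-single f))))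
    (≈-trans (^p-sum (λ g → single (f [ g ]) g)) (≡⇒≈ (A.sum-cong-≗ λ g →
      trans (single-^ (f [ g ]) g (suc q)) (cong (λ c → single c (suc q ∙ g)) (entry g)))))
    where
    open Congruence ringA (suc q)
    open Frobenius ringA q pr
    entry : ∀ g → (f [ g ]) E.^ suc q ≡ σ (suc q) (f [ g ])
    entry g = trans (cong (E._^ suc q) (connection-[] g))
      (trans (hsEntry-^ (mem Γ S g) (mem Γ S (⊝ g)) (suc q) u) (cong (σ (suc q)) (sym (connection-[] g))))

  e : ℕ
  e = proj₁ (common-multiple n)

  -- The conjugates depend on k modulo N only, so finitely many elements of the
  -- group algebra bound the primes that have to be avoided.
  N : ℕ
  N = e ℕ.* 6

  N>0 : 0 ℕ.< N
  N>0 = ℕₚ.*-mono-< {0} {e} {0} {6} (proj₁ (proj₂ (common-multiple n))) (s≤s z≤n)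

  instance
    N≢0 : ℕ.NonZero N
    N≢0 = ℕ.>-nonZero N>0

  N-kills : ∀ z → N ∙ z ≡ 𝟘
  N-kills z with order z
  ... | m , (m>0 , mz , _) , m≤n with proj₂ (proj₂ (common-multiple n)) m m>0 m≤n
  ...   | divides q eq = trans (cong (_∙ z) (trans (ℕₚ.*-comm e 6) (trans (cong (6 ℕ.*_) eq) (sym (ℕₚ.*-assoc 6 q m)))))
            (*-kills (6 ℕ.* q) m z mz)

  conjugate-periodic : ∀ k → conjugate k ≡ conjugate (k % N)
  conjugate-periodic k = A.sum-cong-≗ λ g → cong₂ single
    (σ-cong k (k % N) (f [ g ]) (sym (m∣n⇒o%n%m≡o%m 6 N k (n∣m*n e))))
    (trans (cong (_∙ g) (m≡m%n+[m/n]*n k N)) (∙-mod (k % N) (k / N) N g (N-kills g)))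

  defect : ℕ → Alg
  defect k = conjugate k A.- f

  -- Primes above B exceed N, hence are prime to it; they exceed 3, hence are 1 or 5 modulo 6; and
  -- they exceed the size of the relevant power of every defect with index below N.
  B : ℕ
  B = N ℕ.+ (3 ℕ.+ total (size ∘ squared (length L) ∘ defect) N)

  conjugate-[] : ∀ k k′ → (∀ z → k′ ∙ k ∙ z ≡ z) → ∀ z → conjugate k [ z ] ≡ σ k (f [ k′ ∙ z ])
  conjugate-[] k k′ inv z = trans (sum-[] (λ g → single (σ k (f [ g ])) (k ∙ g)) z)
    (trans (sum-δ (k′ ∙ z) (λ g → single (σ k (f [ g ])) (k ∙ g) [ z ])
             λ g ne → single-≢ (σ k (f [ g ])) λ e → ne (trans (sym (inv g)) (cong (k′ ∙_) (sym e))))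
      (trans (cong (single (σ k (f [ k′ ∙ z ])) (k ∙ k′ ∙ z) [_]) (trans (sym (inv z)) (∙-comm k′ k z)))
        (single-≡ (σ k (f [ k′ ∙ z ])) (k ∙ k′ ∙ z))))

  module _ (p : ℕ) (pr : Prime p) (B<p : B ℕ.< p) where
    p-mod6 : p % 6 ≡ 1 ⊎ p % 6 ≡ 5
    p-mod6 = prime-mod6 pr (ℕₚ.≤-<-trans (ℕₚ.≤-trans (ℕₚ.m≤m+n 3 _) (ℕₚ.m≤n+m _ N)) B<p)

    private
      inverse = inverse-acts p N N>0 (prime⇒coprime pr (ℕₚ.≤-<-trans (ℕₚ.m≤m+n N _) B<p))
      p′ = proj₁ inverse
      inv : ∀ z → p′ ∙ p ∙ z ≡ z
      inv z = proj₁ (proj₂ inverse) z (N-kills z)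

    conjugate-selfAdjoint : SelfAdjoint (conjugate p)
    conjugate-selfAdjoint z = begin
      conjugate p [ ⊝ z ]              ≡⟨ conjugate-[] p p′ inv (⊝ z) ⟩
      σ p (f [ p′ ∙ (⊝ z) ])           ≡⟨ cong (λ y → σ p (f [ y ])) (∙-⊝ p′ z) ⟩
      σ p (f [ ⊝ (p′ ∙ z) ])           ≡⟨ cong (σ p) (connection-hermitian (p′ ∙ z)) ⟩
      σ p (conjω (f [ p′ ∙ z ]))       ≡⟨ σ-conjω p (f [ p′ ∙ z ]) ⟩
      conjω (σ p (f [ p′ ∙ z ]))       ≡⟨ cong conjω (conjugate-[] p p′ inv z) ⟨
      conjω (conjugate p [ z ])        ∎
      where open ≡-Reasoning

    defect-nilpotent : Congruence._≈_ ringA p (squared (length L) (defect p)) 0A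
    defect-nilpotent = go p pr p-mod6
      where
      go : ∀ p → Prime p → p % 6 ≡ 1 ⊎ p % 6 ≡ 5 → Congruence._≈_ ringA p (squared (length L) (defect p)) 0A
      go (suc q) pr u = subst (λ a → Congruence._≈_ ringA (suc q) a 0A) (sym (squared-^ (length L) (defect (suc q))))
        (Frobenius.nilpotent-difference ringA q pr f (conjugate (suc q)) L annihilated
          (conjugate-Frobenius (suc q) pr u) (2 ℕ.^ length L) (n≤2^n (length L)))

    conjugate-fixed : conjugate p ≡ f
    conjugate-fixed = begin
      conjugate p                 ≡⟨ A.solve 2 (λ c f → c A.:= (c A.:- f) A.:+ f) refl (conjugate p) f ⟩
      defect p ⊞ f                ≡⟨ cong (_⊞ f) (selfAdjoint-nilpotent (length L) (defect p)
                                       (selfAdjoint-− {conjugate p} {f} conjugate-selfAdjoint connection-hermitian)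
                                       (small-≈0 p (squared (length L) (defect p)) defect-nilpotent small)) ⟩
      0A ⊞ f                      ≡⟨ ⊞-identityˡ f ⟩
      f                           ∎
      where
      open ≡-Reasoning
      s : ℕ → ℕ
      s = size ∘ squared (length L) ∘ defect
      small : s p ℕ.< p
      -- By periodicity the defect at p is the defect at p modulo N, whose size was counted in B
      -- before p was chosen.
      small = ℕₚ.≤-<-trans (subst (ℕ._≤ total s N)
          (cong (λ c → size (squared (length L) (c A.- f))) (sym (conjugate-periodic p)))
          (total-≥ s N (p % N) (m%n<n p N)))
        (ℕₚ.≤-<-trans (ℕₚ.≤-trans (ℕₚ.m≤n+m _ 3) (ℕₚ.m≤n+m _ N)) B<p)

    prime-invariant : ∀ z → f [ p ∙ z ] ≡ σ p (f [ z ])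
    prime-invariant z = trans (cong (_[ p ∙ z ]) (sym conjugate-fixed))
      (trans (conjugate-[] p p′ inv (p ∙ z)) (cong (λ y → σ p (f [ y ])) (inv z)))

  Invariant : ℕ → Set
  Invariant k = (k % 6 ≡ 1 × (∀ z → f [ k ∙ z ] ≡ f [ z ])) ⊎ (k % 6 ≡ 5 × (∀ z → f [ k ∙ z ] ≡ conjω (f [ z ])))

  invariant-prime : ∀ p → Prime p → B ℕ.< p → Invariant p
  invariant-prime p pr B<p with p-mod6 p pr B<p
  ... | inj₁ p1 = inj₁ (p1 , λ z → trans (prime-invariant p pr B<p z) (σ-1 p (f [ z ]) p1))
  ... | inj₂ p5 = inj₂ (p5 , λ z → trans (prime-invariant p pr B<p z) (σ-5 p (f [ z ]) p5))

  mod6-* : ∀ a b {r s} → a % 6 ≡ r → b % 6 ≡ s → (a ℕ.* b) % 6 ≡ (r ℕ.* s) % 6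
  mod6-* a b refl refl = %-distribˡ-* a b 6

  invariant-* : ∀ a b → Invariant a → Invariant b → Invariant (a ℕ.* b)
  invariant-* a b (inj₁ (a1 , f₁)) (inj₁ (b1 , f₂)) = inj₁ (mod6-* a b a1 b1 , λ z →
    trans (cong (f [_]) (∙-* a b z)) (trans (f₁ (b ∙ z)) (f₂ z)))
  invariant-* a b (inj₁ (a1 , f₁)) (inj₂ (b5 , f₂)) = inj₂ (mod6-* a b a1 b5 , λ z →
    trans (cong (f [_]) (∙-* a b z)) (trans (f₁ (b ∙ z)) (f₂ z)))
  invariant-* a b (inj₂ (a5 , f₁)) (inj₁ (b1 , f₂)) = inj₂ (mod6-* a b a5 b1 , λ z →
    trans (cong (f [_]) (∙-* a b z)) (trans (f₁ (b ∙ z)) (cong conjω (f₂ z))))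
  invariant-* a b (inj₂ (a5 , f₁)) (inj₂ (b5 , f₂)) = inj₁ (mod6-* a b a5 b5 , λ z →
    trans (cong (f [_]) (∙-* a b z)) (trans (f₁ (b ∙ z)) (trans (cong conjω (f₂ z)) (conjω-involutive (f [ z ])))))

  invariant-product : ∀ ps → All Prime ps → All (B ℕ.<_) ps → Invariant (product ps)
  invariant-product []       []         []         = inj₁ (refl , λ z → cong (f [_]) (∙-1 z))
  invariant-product (p ∷ ps) (pr ∷ prs) (B<p ∷ bs) =
    invariant-* p (product ps) (invariant-prime p pr B<p) (invariant-product ps prs bs)

  invariant-rough : ∀ k → 0 ℕ.< k → (∀ q → Prime q → q ∣ k → B ℕ.< q) → Invariant k
  invariant-rough k k>0 rough = subst Invariant (sym eq) (invariant-product ps prs (All.tabulate λ {q} q∈ →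
      rough q (All.lookup prs q∈) (subst (q ∣_) (sym eq) (∈⇒∣product q∈))))
    where
    F = factorise k {{ℕ.>-nonZero k>0}}
    ps = PrimeFactorisation.factors F
    prs = PrimeFactorisation.factorsPrime F
    eq = PrimeFactorisation.isFactorisation F

  -- The representative is taken modulo 3 m, not just m: it acts on z as k does and stays 1 modulo
  -- 3. Hence its residue modulo 6 cannot be 5, and the conjugating case is excluded.
  connection-invariant : ∀ z m → IsOrder Γ z m → ∀ k → Coprime k m → k % 3 ≡ 1 → f [ k ∙ z ] ≡ f [ z ]
  connection-invariant z m (m>0 , mz , _) k c k1 with rough-representative k (3 ℕ.* m) B
    (Coprimality.sym (coprime-* (prime-coprime k prime-3 λ 3∣k → 0≢1 (trans (sym (n∣m⇒m%n≡0 k 3 3∣k)) k1)) (Coprimality.sym c)))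
    where
    0≢1 : 0 ≢ 1
    0≢1 ()
  ... | t , rough = trans (cong (f [_]) (sym (∙-mod k (t ℕ.* 3) m z mz))) (conclude (invariant-rough k′ k′>0 rough′))
    where
    k′ = k ℕ.+ t ℕ.* 3 ℕ.* m
    k′≡ : k′ ≡ k ℕ.+ t ℕ.* (3 ℕ.* m)
    k′≡ = cong (k ℕ.+_) (ℕₚ.*-assoc t 3 m)
    k>0 : ∀ k → k % 3 ≡ 1 → 0 ℕ.< k
    k>0 (suc k) _ = s≤s z≤n
    k′>0 : 0 ℕ.< k′
    k′>0 = ℕₚ.≤-trans (k>0 k k1) (ℕₚ.m≤m+n k _)
    rough′ : ∀ q → Prime q → q ∣ k′ → B ℕ.< q
    rough′ q pr q∣ = rough q pr (subst (q ∣_) k′≡ q∣)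
    k′1 : k′ % 3 ≡ 1
    k′1 = trans (sym (mod3-reduce {r = k} t (m∣m*n m) k′≡)) k1
    conclude : Invariant k′ → f [ k′ ∙ z ] ≡ f [ z ]
    conclude (inj₁ (_ , fixed)) = fixed z
    conclude (inj₂ (k′5 , _)) with () ← trans (sym k′1) (%6⇒%3 k′ k′5)

  module _ (skew : SkewSymmetric Γ S) where

    closed-∙ : ∀ z m → IsOrder Γ z m → ∀ k → Coprime k m → k % 3 ≡ 1 → z ∈ₛ S → k ∙ z ∈ₛ S
    closed-∙ z m ord k c k1 z∈ = mem⇒∈ (first-true (mem Γ S (k ∙ z)) (mem Γ S (⊝ (k ∙ z))) (begin
      hsEntry (mem Γ S (k ∙ z)) (mem Γ S (⊝ (k ∙ z)))   ≡⟨ connection-[] (k ∙ z) ⟨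
      f [ k ∙ z ]                                       ≡⟨ connection-invariant z m ord k c k1 ⟩
      f [ z ]                                           ≡⟨ connection-[] z ⟩
      hsEntry (mem Γ S z) (mem Γ S (⊝ z))               ≡⟨ cong₂ hsEntry (∈⇒mem z∈) (∉⇒mem (skew z z∈)) ⟩
      ω₆                                                ∎))
      where
      open ≡-Reasoning
      first-true : ∀ a b → hsEntry a b ≡ ω₆ → a ≡ true
      first-true true  b     _  = refl
      first-true false true  ()
      first-true false false ()

    -- k = 2m² - 1 is ≡ -1 modulo m and ≡ 1 modulo 3 when 3 ∤ m.
    order-divisible : ∀ z m → IsOrder Γ z m → z ∈ₛ S → 3 ∣ m
    order-divisible z (suc m) ord@(_ , mz , _) z∈ with 3 ∣? suc m
    ... | yes 3∣m = 3∣m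
    ... | no 3∤m  = ⊥-elim (skew z z∈ (subst (_∈ₛ S) k∙z (closed-∙ z (suc m) ord k k-coprime k1 z∈)))
      where
      k = m ℕ.+ (m ℕ.+ m ℕ.* 2) ℕ.+ (m ℕ.* m ℕ.* 2 ℕ.+ 1)
      suc-k : suc k ≡ 2 ℕ.* suc m ℕ.* suc m
      suc-k = identity m
        where
        identity : ∀ m → suc (m ℕ.+ (m ℕ.+ m ℕ.* 2) ℕ.+ (m ℕ.* m ℕ.* 2 ℕ.+ 1)) ≡ 2 ℕ.* suc m ℕ.* suc m
        identity = solve-∀
      k∙z : k ∙ z ≡ ⊝ z
      k∙z = ⊝-power k z (trans (cong (_∙ z) suc-k) (*-kills (2 ℕ.* suc m) (suc m) z mz))
      k-coprime : Coprime k (suc m)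
      k-coprime {d} (d∣k , d∣m) = ∣1⇒≡1 (∣m+n∣m⇒∣n
        (subst (d ∣_) (trans (sym suc-k) (ℕₚ.+-comm 1 k)) (∣n⇒∣m*n (2 ℕ.* suc m) d∣m)) d∣k)
      square : (2 ℕ.* suc m ℕ.* suc m) % 3 ≡ 2
      square with mod3-cases (suc m)
      ... | inj₁ (inj₁ m0) = ⊥-elim (3∤m (m%n≡0⇒n∣m (suc m) 3 m0))
      ... | inj₁ (inj₂ m1) = mod3-* (2 ℕ.* suc m) (suc m) (mod3-* 2 (suc m) refl m1) m1
      ... | inj₂ m2        = mod3-* (2 ℕ.* suc m) (suc m) (mod3-* 2 (suc m) refl m2) m2
      k1 : k % 3 ≡ 1
      k1 with mod3-cases k
      ... | inj₁ (inj₂ e) = e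
      ... | inj₁ (inj₁ e) with () ← trans (sym square) (trans (cong (_% 3) (sym suc-k)) (trans (%-distribˡ-+ 1 k 3) (cong (λ r → (1 ℕ.+ r) % 3) e)))
      ... | inj₂ e        with () ← trans (sym square) (trans (cong (_% 3) (sym suc-k)) (trans (%-distribˡ-+ 1 k 3) (cong (λ r → (1 ℕ.+ r) % 3) e)))

    -- S is the union of the classes of its own elements: each element lies in its own class with
    -- exponent 1, and `closed-∙` keeps every class inside S.
    in-𝔼 : In𝔼 Γ S
    in-𝔼 = skew , members , All.tabulate in-Γ3 , λ y → mk⇔ (to y) (from y)
      where
      members : List G
      members = List.filter (λ z → z ∈ₛ? S) (List.allFin n)
      ∈-members : ∀ {z} → z ∈ members → z ∈ₛ S
      ∈-members z∈ = proj₂ (∈-filter⁻ (λ z → z ∈ₛ? S) {xs = List.allFin n} z∈)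
      in-Γ3 : ∀ {x} → x ∈ members → InΓ3 Γ x
      in-Γ3 {x} x∈ = let m , ord , _ = order x in m , ord , order-divisible x m ord (∈-members x∈)
      to : ∀ y → y ∈ₛ S → Any (λ x → In⟪_⟫ Γ x y) members
      to y y∈ = lose (∈-filter⁺ (λ z → z ∈ₛ? S) (∈-allFin y) y∈) class
        where
        class : In⟪_⟫ Γ y y
        class with order y
        ... | m , ord , _ = m , ord , 1 , s≤s z≤n ,
              -- The exponent 1 has to lie strictly below the order, which is at least 3.
              ℕₚ.<-≤-trans (s≤s (s≤s z≤n)) (∣⇒≤ {{ℕ.>-nonZero (proj₁ ord)}} (order-divisible y m ord y∈)) ,
              coprime⇒gcd≡1 (Coprimality.1-coprimeTo m) , refl , sym (∙-1 y)
      from : ∀ y → Any (λ x → In⟪_⟫ Γ x y) members → y ∈ₛ S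
      from y a with find a
      ... | x , x∈ , m , ord , k , _ , _ , c , k1 , refl = closed-∙ x m ord k (gcd≡1⇒coprime c) k1 (∈-members x∈)

-- From integer eigenvalues to an annihilating product

-- Agreement at integers alone does not permit substituting h. The difference of the two polynomials
-- therefore is first shown to have zero coefficients; then Cayley-Hamilton transfers to the product
-- over the λ.
integral⇒annihilated : ∀ Γ S → HSIntegral Γ S → ∃ λ L →
  RootProduct.rootProduct (GroupAlgebra.ringA ℤω-ring Γ) (CayleyGraph.connection Γ S) L ≡ GroupAlgebra.0A ℤω-ring Γ
integral⇒annihilated Γ S (λs , eq) = L , (begin
    RA.rootProduct f L                   ≡⟨ EA.ev-rootPoly f L ⟨
    EA.ev f (rootPoly L)                 ≡⟨ A.solve 2 (λ a b → b A.:= a A.:- (a A.:- b)) refl (EA.ev f p) (EA.ev f (rootPoly L)) ⟩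
    EA.ev f p A.- (EA.ev f p A.- EA.ev f (rootPoly L))
      ≡⟨ cong (λ c → EA.ev f p A.- c) (trans (sym (trans (EA.ev-⊞ f p (neg (rootPoly L))) (cong (EA.ev f p A.+_) (EA.ev-neg f (rootPoly L)))))
           (EA.ev-vanish f r r-vanish)) ⟩
    EA.ev f p A.- A.0#                   ≡⟨ cong (A._- A.0#) (charPoly-annihilates f) ⟩
    A.0# A.- A.0#                        ≡⟨ A.-‿inverseʳ A.0# ⟩
    A.0#                                 ∎)
  where
  open ≡-Reasoning
  open GroupAlgebra ℤω-ring Γ hiding (_⊞_)
  open CayleyGraph Γ S
  open ConvolutionCharPoly ℤω-ring Γ
  open Polynomial ℤω-ring
  open PolynomialMatrix ℤω-ring
  open Polynomial.Eval ℤω-ring (id-hom ℤω-ring)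
  module EA = Polynomial.Eval ℤω-ring constant
  module RA = RootProduct ringA
  f = connection
  p = charPoly (convMatrix f)
  L = Vec.toList (Vec.tabulate λs)
  r : Poly
  r = p ⊞ neg (rootPoly L)
  ev-p : ∀ t → ev (E.fromℤ t) p ≡ ev (E.fromℤ t) (rootPoly L)
  ev-p t = trans (sym (charPolyAt-ev t)) (trans (eq t) (trans (prodω-rootProduct t λs) (sym (ev-rootPoly (E.fromℤ t) L))))
  r-vanish : Vanishes≥ 0 r
  r-vanish = Splitting.vanishing ℤω-arithmetic r 1 ℕₚ.≤-refl λ t _ →
    trans (ev-⊞ (E.fromℕ t) p (neg (rootPoly L)))
      (trans (cong₂ _+ω_ (ev-p (pos t)) (ev-neg (E.fromℕ t) (rootPoly L))) (E.-‿inverseʳ (ev (E.fromℕ t) (rootPoly L))))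

theorem4p2 : (Γ : FinAbGroup) (S : Subset (FinAbGroup.n Γ)) →
    SkewSymmetric Γ S → FinAbGroup.𝟘 Γ ∉ S →
    HSIntegral Γ S ⇔ In𝔼 Γ S
theorem4p2 Γ S skew 0∉S = mk⇔
  (λ integral → let L , eq = integral⇒annihilated Γ S integral in GaloisInvariance.in-𝔼 Γ S L eq skew)
  (CayleyGraph.𝔼⇒integral Γ S)
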